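{- Let $G=\mathbb Z_6\times\mathbb Z_2$. Then $\mathcal S(G)$ is exactly the union of the following sets of integers, where in each case $m$ runs through all integers: (a) (values divisible by $3^3$) $3^3(4m-1)$, $2^4\cdot 3^3(2m-1)$, $2^6\cdot 3^3 m$; (b) (values exactly divisible by $3^2$) $3^2(4m-1)p$, $2^4\cdot 3^2(2m-1)p$, $2^6\cdot 3^2 mp$ for a prime $p\equiv 7\pmod{12}$; and $2^8\cdot 3^2(4m-1)$, $2^{10}\cdot 3^2(4m-1)$, $2^{12}\cdot 3^2(2m-1)$, $2^{14}\cdot 3^2 m$; (c) (values coprime to $3$) $12m+1$, $2^4(6m+1)$, $2^6(3m+1)$; and $(12m+5)k$, $-2^4(6m+1)k$, $-2^6(3m+1)k$, where $k=p$ for a prime $p\in\mathcal P_1$, or $k=p^2$ for a prime $p\equiv 5\pmod{12}$, or $k=p_1p_2$ for primes $p_1,p_2\equiv 7\pmod{12}$; and $2^8(12m+5)$, $2^8(12m+5)p$, $2^{10}(12m+5)$, $2^{10}(12m+5)p$ for a prime $p\equiv 7\pmod{12}$; and $-2^{12}(6m+1)$, $-2^{14}(3m+1)$.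
   Context: For a finite group $G=\{g_1,\dots,g_n\}$, assign an independent variable $x_g$ to each $g\in G$; the group determinant $\mathscr D_G(x_{g_1},\dots,x_{g_n})$ is the determinant of the $n\times n$ matrix whose $(i,j)$ entry is $x_{g_ig_j^{ -1}}$. Define $\mathcal S(G)=\{\mathscr D_G(x_{g_1},\dots,x_{g_n}) : x_{g_i}\in\mathbb Z\}$. Define $\mathcal P_1$ to be the set of primes $p\equiv 1\pmod{12}$ of the form $p=(6k+2)^2+(6t+3)^2$ for some integers $k,t$. (The remaining primes $p\equiv 1\pmod{12}$ are those of the form $(6k)^2+(6t+1)^2$.) -}

module Defs where

open import Data.Nat as ℕ using (ℕ; zero; suc)
open import Data.Nat.DivMod using (_mod_; _%_; _/_)
open import Data.Nat.Primality using (Prime)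
open import Data.Fin using (Fin; toℕ; punchIn) renaming (zero to fzero; suc to fsuc)
open import Data.Integer using (ℤ; +_; -_; _+_; _-_; _*_; _^_)
open import Data.Product using (∃; ∃-syntax; _×_)
open import Relation.Binary.PropositionalEquality using (_≡_)

sumFin : ∀ n → (Fin n → ℤ) → ℤ
sumFin zero    f = + 0
sumFin (suc n) f = f fzero + sumFin n (λ i → f (fsuc i))

det : ∀ n → (Fin n → Fin n → ℤ) → ℤ
det zero    M = + 1
det (suc n) M =
  sumFin (suc n) (λ j → ((- + 1) ^ toℕ j) * M fzero j * det n (λ r c → M (fsuc r) (punchIn j c)))

-- The group G = ℤ₆ × ℤ₂; its elements are indexed by Fin 12 via i ↦ (i mod 6, i div 6)
-- (this enumeration is a bijection Fin 12 ≃ ℤ₆ × ℤ₂).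
fst6 : Fin 12 → ℕ
fst6 i = toℕ i % 6

snd2 : Fin 12 → ℕ
snd2 i = toℕ i / 6

-- Group determinant of G with variables x : ℤ₆ → ℤ₂ → ℤ :
-- the (i,j) entry is x_{g_i g_j⁻¹} = x (a_i - a_j mod 6) (b_i - b_j mod 2)
groupMatrix : (Fin 6 → Fin 2 → ℤ) → Fin 12 → Fin 12 → ℤ
groupMatrix x i j =
  x ((fst6 i ℕ.+ 6 ℕ.∸ fst6 j) mod 6) ((snd2 i ℕ.+ 2 ℕ.∸ snd2 j) mod 2)

groupDet : (Fin 6 → Fin 2 → ℤ) → ℤ
groupDet x = det 12 (groupMatrix x)

InS : ℤ → Set
InS n = ∃[ x ] groupDet x ≡ n

P1 : ℕ → Set
P1 p = Prime p × p % 12 ≡ 1 ×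
  ∃[ k ] ∃[ t ] + p ≡ (+ 6 * k + + 2) ^ 2 + (+ 6 * t + + 3) ^ 2

Prime7 : ℕ → Set
Prime7 p = Prime p × p % 12 ≡ 7

Prime5 : ℕ → Set
Prime5 p = Prime p × p % 12 ≡ 5

data KVal : ℤ → Set where
  k-P1  : ∀ p → P1 p → KVal (+ p)
  k-sq5 : ∀ p → Prime5 p → KVal ((+ p) ^ 2)
  k-77  : ∀ p₁ p₂ → Prime7 p₁ → Prime7 p₂ → KVal ((+ p₁) * (+ p₂))

two three : ℤ
two = + 2
three = + 3

data Union : ℤ → Set where
  a1 : ∀ m → Union (three ^ 3 * (+ 4 * m - + 1))
  a2 : ∀ m → Union (two ^ 4 * three ^ 3 * (+ 2 * m - + 1))
  a3 : ∀ m → Union (two ^ 6 * three ^ 3 * m)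
  b1 : ∀ m p → Prime7 p → Union (three ^ 2 * (+ 4 * m - + 1) * + p)
  b2 : ∀ m p → Prime7 p → Union (two ^ 4 * three ^ 2 * (+ 2 * m - + 1) * + p)
  b3 : ∀ m p → Prime7 p → Union (two ^ 6 * three ^ 2 * m * + p)
  b4 : ∀ m → Union (two ^ 8 * three ^ 2 * (+ 4 * m - + 1))
  b5 : ∀ m → Union (two ^ 10 * three ^ 2 * (+ 4 * m - + 1))
  b6 : ∀ m → Union (two ^ 12 * three ^ 2 * (+ 2 * m - + 1))
  b7 : ∀ m → Union (two ^ 14 * three ^ 2 * m)
  c1 : ∀ m → Union (+ 12 * m + + 1)
  c2 : ∀ m → Union (two ^ 4 * (+ 6 * m + + 1))
  c3 : ∀ m → Union (two ^ 6 * (+ 3 * m + + 1))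
  c4 : ∀ m k → KVal k → Union ((+ 12 * m + + 5) * k)
  c5 : ∀ m k → KVal k → Union (- (two ^ 4) * (+ 6 * m + + 1) * k)
  c6 : ∀ m k → KVal k → Union (- (two ^ 6) * (+ 3 * m + + 1) * k)
  c7 : ∀ m → Union (two ^ 8 * (+ 12 * m + + 5))
  c8 : ∀ m p → Prime7 p → Union (two ^ 8 * (+ 12 * m + + 5) * + p)
  c9 : ∀ m → Union (two ^ 10 * (+ 12 * m + + 5))
  c10 : ∀ m p → Prime7 p → Union (two ^ 10 * (+ 12 * m + + 5) * + p)
  c11 : ∀ m → Union (- (two ^ 12) * (+ 6 * m + + 1))
  c12 : ∀ m → Union (- (two ^ 14) * (+ 3 * m + + 1))

{-# OPTIONS --safe #-}

-- The group ring of ℤ₆ × ℤ₂ = ℤ₃ × ℤ₂² decomposes over the four characters of ℤ₂². At each of them the determinant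
-- contributes n · N(E), with n an integer, E an Eisenstein integer and n ≡ E modulo √-3; the four n and the four E are
-- subject to congruences modulo 4 only. Hence 𝒮(G) consists of the products D · N(E), where D = n₁n₂n₃n₄ is
-- 1 mod 4, 2⁴ times an odd number or a multiple of 2⁶, and E = E₁E₂E₃E₄ satisfies E ≡ D mod √-3 and is either ωʲ mod 4
-- or divisible by 2⁴. The only subtle case is D ≡ -1 mod 3 with E odd. Then N(E) = u² + 12e² with u + 6e ≡ 5 mod 12;
-- since u + 6e mod 12 is multiplicative up to sign, some prime factor of N(E) must be responsible for u + 6e ≢ ±1:
-- an inert prime 5 mod 12 (squared), two primes 7 mod 12, or a prime p = u² + 12e² with u + 6e ≡ ±5 mod 12. The last are
-- the primes of 𝒫₁: writing p = A² + 9B² as well and factoring the difference of the two representations gives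
-- divisors of some x² - 3y², and those coprime to 6 are ±1 mod 12.
module Submission where

-- The determinant reveals only the product `D` · N(E), not E itself. The list can nevertheless be
-- short because `D` obeys congruences alone: once N(E) has a suitable divisor k, the cofactor is 1
-- mod 12 and is absorbed into `D`. The primes 7 mod 12 enter the multiples of 9 in the same way: if
-- E is odd and divisible by √-3, the norm of E/√-3 is 3 mod 4, and when it is prime to 3 it is 7
-- mod 12 and has such a prime factor. For E ≡ 1 mod 4, up to powers of ω, one has E = u + 2e√-3;
-- then u + 6e is 1 mod 4 and its residue mod 3 is E mod √-3. So `D` ≡ -1 mod 3 means exactly u + 6e
-- ≡ 5 mod 12. Neither unique factorisation in ℤ[ω] nor reciprocity is invoked. Primes are
-- represented by reducing forms of determinant 1 and 3, divisors of x² - 3y² by reducing forms of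
-- determinant -3, and square roots of -3 and -1 come from short orbits of x ↦ 1/(1 - x) and x ↦ (1
-- + x)/(1 - x).

open import Defs
open import Data.Bool as Bool using (Bool; true; false; _∧_; _∨_; not)
open import Data.Empty using (⊥; ⊥-elim)
open import Data.Fin as Fin using (Fin; toℕ; fromℕ<; punchIn; _↑ˡ_; _↑ʳ_; splitAt; #_) renaming
    (zero to fzero; suc to fsuc)
open import Data.Fin.Permutation using (Permutation′; permutation)
import Data.Fin.Properties as Finₚ
open import Data.Integer as ℤ using (ℤ; +_; -[1+_]; -_; _+_; _-_; _*_; _^_; ∣_∣)
open import Data.Integer.DivMod using (_%ℕ_; _/ℕ_; n%ℕd<d; a≡a%ℕn+[a/ℕn]*n)
open import Data.Integer.Divisibility.Signed using (divides; ∣ᵤ⇒∣; ∣⇒∣ᵤ; _∣?_) renaming (_∣_ to _∣ℤ_)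
import Data.Integer.Properties as ℤₚ
open import Data.Integer.Tactic.RingSolver using (solve-∀; solve)
open import Data.List using ([]; _∷_)
import Data.List.Relation.Unary.All as All
open import Data.Nat as ℕ using (ℕ; zero; suc; NonZero; z≤n; s≤s; _<ᵇ_)
open import Data.Nat.Coprimality using (Coprime; gcd≡1⇒coprime; coprime-Bézout)
import Data.Nat.Divisibility as ℕ
import Data.Nat.DivMod as ℕ
open import Data.Nat.DivMod using (_mod_)
open import Data.Nat.GCD using (gcd; gcd[m,n]∣m; gcd[m,n]∣n; module Bézout)
open import Data.Nat.Induction using (<-wellFounded)
open import Data.Nat.ListAction using (product)
open import Data.Nat.Primality using (Prime; euclidsLemma; prime⇒nonZero; prime⇒nonTrivial; prime⇒irreducible)
open import Data.Nat.Primality.Factorisation using (factorise)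
import Data.Nat.Properties as ℕₚ
open import Data.Product using (_×_; _,_; ∃-syntax; proj₁; proj₂)
open import Data.Sum using (_⊎_; inj₁; inj₂; [_,_]′)
open import Data.Unit using (tt)
open import Data.Vec as Vec using (Vec; lookup)
open import Data.Vec.Properties using (lookup-map)
open import Function using (_∘_)
open import Induction.WellFounded using (Acc; acc)
open import Relation.Binary.PropositionalEquality
open import Relation.Nullary using (¬_; yes; no; contradiction)
open import Relation.Nullary.Decidable using (True; toWitness)
open import Algebra.Properties.CommutativeMonoid.Sum ℕₚ.+-0-commutativeMonoid using
    (sum; sum-permute; ∑-distrib-+; sum-cong-≗)

-- Determinants

Matrix : ℕ → Set
Matrix n = Fin n → Fin n → ℤ

sgn : ∀ {n} → Fin n → ℤ
sgn j = (- + 1) ^ toℕ j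

sumFin-cong : ∀ n {f g : Fin n → ℤ} → (∀ i → f i ≡ g i) → sumFin n f ≡ sumFin n g
sumFin-cong zero    e = refl
sumFin-cong (suc n) e = cong₂ _+_ (e fzero) (sumFin-cong n (λ i → e (fsuc i)))

sumFin-0 : ∀ n {f : Fin n → ℤ} → (∀ i → f i ≡ + 0) → sumFin n f ≡ + 0
sumFin-0 zero    e = refl
sumFin-0 (suc n) e = cong₂ _+_ (e fzero) (sumFin-0 n (λ i → e (fsuc i)))

sumFin-linear : ∀ n t (f g : Fin n → ℤ) → sumFin n (λ i → t * f i + g i) ≡ t * sumFin n f + sumFin n g
sumFin-linear zero    t f g = cong (_+ + 0) (sym (ℤₚ.*-zeroʳ t))
sumFin-linear (suc n) t f g =
  trans (cong (λ z → t * f fzero + g fzero + z) (sumFin-linear n t (λ i → f (fsuc i)) (λ i → g (fsuc i))))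
        (regroup t (f fzero) (g fzero) _ _)
  where
  regroup : ∀ t a b c d → t * a + b + (t * c + d) ≡ t * (a + c) + (b + d)
  regroup = solve-∀

sumFin-*ˡ : ∀ n t (f : Fin n → ℤ) → t * sumFin n f ≡ sumFin n (λ i → t * f i)
sumFin-*ˡ zero    t f = ℤₚ.*-zeroʳ t
sumFin-*ˡ (suc n) t f = trans (ℤₚ.*-distribˡ-+ t _ _) (cong (λ z → t * f fzero + z) (sumFin-*ˡ n t (λ i → f (fsuc i))))

sumFin-+ : ∀ n (f g : Fin n → ℤ) → sumFin n (λ i → f i + g i) ≡ sumFin n f + sumFin n g
sumFin-+ zero    f g = refl
sumFin-+ (suc n) f g =
  trans (cong (λ z → f fzero + g fzero + z) (sumFin-+ n (λ i → f (fsuc i)) (λ i → g (fsuc i))))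
      (regroup (f fzero) (g fzero) _ _)
  where
  regroup : ∀ a b c d → a + b + (c + d) ≡ a + c + (b + d)
  regroup = solve-∀

sumFin-swap : ∀ m n (f : Fin m → Fin n → ℤ) →
  sumFin m (λ i → sumFin n (f i)) ≡ sumFin n (λ j → sumFin m (λ i → f i j))
sumFin-swap zero    n f = sym (sumFin-0 n (λ _ → refl))
sumFin-swap (suc m) n f =
  trans (cong (λ z → sumFin n (f fzero) + z) (sumFin-swap m n (λ i → f (fsuc i)))) (sym (sumFin-+ n (f fzero) _))

sumFin-++ : ∀ m n (f : Fin (m ℕ.+ n) → ℤ) →
  sumFin (m ℕ.+ n) f ≡ sumFin m (λ i → f (i ↑ˡ n)) + sumFin n (λ i → f (m ↑ʳ i))
sumFin-++ zero    n f = sym (ℤₚ.+-identityˡ _)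
sumFin-++ (suc m) n f =
  trans (cong (λ z → f fzero + z) (sumFin-++ m n (λ i → f (fsuc i)))) (sym (ℤₚ.+-assoc (f fzero) _ _))

det-cong : ∀ n {M N : Matrix n} → (∀ i j → M i j ≡ N i j) → det n M ≡ det n N
det-cong zero    e = refl
det-cong (suc n) {M} {N} e = sumFin-cong (suc n) λ j →
  cong₂ _*_ (cong (sgn j *_) (e fzero j)) (det-cong n (λ r c → e (fsuc r) (punchIn j c)))

minor : ∀ {n} → Matrix (suc n) → Fin (suc n) → Fin (suc n) → Matrix n
minor M i j r c = M (punchIn i r) (punchIn j c)

-- Expanding each first-row minor along its own first column gives a double sum over a row and a
-- column; exchanging the summations regroups it as the expansion along the first column.
laplace-column : ∀ n (M : Matrix (suc n)) →
  det (suc n) M ≡ sumFin (suc n) (λ i → sgn i * M i fzero * det n (minor M i fzero))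
laplace-column zero    M = refl
laplace-column (suc n) M = cong (λ z → + 1 * M fzero fzero * det (suc n) (minor M fzero fzero) + z) (begin
    sumFin (suc n) (λ k → sgn (fsuc k) * M fzero (fsuc k) * det (suc n) (minor M fzero (fsuc k)))
  ≡⟨ sumFin-cong (suc n) (λ k → trans
      (cong (sgn (fsuc k) * M fzero (fsuc k) *_) (laplace-column n (minor M fzero (fsuc k))))
                                       (sumFin-*ˡ (suc n) (sgn (fsuc k) * M fzero (fsuc k))
                                           (λ i → sgn i * M (fsuc i) fzero * D i k))) ⟩
    sumFin (suc n) (λ k → sumFin (suc n) (λ i → sgn (fsuc k) * M fzero (fsuc k) * (sgn i * M (fsuc i) fzero * D i k)))
  ≡⟨ sumFin-swap (suc n) (suc n) (λ k i → sgn (fsuc k) * M fzero (fsuc k) * (sgn i * M (fsuc i) fzero * D i k)) ⟩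
    sumFin (suc n) (λ i → sumFin (suc n) (λ k → sgn (fsuc k) * M fzero (fsuc k) * (sgn i * M (fsuc i) fzero * D i k)))
  ≡⟨ sumFin-cong (suc n) (λ i → sumFin-cong (suc n)
      (λ k → exchange (sgn k) (M fzero (fsuc k)) (sgn i) (M (fsuc i) fzero) (D i k))) ⟩
    sumFin (suc n) (λ i → sumFin (suc n) (λ k → sgn (fsuc i) * M (fsuc i) fzero * (sgn k * M fzero (fsuc k) * D i k)))
  ≡⟨ sumFin-cong (suc n) (λ i → sumFin-*ˡ (suc n) (sgn (fsuc i) * M (fsuc i) fzero)
      (λ k → sgn k * M fzero (fsuc k) * D i k)) ⟨
    sumFin (suc n) (λ i → sgn (fsuc i) * M (fsuc i) fzero * det (suc n) (minor M (fsuc i) fzero)) ∎)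
  where
  open ≡-Reasoning
  D : Fin (suc n) → Fin (suc n) → ℤ
  D i k = det n (λ r c → M (fsuc (punchIn i r)) (fsuc (punchIn k c)))
  exchange : ∀ s x t y d → (- + 1 * s) * x * (t * y * d) ≡ (- + 1 * t) * y * (s * x * d)
  exchange = solve-∀

det-transpose : ∀ n (M : Matrix n) → det n (λ i j → M j i) ≡ det n M
det-transpose zero    M = refl
det-transpose (suc n) M = trans
  (sumFin-cong (suc n) (λ j → cong (sgn j * M j fzero *_) (det-transpose n (minor M j fzero))))
  (sym (laplace-column n M))

cofactor : ∀ {n} → Matrix (suc n) → Fin (suc n) → ℤ
cofactor {n} M j = sgn j * M fzero j * det n (minor M fzero j)

det-row-linear : ∀ n (k : Fin n) t (M M₁ M₂ : Matrix n) →
  (∀ c → M k c ≡ t * M₁ k c + M₂ k c) →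
  (∀ r → r ≢ k → ∀ c → M r c ≡ M₁ r c) → (∀ r → r ≢ k → ∀ c → M r c ≡ M₂ r c) →
  det n M ≡ t * det n M₁ + det n M₂
det-row-linear (suc n) fzero t M M₁ M₂ e e₁ e₂ = trans
  (sumFin-cong (suc n) λ j → trans
    (cong (λ z → sgn j * z * det n (minor M fzero j)) (e j))
    (trans (expand (sgn j) t (M₁ fzero j) (M₂ fzero j) _)
      (cong₂ (λ x y → t * (sgn j * M₁ fzero j * x) + sgn j * M₂ fzero j * y)
        (det-cong n (λ r c → e₁ (fsuc r) (λ ()) _)) (det-cong n (λ r c → e₂ (fsuc r) (λ ()) _)))))
  (sumFin-linear (suc n) t (cofactor M₁) (cofactor M₂))
  where
  expand : ∀ s t a b d → s * (t * a + b) * d ≡ t * (s * a * d) + s * b * d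
  expand = solve-∀
det-row-linear (suc n) (fsuc k) t M M₁ M₂ e e₁ e₂ = trans
  (sumFin-cong (suc n) λ j → trans
    (cong (sgn j * M fzero j *_)
      (det-row-linear n k t (minor M fzero j) (minor M₁ fzero j) (minor M₂ fzero j)
        (λ c → e _) (λ r ne c → e₁ (fsuc r) (λ q → ne (Finₚ.suc-injective q)) _)
        (λ r ne c → e₂ (fsuc r) (λ q → ne (Finₚ.suc-injective q)) _)))
    (trans (expand (sgn j) t (M fzero j) _ _)
      (cong₂ (λ x y → t * (sgn j * x * det n (minor M₁ fzero j)) + sgn j * y * det n (minor M₂ fzero j))
        (e₁ fzero (λ ()) j) (e₂ fzero (λ ()) j))))
  (sumFin-linear (suc n) t (cofactor M₁) (cofactor M₂))
  where
  expand : ∀ s t a d₁ d₂ → s * a * (t * d₁ + d₂) ≡ t * (s * a * d₁) + s * a * d₂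
  expand = solve-∀

-- In the expansion along the first column the first two terms have equal minors and opposite signs;
-- every other minor again has its first two rows equal.
det-rows01-equal : ∀ n (M : Matrix (suc (suc n))) → (∀ c → M fzero c ≡ M (fsuc fzero) c) → det (suc (suc n)) M ≡ + 0
det-rows01-equal n M e = begin
    det (suc (suc n)) M
  ≡⟨ laplace-column (suc n) M ⟩
    + 1 * M fzero fzero * D₀ + ((- + 1 * + 1) * M (fsuc fzero) fzero * D₁ + rest)
  ≡⟨ cong₂ (λ x y → + 1 * x * D₀ + ((- + 1 * + 1) * M (fsuc fzero) fzero * D₁ + y)) (e fzero) (rest≡0 n M e) ⟩
    + 1 * M (fsuc fzero) fzero * D₀ + ((- + 1 * + 1) * M (fsuc fzero) fzero * D₁ + + 0)
  ≡⟨ cong (λ x → + 1 * M (fsuc fzero) fzero * x + ((- + 1 * + 1) * M (fsuc fzero) fzero * D₁ + + 0))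
          (det-cong (suc n) {minor M fzero fzero} {minor M (fsuc fzero) fzero}
              λ { fzero c → sym (e (fsuc c)) ; (fsuc r) c → refl }) ⟩
    + 1 * M (fsuc fzero) fzero * D₁ + ((- + 1 * + 1) * M (fsuc fzero) fzero * D₁ + + 0)
  ≡⟨ cancel (M (fsuc fzero) fzero) D₁ ⟩
    + 0 ∎
  where
  open ≡-Reasoning
  D₀ = det (suc n) (minor M fzero fzero)
  D₁ = det (suc n) (minor M (fsuc fzero) fzero)
  rest = sumFin n (λ i → sgn (fsuc (fsuc i)) * M (fsuc (fsuc i)) fzero * det (suc n) (minor M (fsuc (fsuc i)) fzero))
  cancel : ∀ a d → + 1 * a * d + ((- + 1 * + 1) * a * d + + 0) ≡ + 0
  cancel = solve-∀
  rest≡0 : ∀ n (M : Matrix (suc (suc n))) → (∀ c → M fzero c ≡ M (fsuc fzero) c) →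
    sumFin n (λ i → sgn (fsuc (fsuc i)) * M (fsuc (fsuc i)) fzero * det (suc n) (minor M (fsuc (fsuc i)) fzero)) ≡ + 0
  rest≡0 zero    M e = refl
  rest≡0 (suc n) M e = sumFin-0 (suc n) λ i → trans
    (cong (sgn (fsuc (fsuc i)) * M (fsuc (fsuc i)) fzero *_)
      (det-rows01-equal n (minor M (fsuc (fsuc i)) fzero) (λ c → e (fsuc c))))
    (ℤₚ.*-zeroʳ (sgn (fsuc (fsuc i)) * M (fsuc (fsuc i)) fzero))

infixr 5 _◂_
_◂_ : ∀ {a} {A : Set a} {n} → A → (Fin n → A) → Fin (suc n) → A
(v ◂ R) fzero    = v
(v ◂ R) (fsuc i) = R i

-- Polarisation: put u + v into both rows and expand by linearity; the terms with a repeated row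
-- vanish.
det-swap01 : ∀ n (u v : Fin (suc (suc n)) → ℤ) (R : Fin n → Fin (suc (suc n)) → ℤ) →
  det (suc (suc n)) (v ◂ u ◂ R) ≡ - det (suc (suc n)) (u ◂ v ◂ R)
det-swap01 n u v R = solve₀ (D u v) (D v u) (begin
    + 0                                  ≡⟨ det-rows01-equal n (w ◂ w ◂ R) (λ _ → refl) ⟨
    D w w                                ≡⟨ first u v w ⟩
    + 1 * D u w + D v w                  ≡⟨ cong₂ (λ x y → + 1 * x + y) (second u) (second v) ⟩
    + 1 * (+ 1 * D u u + D u v) + (+ 1 * D v u + D v v)
      ≡⟨ cong₂ (λ x y → + 1 * (+ 1 * x + D u v) + (+ 1 * D v u + y))
           (det-rows01-equal n (u ◂ u ◂ R) (λ _ → refl)) (det-rows01-equal n (v ◂ v ◂ R) (λ _ → refl)) ⟩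
    + 1 * (+ 1 * + 0 + D u v) + (+ 1 * D v u + + 0) ∎)
  where
  open ≡-Reasoning
  w : Fin (suc (suc n)) → ℤ
  w c = + 1 * u c + v c
  D : (x y : Fin (suc (suc n)) → ℤ) → ℤ
  D x y = det (suc (suc n)) (x ◂ y ◂ R)
  first : ∀ x y z → D w z ≡ + 1 * D u z + D v z
  first x y z = det-row-linear (suc (suc n)) fzero (+ 1) (w ◂ z ◂ R) (u ◂ z ◂ R) (v ◂ z ◂ R) (λ _ → refl)
    (λ { fzero ne → ⊥-elim (ne refl) ; (fsuc r) _ c → refl })
    (λ { fzero ne → ⊥-elim (ne refl) ; (fsuc r) _ c → refl })
  second : ∀ x → D x w ≡ + 1 * D x u + D x v
  second x = det-row-linear (suc (suc n)) (fsuc fzero) (+ 1) (x ◂ w ◂ R) (x ◂ u ◂ R) (x ◂ v ◂ R) (λ _ → refl)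
    (λ { fzero _ c → refl ; (fsuc fzero) ne → ⊥-elim (ne refl) ; (fsuc (fsuc r)) _ c → refl })
    (λ { fzero _ c → refl ; (fsuc fzero) ne → ⊥-elim (ne refl) ; (fsuc (fsuc r)) _ c → refl })
  solve₀ : ∀ x y → + 0 ≡ + 1 * (+ 1 * + 0 + x) + (+ 1 * y + + 0) → y ≡ - x
  solve₀ x y eq = trans (lemma x y) (trans (cong (λ z → - x + z) (sym eq)) (ℤₚ.+-identityʳ (- x)))
    where
    lemma : ∀ x y → y ≡ - x + (+ 1 * (+ 1 * + 0 + x) + (+ 1 * y + + 0))
    lemma = solve-∀

-- Two equal rows below the first survive in every minor of the first-row expansion. If the first
-- row is one of them, exchanging it with the second produces such a pair.
det-equal-rows : ∀ n (M : Matrix n) (k l : Fin n) → k ≢ l → (∀ c → M k c ≡ M l c) → det n M ≡ + 0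
det-row0-equal : ∀ n (M : Matrix (suc n)) (l : Fin n) → (∀ c → M fzero c ≡ M (fsuc l) c) → det (suc n) M ≡ + 0

det-equal-rows (suc n) M fzero fzero ne e = ⊥-elim (ne refl)
det-equal-rows (suc n) M (fsuc k) (fsuc l) ne e = sumFin-0 (suc n) λ j → trans
  (cong (sgn j * M fzero j *_) (det-equal-rows n (minor M fzero j) k l (λ q → ne (cong fsuc q)) (λ c → e _)))
  (ℤₚ.*-zeroʳ (sgn j * M fzero j))
det-equal-rows (suc n) M fzero (fsuc l) ne e = det-row0-equal n M l e
det-equal-rows (suc n) M (fsuc l) fzero ne e = det-row0-equal n M l (λ c → sym (e c))

det-row0-equal (suc n) M fzero e = det-rows01-equal n M e
det-row0-equal (suc n) M (fsuc l) e = begin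
    det (suc (suc n)) M
  ≡⟨ det-cong (suc (suc n)) {M} {M fzero ◂ M (fsuc fzero) ◂ R}
      (λ { fzero c → refl ; (fsuc fzero) c → refl ; (fsuc (fsuc r)) c → refl }) ⟩
    det (suc (suc n)) (M fzero ◂ M (fsuc fzero) ◂ R)
  ≡⟨ det-swap01 n (M (fsuc fzero)) (M fzero) R ⟩
    - det (suc (suc n)) M′
  ≡⟨ cong -_ (sumFin-0 (suc (suc n)) λ j → trans
       (cong (sgn j * M′ fzero j *_) (det-equal-rows (suc n) (minor M′ fzero j) fzero (fsuc l) (λ ()) (λ c → e _)))
       (ℤₚ.*-zeroʳ (sgn j * M′ fzero j))) ⟩
    + 0 ∎
  where
  open ≡-Reasoning
  R : Fin n → Fin (suc (suc n)) → ℤ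
  R r = M (fsuc (fsuc r))
  M′ : Matrix (suc (suc n))
  M′ = M (fsuc fzero) ◂ M fzero ◂ R

det-add-row : ∀ n (k l : Fin n) → l ≢ k → ∀ t (M M′ : Matrix n) →
  (∀ c → M′ k c ≡ t * M l c + M k c) → (∀ r → r ≢ k → ∀ c → M′ r c ≡ M r c) → det n M′ ≡ det n M
det-add-row n k l l≢k t M M′ e e′ = trans
  (det-row-linear n k t M′ N M (λ c → trans (e c) (cong (λ z → t * z + M k c) (sym (N-k c))))
    (λ r ne c → trans (e′ r ne c) (sym (N-other r ne c))) e′)
  (trans (cong (λ z → t * z + det n M)
      (det-equal-rows n N k l (λ q → l≢k (sym q)) (λ c → trans (N-k c) (sym (N-other l l≢k c)))))
    (trans (cong (_+ det n M) (ℤₚ.*-zeroʳ t)) (ℤₚ.+-identityˡ (det n M))))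
  where
  N : Matrix n
  N r with r Fin.≟ k
  ... | yes _ = M l
  ... | no  _ = M r
  N-k : ∀ c → N k c ≡ M l c
  N-k c with k Fin.≟ k
  ... | yes _ = refl
  ... | no ne = ⊥-elim (ne refl)
  N-other : ∀ r → r ≢ k → ∀ c → N r c ≡ M r c
  N-other r ne c with r Fin.≟ k
  ... | yes q = ⊥-elim (ne q)
  ... | no _  = refl

-- The rows are processed one at a time; t r * t (g r) ≡ 0 says that the row being added has not been modified itself.
det-add-rows : ∀ n (M : Matrix n) (t : Fin n → ℤ) (g : Fin n → Fin n) →
  (∀ r → g r ≢ r) → (∀ r → t r * t (g r) ≡ + 0) →
  det n (λ r c → t r * M (g r) c + M r c) ≡ det n M
det-add-rows n M t g g≢ tt≡0 = trans (det-cong n (λ r c → sym (stage-all r c))) (stages n ℕₚ.≤-refl)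
  where
  stage : ℕ → Matrix n
  stage k r c with toℕ r ℕ.<? k
  ... | yes _ = t r * M (g r) c + M r c
  ... | no  _ = M r c
  stage-done : ∀ k r c → toℕ r ℕ.< k → stage k r c ≡ t r * M (g r) c + M r c
  stage-done k r c r<k with toℕ r ℕ.<? k
  ... | yes _ = refl
  ... | no r≮k = contradiction r<k r≮k
  stage-todo : ∀ k r c → k ℕ.≤ toℕ r → stage k r c ≡ M r c
  stage-todo k r c k≤r with toℕ r ℕ.<? k
  ... | yes r<k = contradiction k≤r (ℕₚ.<⇒≱ r<k)
  ... | no _ = refl
  stage-all : ∀ r c → stage n r c ≡ t r * M (g r) c + M r c
  stage-all r c = stage-done n r c (Finₚ.toℕ<n r)
  stage-g : ∀ k r c → t r * stage k (g r) c ≡ t r * M (g r) c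
  stage-g k r c with toℕ (g r) ℕ.<? k
  ... | no _  = refl
  ... | yes _ = trans (expand (t r) (t (g r)) (M (g (g r)) c) (M (g r) c))
                  (trans (cong (λ z → z * M (g (g r)) c + t r * M (g r) c) (tt≡0 r)) (ℤₚ.+-identityˡ (t r * M (g r) c)))
    where
    expand : ∀ a b x y → a * (b * x + y) ≡ a * b * x + a * y
    expand = solve-∀
  stages : ∀ k → k ℕ.≤ n → det n (stage k) ≡ det n M
  stages zero    _   = det-cong n (λ r c → stage-todo zero r c ℕ.z≤n)
  stages (suc k) k<n = trans (det-add-row n r (g r) (g≢ r) (t r) (stage k) (stage (suc k)) at-r elsewhere)
                             (stages k (ℕₚ.<⇒≤ k<n))
    where
    r : Fin n
    r = Fin.fromℕ< k<n
    toℕ-r : toℕ r ≡ k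
    toℕ-r = Finₚ.toℕ-fromℕ< k<n
    at-r : ∀ c → stage (suc k) r c ≡ t r * stage k (g r) c + stage k r c
    at-r c = trans (stage-done (suc k) r c (ℕ.s≤s (ℕₚ.≤-reflexive toℕ-r)))
      (sym (cong₂ _+_ (stage-g k r c) (stage-todo k r c (ℕₚ.≤-reflexive (sym toℕ-r)))))
    elsewhere : ∀ s → s ≢ r → ∀ c → stage (suc k) s c ≡ stage k s c
    elsewhere s s≢r c with toℕ s ℕ.<? k
    ... | yes s<k = stage-done (suc k) s c (ℕₚ.m<n⇒m<1+n s<k)
    ... | no s≮k = stage-todo (suc k) s c (ℕₚ.≤∧≢⇒< (ℕₚ.≮⇒≥ s≮k)
                     (λ q → s≢r (Finₚ.toℕ-injective (trans (sym q) (sym toℕ-r)))))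

punchIn-↑ˡ : ∀ {m} n (i : Fin (suc m)) (j : Fin m) → punchIn (i ↑ˡ n) (j ↑ˡ n) ≡ punchIn i j ↑ˡ n
punchIn-↑ˡ n fzero    j        = refl
punchIn-↑ˡ n (fsuc i) fzero    = refl
punchIn-↑ˡ n (fsuc i) (fsuc j) = cong fsuc (punchIn-↑ˡ n i j)

punchIn-↑ʳ : ∀ m {n} (i : Fin (suc m)) (j : Fin n) → punchIn (i ↑ˡ n) (m ↑ʳ j) ≡ suc m ↑ʳ j
punchIn-↑ʳ m       fzero    j = refl
punchIn-↑ʳ (suc m) (fsuc i) j = cong fsuc (punchIn-↑ʳ m i j)

toℕ-sgn : ∀ {m} n (i : Fin m) → sgn (i ↑ˡ n) ≡ sgn i
toℕ-sgn n i = cong ((- + 1) ^_) (Finₚ.toℕ-↑ˡ i n)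

det-block-triangular : ∀ m n (M : Matrix (m ℕ.+ n)) → (∀ i j → M (i ↑ˡ n) (m ↑ʳ j) ≡ + 0) →
  det (m ℕ.+ n) M ≡ det m (λ i j → M (i ↑ˡ n) (j ↑ˡ n)) * det n (λ i j → M (m ↑ʳ i) (m ↑ʳ j))
det-block-triangular zero    n M z = sym (ℤₚ.*-identityˡ _)
det-block-triangular (suc m) n M z = begin
    det (suc m ℕ.+ n) M
  ≡⟨ sumFin-++ (suc m) n term ⟩
    sumFin (suc m) (λ j → term (j ↑ˡ n)) + sumFin n (λ j → term (suc m ↑ʳ j))
  ≡⟨ cong₂ _+_ (sumFin-cong (suc m) left) (sumFin-0 n right) ⟩
    sumFin (suc m) (λ j → R * (sgn j * P fzero j * det m (minor P fzero j))) + + 0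
  ≡⟨ ℤₚ.+-identityʳ (sumFin (suc m) (λ j → R * (sgn j * P fzero j * det m (minor P fzero j)))) ⟩
    sumFin (suc m) (λ j → R * (sgn j * P fzero j * det m (minor P fzero j)))
  ≡⟨ sumFin-*ˡ (suc m) R (cofactor P) ⟨
    R * det (suc m) P
  ≡⟨ ℤₚ.*-comm R (det (suc m) P) ⟩
    det (suc m) P * R ∎
  where
  open ≡-Reasoning
  P : Matrix (suc m)
  P i j = M (i ↑ˡ n) (j ↑ˡ n)
  R : ℤ
  R = det n (λ i j → M (suc m ↑ʳ i) (suc m ↑ʳ j))
  term : Fin (suc m ℕ.+ n) → ℤ
  term j = sgn j * M fzero j * det (m ℕ.+ n) (minor M fzero j)
  rearrange : ∀ s x d r → s * x * (d * r) ≡ r * (s * x * d)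
  rearrange = solve-∀
  left : ∀ j → term (j ↑ˡ n) ≡ R * (sgn j * P fzero j * det m (minor P fzero j))
  left j = trans (cong₂ (λ s d → s * P fzero j * d) (toℕ-sgn n j)
      (trans (det-block-triangular m n (minor M fzero (j ↑ˡ n))
               (λ i k → trans (cong (M (fsuc i ↑ˡ n)) (punchIn-↑ʳ m j k)) (z (fsuc i) k)))
        (cong₂ _*_ (det-cong m (λ r c → cong (M (fsuc r ↑ˡ n)) (punchIn-↑ˡ n j c)))
                   (det-cong n (λ r c → cong (M (suc m ↑ʳ r)) (punchIn-↑ʳ m j c))))))
    (rearrange (sgn j) (P fzero j) (det m (minor P fzero j)) R)
  right : ∀ j → term (suc m ↑ʳ j) ≡ + 0
  right j = trans (cong (λ x → sgn (suc m ↑ʳ j) * x * det (m ℕ.+ n) (minor M fzero (suc m ↑ʳ j))) (z fzero j))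
    (trans (cong (_* det (m ℕ.+ n) (minor M fzero (suc m ↑ʳ j))) (ℤₚ.*-zeroʳ (sgn (suc m ↑ʳ j))))
        (ℤₚ.*-zeroˡ (det (m ℕ.+ n) (minor M fzero (suc m ↑ʳ j)))))

opposite : ∀ n → Fin (n ℕ.+ n) → Fin (n ℕ.+ n)
opposite n r with splitAt n r
... | inj₁ i = n ↑ʳ i
... | inj₂ i = i ↑ˡ n

byHalf : ∀ n → ℤ → ℤ → Fin (n ℕ.+ n) → ℤ
byHalf n x y r with splitAt n r
... | inj₁ _ = x
... | inj₂ _ = y

opposite-↑ˡ : ∀ n (i : Fin n) → opposite n (i ↑ˡ n) ≡ n ↑ʳ i
opposite-↑ˡ n i rewrite Finₚ.splitAt-↑ˡ n i n = refl

opposite-↑ʳ : ∀ n (i : Fin n) → opposite n (n ↑ʳ i) ≡ i ↑ˡ n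
opposite-↑ʳ n i rewrite Finₚ.splitAt-↑ʳ n n i = refl

byHalf-↑ˡ : ∀ n x y (i : Fin n) → byHalf n x y (i ↑ˡ n) ≡ x
byHalf-↑ˡ n x y i rewrite Finₚ.splitAt-↑ˡ n i n = refl

byHalf-↑ʳ : ∀ n x y (i : Fin n) → byHalf n x y (n ↑ʳ i) ≡ y
byHalf-↑ʳ n x y i rewrite Finₚ.splitAt-↑ʳ n n i = refl

halves : ∀ n {ℓ} (P : Fin (n ℕ.+ n) → Set ℓ) → (∀ i → P (i ↑ˡ n)) → (∀ i → P (n ↑ʳ i)) → ∀ r → P r
halves n P l r k with splitAt n k in eq
... | inj₁ i = subst P (Finₚ.splitAt⁻¹-↑ˡ eq) (l i)
... | inj₂ i = subst P (Finₚ.splitAt⁻¹-↑ʳ eq) (r i)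

↑ʳ≢↑ˡ : ∀ n (i j : Fin n) → n ↑ʳ i ≢ j ↑ˡ n
↑ʳ≢↑ˡ n i j q with trans (sym (Finₚ.splitAt-↑ʳ n n i)) (trans (cong (splitAt n) q) (Finₚ.splitAt-↑ˡ n j n))
... | ()

opposite≢ : ∀ n r → opposite n r ≢ r
opposite≢ n = halves n (λ r → opposite n r ≢ r)
  (λ i q → ↑ʳ≢↑ˡ n i i (trans (sym (opposite-↑ˡ n i)) q))
  (λ i q → ↑ʳ≢↑ˡ n i i (trans (sym q) (opposite-↑ʳ n i)))

byHalf-opposite : ∀ n x y → x * y ≡ + 0 → ∀ r → byHalf n x y r * byHalf n x y (opposite n r) ≡ + 0
byHalf-opposite n x y xy≡0 = halves n (λ r → byHalf n x y r * byHalf n x y (opposite n r) ≡ + 0)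
  (λ i → trans (cong₂ _*_ (byHalf-↑ˡ n x y i) (trans (cong (byHalf n x y) (opposite-↑ˡ n i)) (byHalf-↑ʳ n x y i))) xy≡0)
  (λ i → trans (cong₂ _*_ (byHalf-↑ʳ n x y i) (trans (cong (byHalf n x y) (opposite-↑ʳ n i)) (byHalf-↑ˡ n x y i)))
           (trans (ℤₚ.*-comm y x) xy≡0))

-- Adding the lower rows to the upper ones and then subtracting the left columns from the right ones
-- turns [[A,B],[B,A]] into [[A+B,0],[B,A-B]].
det-block-circulant : ∀ n (M : Matrix (n ℕ.+ n)) →
  (∀ i j → M (n ↑ʳ i) (n ↑ʳ j) ≡ M (i ↑ˡ n) (j ↑ˡ n)) →
  (∀ i j → M (n ↑ʳ i) (j ↑ˡ n) ≡ M (i ↑ˡ n) (n ↑ʳ j)) →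
  det (n ℕ.+ n) M ≡ det n (λ i j → M (i ↑ˡ n) (j ↑ˡ n) + M (i ↑ˡ n) (n ↑ʳ j))
                  * det n (λ i j → M (i ↑ˡ n) (j ↑ˡ n) - M (i ↑ˡ n) (n ↑ʳ j))
det-block-circulant n M diagonal offDiagonal = begin
    det (n ℕ.+ n) M
  ≡⟨ det-add-rows (n ℕ.+ n) M t g (opposite≢ n) (byHalf-opposite n (+ 1) (+ 0) refl) ⟨
    det (n ℕ.+ n) M₁
  ≡⟨ det-transpose (n ℕ.+ n) M₁ ⟨
    det (n ℕ.+ n) (λ r c → M₁ c r)
  ≡⟨ det-add-rows (n ℕ.+ n) (λ r c → M₁ c r) s g (opposite≢ n) (byHalf-opposite n (+ 0) (- + 1) refl) ⟨
    det (n ℕ.+ n) (λ r c → M₂ c r)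
  ≡⟨ det-transpose (n ℕ.+ n) M₂ ⟩
    det (n ℕ.+ n) M₂
  ≡⟨ det-block-triangular n n M₂ upperRight ⟩
    det n (λ i j → M₂ (i ↑ˡ n) (j ↑ˡ n)) * det n (λ i j → M₂ (n ↑ʳ i) (n ↑ʳ j))
  ≡⟨ cong₂ _*_ (det-cong n upperLeft) (det-cong n lowerRight) ⟩
    det n (λ i j → M (i ↑ˡ n) (j ↑ˡ n) + M (i ↑ˡ n) (n ↑ʳ j)) * det n
        (λ i j → M (i ↑ˡ n) (j ↑ˡ n) - M (i ↑ˡ n) (n ↑ʳ j)) ∎
  where
  open ≡-Reasoning
  g = opposite n
  t = byHalf n (+ 1) (+ 0)
  s = byHalf n (+ 0) (- + 1)
  M₁ M₂ : Matrix (n ℕ.+ n)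
  M₁ r c = t r * M (g r) c + M r c
  M₂ r c = s c * M₁ r (g c) + M₁ r c
  M₁-upper : ∀ i c → M₁ (i ↑ˡ n) c ≡ + 1 * M (n ↑ʳ i) c + M (i ↑ˡ n) c
  M₁-upper i c = cong₂ (λ x y → x * M y c + M (i ↑ˡ n) c) (byHalf-↑ˡ n (+ 1) (+ 0) i) (opposite-↑ˡ n i)
  M₁-lower : ∀ i c → M₁ (n ↑ʳ i) c ≡ + 0 * M (i ↑ˡ n) c + M (n ↑ʳ i) c
  M₁-lower i c = cong₂ (λ x y → x * M y c + M (n ↑ʳ i) c) (byHalf-↑ʳ n (+ 1) (+ 0) i) (opposite-↑ʳ n i)
  M₂-left : ∀ r j → M₂ r (j ↑ˡ n) ≡ + 0 * M₁ r (n ↑ʳ j) + M₁ r (j ↑ˡ n)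
  M₂-left r j = cong₂ (λ x y → x * M₁ r y + M₁ r (j ↑ˡ n)) (byHalf-↑ˡ n (+ 0) (- + 1) j) (opposite-↑ˡ n j)
  M₂-right : ∀ r j → M₂ r (n ↑ʳ j) ≡ - + 1 * M₁ r (j ↑ˡ n) + M₁ r (n ↑ʳ j)
  M₂-right r j = cong₂ (λ x y → x * M₁ r y + M₁ r (n ↑ʳ j)) (byHalf-↑ʳ n (+ 0) (- + 1) j) (opposite-↑ʳ n j)
  upperRight : ∀ i j → M₂ (i ↑ˡ n) (n ↑ʳ j) ≡ + 0
  upperRight i j = trans (M₂-right _ j) (trans (cong₂ (λ x y → - + 1 * x + y) (M₁-upper i _) (M₁-upper i _))
    (trans (cong₂ (λ x y → - + 1 * (+ 1 * x + M (i ↑ˡ n) (j ↑ˡ n)) + (+ 1 * y + M (i ↑ˡ n) (n ↑ʳ j)))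
       (offDiagonal i j) (diagonal i j))
      (identity (M (i ↑ˡ n) (j ↑ˡ n)) (M (i ↑ˡ n) (n ↑ʳ j)))))
    where
    identity : ∀ a b → - + 1 * (+ 1 * b + a) + (+ 1 * a + b) ≡ + 0
    identity = solve-∀
  upperLeft : ∀ i j → M₂ (i ↑ˡ n) (j ↑ˡ n) ≡ M (i ↑ˡ n) (j ↑ˡ n) + M (i ↑ˡ n) (n ↑ʳ j)
  upperLeft i j = trans (M₂-left _ j) (trans (cong₂ (λ x y → + 0 * x + y) (M₁-upper i (n ↑ʳ j)) (M₁-upper i (j ↑ˡ n)))
    (trans (cong (λ x → + 0 * (+ 1 * M (n ↑ʳ i) (n ↑ʳ j) + M (i ↑ˡ n) (n ↑ʳ j)) + (+ 1 * x + M (i ↑ˡ n) (j ↑ˡ n)))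
        (offDiagonal i j))
      (identity (M (i ↑ˡ n) (j ↑ˡ n)) (M (i ↑ˡ n) (n ↑ʳ j)) (M (n ↑ʳ i) (n ↑ʳ j)))))
    where
    identity : ∀ a b x → + 0 * (+ 1 * x + b) + (+ 1 * b + a) ≡ a + b
    identity = solve-∀
  lowerRight : ∀ i j → M₂ (n ↑ʳ i) (n ↑ʳ j) ≡ M (i ↑ˡ n) (j ↑ˡ n) - M (i ↑ˡ n) (n ↑ʳ j)
  lowerRight i j = trans (M₂-right _ j) (trans (cong₂ (λ x y → - + 1 * x + y) (M₁-lower i _) (M₁-lower i _))
    (trans (cong₂ (λ x y → - + 1 * (+ 0 * M (i ↑ˡ n) (j ↑ˡ n) + x) + (+ 0 * M (i ↑ˡ n) (n ↑ʳ j) + y))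
        (offDiagonal i j) (diagonal i j))
      (identity (M (i ↑ˡ n) (j ↑ˡ n)) (M (i ↑ˡ n) (n ↑ʳ j)))))
    where
    identity : ∀ a b → - + 1 * (+ 0 * a + b) + (+ 0 * b + a) ≡ a - b
    identity = solve-∀

-- The factors of the group determinant

record Quad : Set where
  constructor quad
  field q₁ q₂ q₃ q₄ : ℤ

-- The four characters of ℤ₂ × ℤ₂, extended linearly to the group ring.
h₁ h₂ h₃ h₄ : Quad → ℤ
h₁ (quad a b c d) = a + b + c + d
h₂ (quad a b c d) = a + b - c - d
h₃ (quad a b c d) = a - b + c - d
h₄ (quad a b c d) = a - b - c + d

norm : ℤ → ℤ → ℤ
norm P Q = P * P - P * Q + Q * Q

-- The group determinant of ℤ₃: the trivial character times the norm of a + bω + cω² = (a - c) + (b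
-- - c)ω, `norm` P Q being the norm of P + Qω.
D₃ : ℤ → ℤ → ℤ → ℤ
D₃ a b c = (a + b + c) * norm (a - c) (b - c)

agree : ∀ {m n k} (f g : Fin m → Fin n → Fin k) → {True (Finₚ.all? λ i → Finₚ.all? λ j → f i j Fin.≟ g i j)} →
  ∀ i j → f i j ≡ g i j
agree f g {t} = toWitness t

-- The size is a variable constrained by an equation so that determinants of literal size are never unfolded.
det-halves : ∀ N n (eq : n ℕ.+ n ≡ N) (M : Matrix N) (A B : Matrix n) →
  let lower = λ i → subst Fin eq (i ↑ˡ n) ; upper = λ i → subst Fin eq (n ↑ʳ i) in
  (∀ i j → M (lower i) (lower j) ≡ A i j) → (∀ i j → M (upper i) (upper j) ≡ A i j) →
  (∀ i j → M (lower i) (upper j) ≡ B i j) → (∀ i j → M (upper i) (lower j) ≡ B i j) →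
  det N M ≡ det n (λ i j → A i j + B i j) * det n (λ i j → A i j - B i j)
det-halves .(n ℕ.+ n) n refl M A B a₁ a₂ b₁ b₂ = trans
  (det-block-circulant n M (λ i j → trans (a₂ i j) (sym (a₁ i j))) (λ i j → trans (b₂ i j) (sym (b₁ i j))))
  (cong₂ _*_ (det-cong n (λ i j → cong₂ _+_ (a₁ i j) (b₁ i j))) (det-cong n (λ i j → cong₂ _-_ (a₁ i j) (b₁ i j))))

circulant : (Fin 6 → ℤ) → Matrix 6
circulant y i j = y ((toℕ i ℕ.+ 6 ℕ.∸ toℕ j) mod 6)

det-3 : ∀ N → det 3 N ≡
  N (# 0) (# 0) * (N (# 1) (# 1) * N (# 2) (# 2) - N (# 1) (# 2) * N (# 2) (# 1))
  - N (# 0) (# 1) * (N (# 1) (# 0) * N (# 2) (# 2) - N (# 1) (# 2) * N (# 2) (# 0))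
  + N (# 0) (# 2) * (N (# 1) (# 0) * N (# 2) (# 1) - N (# 1) (# 1) * N (# 2) (# 0))
det-3 N = expand (N (# 0) (# 0)) (N (# 0) (# 1)) (N (# 0) (# 2)) (N (# 1) (# 0)) (N (# 1) (# 1)) (N (# 1) (# 2))
                 (N (# 2) (# 0)) (N (# 2) (# 1)) (N (# 2) (# 2))
  where
  expand : ∀ a b c d e f g h i →
    + 1 * a * (+ 1 * e * (+ 1 * i * + 1 + + 0) + (- + 1 * f * (+ 1 * h * + 1 + + 0) + + 0))
    + (- + 1 * b * (+ 1 * d * (+ 1 * i * + 1 + + 0) + (- + 1 * f * (+ 1 * g * + 1 + + 0) + + 0))
    + (+ 1 * c * (+ 1 * d * (+ 1 * h * + 1 + + 0) + (- + 1 * e * (+ 1 * g * + 1 + + 0) + + 0)) + + 0))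
    ≡ a * (e * i - f * h) - b * (d * i - f * g) + c * (d * h - e * g)
  expand = solve-∀

-- The arguments pair the cosets of the element 3 of order 2, even member first. The sign character
-- of ℤ₆ is 1 on even residues, so this choice turns the negacyclic block into an ordinary circulant
-- in the differences.
det-circulant : ∀ M y → (∀ i j → M i j ≡ circulant y i j) → det 6 M ≡
  D₃ (y (# 0) + y (# 3)) (y (# 4) + y (# 1)) (y (# 2) + y (# 5)) *
  D₃ (y (# 0) - y (# 3)) (y (# 4) - y (# 1)) (y (# 2) - y (# 5))
det-circulant M y e = trans
  (det-halves 6 3 refl M A B (λ i j → e _ _) (λ i j → trans (e _ _) (cong y (A₂ i j)))
    (λ i j → e _ _) (λ i j → trans (e _ _) (cong y (B₂ i j))))
  (cong₂ _*_
    (trans (det-3 (λ i j → A i j + B i j)) (cyclic (y (# 0)) (y (# 1)) (y (# 2)) (y (# 3)) (y (# 4)) (y (# 5))))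
    (trans (det-3 (λ i j → A i j - B i j)) (negacyclic (y (# 0)) (y (# 1)) (y (# 2)) (y (# 3)) (y (# 4)) (y (# 5)))))
  where
  index : (i j : Fin 6) → Fin 6
  index i j = (toℕ i ℕ.+ 6 ℕ.∸ toℕ j) mod 6
  A B : Matrix 3
  A i j = y (index (i ↑ˡ 3) (j ↑ˡ 3))
  B i j = y (index (i ↑ˡ 3) (3 ↑ʳ j))
  A₂ : ∀ (i j : Fin 3) → index (3 ↑ʳ i) (3 ↑ʳ j) ≡ index (i ↑ˡ 3) (j ↑ˡ 3)
  A₂ = agree (λ i j → index (3 ↑ʳ i) (3 ↑ʳ j)) (λ i j → index (i ↑ˡ 3) (j ↑ˡ 3))
  B₂ : ∀ (i j : Fin 3) → index (3 ↑ʳ i) (j ↑ˡ 3) ≡ index (i ↑ˡ 3) (3 ↑ʳ j)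
  B₂ = agree (λ i j → index (3 ↑ʳ i) (j ↑ˡ 3)) (λ i j → index (i ↑ˡ 3) (3 ↑ʳ j))
  cyclic : ∀ y₀ y₁ y₂ y₃ y₄ y₅ →
    (y₀ + y₃) * ((y₀ + y₃) * (y₀ + y₃) - (y₅ + y₂) * (y₁ + y₄))
    - (y₅ + y₂) * ((y₁ + y₄) * (y₀ + y₃) - (y₅ + y₂) * (y₂ + y₅))
    + (y₄ + y₁) * ((y₁ + y₄) * (y₁ + y₄) - (y₀ + y₃) * (y₂ + y₅))
    ≡ ((y₀ + y₃) + (y₄ + y₁) + (y₂ + y₅)) *
      (((y₀ + y₃) - (y₂ + y₅)) * ((y₀ + y₃) - (y₂ + y₅)) - ((y₀ + y₃) - (y₂ + y₅)) * ((y₄ + y₁) - (y₂ + y₅))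
       + ((y₄ + y₁) - (y₂ + y₅)) * ((y₄ + y₁) - (y₂ + y₅)))
  cyclic = solve-∀
  negacyclic : ∀ y₀ y₁ y₂ y₃ y₄ y₅ →
    (y₀ - y₃) * ((y₀ - y₃) * (y₀ - y₃) - (y₅ - y₂) * (y₁ - y₄))
    - (y₅ - y₂) * ((y₁ - y₄) * (y₀ - y₃) - (y₅ - y₂) * (y₂ - y₅))
    + (y₄ - y₁) * ((y₁ - y₄) * (y₁ - y₄) - (y₀ - y₃) * (y₂ - y₅))
    ≡ ((y₀ - y₃) + (y₄ - y₁) + (y₂ - y₅)) *
      (((y₀ - y₃) - (y₂ - y₅)) * ((y₀ - y₃) - (y₂ - y₅)) - ((y₀ - y₃) - (y₂ - y₅)) * ((y₄ - y₁) - (y₂ - y₅))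
       + ((y₄ - y₁) - (y₂ - y₅)) * ((y₄ - y₁) - (y₂ - y₅)))
  negacyclic = solve-∀

sumMatrix differenceMatrix : (Fin 6 → Fin 2 → ℤ) → Matrix 6
sumMatrix x i j = circulant (λ i → x i (# 0)) i j + circulant (λ i → x i (# 1)) i j
differenceMatrix x i j = circulant (λ i → x i (# 0)) i j - circulant (λ i → x i (# 1)) i j

groupDet-halves : ∀ x → groupDet x ≡ det 6 (sumMatrix x) * det 6 (differenceMatrix x)
groupDet-halves x =
  det-halves 12 6 refl (groupMatrix x) (circulant (λ i → x i (# 0))) (circulant (λ i → x i (# 1)))
    (λ i j → cong₂ x (A₁ i j) (A₂ i j)) (λ i j → cong₂ x (A₃ i j) (A₄ i j))
    (λ i j → cong₂ x (B₁ i j) (B₂ i j)) (λ i j → cong₂ x (B₃ i j) (B₄ i j))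
  where
  i₁ : (i j : Fin 12) → Fin 6
  i₁ i j = (fst6 i ℕ.+ 6 ℕ.∸ fst6 j) mod 6
  i₂ : (i j : Fin 12) → Fin 2
  i₂ i j = (snd2 i ℕ.+ 2 ℕ.∸ snd2 j) mod 2
  index : (i j : Fin 6) → Fin 6
  index i j = (toℕ i ℕ.+ 6 ℕ.∸ toℕ j) mod 6
  A₁ : ∀ (i j : Fin 6) → i₁ (i ↑ˡ 6) (j ↑ˡ 6) ≡ index i j
  A₁ = agree (λ i j → i₁ (i ↑ˡ 6) (j ↑ˡ 6)) (λ i j → index i j)
  A₂ : ∀ (i j : Fin 6) → i₂ (i ↑ˡ 6) (j ↑ˡ 6) ≡ # 0
  A₂ = agree (λ i j → i₂ (i ↑ˡ 6) (j ↑ˡ 6)) (λ i j → # 0)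
  A₃ : ∀ (i j : Fin 6) → i₁ (6 ↑ʳ i) (6 ↑ʳ j) ≡ index i j
  A₃ = agree (λ i j → i₁ (6 ↑ʳ i) (6 ↑ʳ j)) (λ i j → index i j)
  A₄ : ∀ (i j : Fin 6) → i₂ (6 ↑ʳ i) (6 ↑ʳ j) ≡ # 0
  A₄ = agree (λ i j → i₂ (6 ↑ʳ i) (6 ↑ʳ j)) (λ i j → # 0)
  B₁ : ∀ (i j : Fin 6) → i₁ (i ↑ˡ 6) (6 ↑ʳ j) ≡ index i j
  B₁ = agree (λ i j → i₁ (i ↑ˡ 6) (6 ↑ʳ j)) (λ i j → index i j)
  B₂ : ∀ (i j : Fin 6) → i₂ (i ↑ˡ 6) (6 ↑ʳ j) ≡ # 1
  B₂ = agree (λ i j → i₂ (i ↑ˡ 6) (6 ↑ʳ j)) (λ i j → # 1)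
  B₃ : ∀ (i j : Fin 6) → i₁ (6 ↑ʳ i) (j ↑ˡ 6) ≡ index i j
  B₃ = agree (λ i j → i₁ (6 ↑ʳ i) (j ↑ˡ 6)) (λ i j → index i j)
  B₄ : ∀ (i j : Fin 6) → i₂ (6 ↑ʳ i) (j ↑ˡ 6) ≡ # 1
  B₄ = agree (λ i j → i₂ (6 ↑ʳ i) (j ↑ˡ 6)) (λ i j → # 1)

-- ℤ₆ × ℤ₂ = ℤ₃ × (ℤ₂ × ℤ₂); A, B, C collect the variables over the three elements 0, 4, 2 of ℤ₃ ⊂ ℤ₆.
coordA coordB coordC : (Fin 6 → Fin 2 → ℤ) → Quad
coordA x = quad (x (# 0) (# 0)) (x (# 3) (# 0)) (x (# 0) (# 1)) (x (# 3) (# 1))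
coordB x = quad (x (# 4) (# 0)) (x (# 1) (# 0)) (x (# 4) (# 1)) (x (# 1) (# 1))
coordC x = quad (x (# 2) (# 0)) (x (# 5) (# 0)) (x (# 2) (# 1)) (x (# 5) (# 1))

groupDet-factors : ∀ x → let a = coordA x ; b = coordB x ; c = coordC x in
  groupDet x ≡ D₃ (h₁ a) (h₁ b) (h₁ c) * D₃ (h₃ a) (h₃ b) (h₃ c) *
               (D₃ (h₂ a) (h₂ b) (h₂ c) * D₃ (h₄ a) (h₄ b) (h₄ c))
groupDet-factors x = trans (groupDet-halves x) (cong₂ _*_
  (trans (det-circulant (sumMatrix x) (λ i → x i (# 0) + x i (# 1)) (λ _ _ → refl))
    (cong₂ _*_ (cong-D₃ (e₁ (# 0) (# 3)) (e₁ (# 4) (# 1)) (e₁ (# 2) (# 5)))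
               (cong-D₃ (e₃ (# 0) (# 3)) (e₃ (# 4) (# 1)) (e₃ (# 2) (# 5)))))
  (trans (det-circulant (differenceMatrix x) (λ i → x i (# 0) - x i (# 1)) (λ _ _ → refl))
    (cong₂ _*_ (cong-D₃ (e₂ (# 0) (# 3)) (e₂ (# 4) (# 1)) (e₂ (# 2) (# 5)))
               (cong-D₃ (e₄ (# 0) (# 3)) (e₄ (# 4) (# 1)) (e₄ (# 2) (# 5))))))
  where
  cong-D₃ : ∀ {a a′ b b′ c c′} → a ≡ a′ → b ≡ b′ → c ≡ c′ → D₃ a b c ≡ D₃ a′ b′ c′
  cong-D₃ refl refl refl = refl
  module _ (i j : Fin 6) where
    a = x i (# 0)
    b = x j (# 0)
    c = x i (# 1)
    d = x j (# 1)
    e₁ : (a + c) + (b + d) ≡ h₁ (quad a b c d)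
    e₁ = identity a b c d
      where
      identity : ∀ a b c d → (a + c) + (b + d) ≡ a + b + c + d
      identity = solve-∀
    e₂ : (a - c) + (b - d) ≡ h₂ (quad a b c d)
    e₂ = identity a b c d
      where
      identity : ∀ a b c d → (a - c) + (b - d) ≡ a + b - c - d
      identity = solve-∀
    e₃ : (a + c) - (b + d) ≡ h₃ (quad a b c d)
    e₃ = identity a b c d
      where
      identity : ∀ a b c d → (a + c) - (b + d) ≡ a - b + c - d
      identity = solve-∀
    e₄ : (a - c) - (b - d) ≡ h₄ (quad a b c d)
    e₄ = identity a b c d
      where
      identity : ∀ a b c d → (a - c) - (b - d) ≡ a - b - c + d
      identity = solve-∀

-- An equation is derived from others by exhibiting the difference of its sides as a linear combination.
by₁ : ∀ {A B l r} c → l ≡ r → A + c * r ≡ B + c * l → A ≡ B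
by₁ {A} {B} {l} c refl e = trans (u A (c * l)) (trans (cong (_- c * l) e) (sym (u B (c * l))))
  where
  u : ∀ a x → a ≡ a + x - x
  u = solve-∀

by₂ : ∀ {A B l r l′ r′} c → l ≡ r → ∀ c′ → l′ ≡ r′ → A + (c * r + c′ * r′) ≡ B + (c * l + c′ * l′) → A ≡ B
by₂ {A} {B} {l} {_} {l′} c refl c′ refl e =
  trans (u A (c * l + c′ * l′)) (trans (cong (_- (c * l + c′ * l′)) e) (sym (u B (c * l + c′ * l′))))
  where
  u : ∀ a x → a ≡ a + x - x
  u = solve-∀

by₃ : ∀ {A B l r l′ r′ l″ r″} c → l ≡ r → ∀ c′ → l′ ≡ r′ → ∀ c″ → l″ ≡ r″ →
  A + (c * r + c′ * r′ + c″ * r″) ≡ B + (c * l + c′ * l′ + c″ * l″) → A ≡ B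
by₃ {A} {B} {l} {_} {l′} {_} {l″} c refl c′ refl c″ refl e =
  trans (u A (c * l + c′ * l′ + c″ * l″))
      (trans (cong (_- (c * l + c′ * l′ + c″ * l″)) e) (sym (u B (c * l + c′ * l′ + c″ * l″))))
  where
  u : ∀ a x → a ≡ a + x - x
  u = solve-∀

-- Residues

%ℕ-unique : ∀ m .{{_ : NonZero m}} {a} q {r} → r ℕ.< m → a ≡ + r + q * + m → a %ℕ m ≡ r
%ℕ-unique m {a} q {r} r<m eq = ℤₚ.+-injective (ℤₚ.i-j≡0⇒i≡j _ _ (ℤₚ.∣i∣≡0⇒i≡0 (small difference≡)))
  where
  r′ = a %ℕ m
  q′ = a /ℕ m
  identity : ∀ r r′ q q′ m → r′ + q′ * m ≡ r + q * m → r′ - r ≡ (q - q′) * m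
  identity r r′ q q′ m e = trans (l r r′ q′ m) (trans (cong (λ z → z - q′ * m - r) e) (l′ r q q′ m))
    where
    l : ∀ r r′ q′ m → r′ - r ≡ r′ + q′ * m - q′ * m - r
    l = solve-∀
    l′ : ∀ r q q′ m → r + q * m - q′ * m - r ≡ (q - q′) * m
    l′ = solve-∀
  difference≡ : + r′ - + r ≡ (q - q′) * + m
  difference≡ = identity (+ r) (+ r′) q q′ (+ m) (trans (sym (a≡a%ℕn+[a/ℕn]*n a m)) eq)
  abs<m : ∣ + r′ - + r ∣ ℕ.< m
  abs<m = subst (λ z → ∣ z ∣ ℕ.< m) (sym (ℤₚ.m-n≡m⊖n r′ r))
    (ℕₚ.≤-<-trans (ℤₚ.∣m⊝n∣≤m⊔n r′ r) (ℕₚ.⊔-pres-<m (n%ℕd<d a m) r<m))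
  small : + r′ - + r ≡ (q - q′) * + m → ∣ + r′ - + r ∣ ≡ 0
  small d with ∣ + r′ - + r ∣ | abs<m | trans (cong ∣_∣ d) (ℤₚ.abs-* (q - q′) (+ m))
  ... | zero  | _ | _ = refl
  ... | suc k | lt | eq′ = ⊥-elim (ℕₚ.<⇒≱ lt (ℕ.∣⇒≤ (ℕ.divides ∣ q - q′ ∣ eq′)))

%ℕ-cong : ∀ m .{{_ : NonZero m}} a b q → a ≡ b + q * + m → a %ℕ m ≡ b %ℕ m
%ℕ-cong m a b q e = %ℕ-unique m (b /ℕ m + q) (n%ℕd<d b m)
  (trans e (trans (cong (_+ q * + m) (a≡a%ℕn+[a/ℕn]*n b m)) (regroup (+ (b %ℕ m)) (b /ℕ m) q (+ m))))
  where
  regroup : ∀ r q q′ m → r + q * m + q′ * m ≡ r + (q + q′) * m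
  regroup = solve-∀

module _ (m : ℕ) .{{_ : NonZero m}} where

  %ℕ-+ : ∀ a b → (a + b) %ℕ m ≡ (a %ℕ m ℕ.+ b %ℕ m) ℕ.% m
  %ℕ-+ a b = %ℕ-cong m (a + b) (+ (a %ℕ m ℕ.+ b %ℕ m)) (a /ℕ m + b /ℕ m)
      (trans (cong₂ _+_ (a≡a%ℕn+[a/ℕn]*n a m) (a≡a%ℕn+[a/ℕn]*n b m))
    (trans (regroup (+ (a %ℕ m)) (a /ℕ m) (+ (b %ℕ m)) (b /ℕ m) (+ m))
      (cong (_+ (a /ℕ m + b /ℕ m) * + m) (sym (ℤₚ.pos-+ (a %ℕ m) (b %ℕ m))))))
    where
    regroup : ∀ r q s t m → r + q * m + (s + t * m) ≡ r + s + (q + t) * m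
    regroup = solve-∀

  %ℕ-* : ∀ a b → (a * b) %ℕ m ≡ ((a %ℕ m) ℕ.* (b %ℕ m)) ℕ.% m
  %ℕ-* a b = %ℕ-cong m (a * b) (+ ((a %ℕ m) ℕ.* (b %ℕ m)))
      (+ (a %ℕ m) * (b /ℕ m) + a /ℕ m * + (b %ℕ m) + a /ℕ m * (b /ℕ m) * + m)
    (trans (cong₂ _*_ (a≡a%ℕn+[a/ℕn]*n a m) (a≡a%ℕn+[a/ℕn]*n b m))
      (trans (regroup (+ (a %ℕ m)) (a /ℕ m) (+ (b %ℕ m)) (b /ℕ m) (+ m))
        (cong (_+ (+ (a %ℕ m) * (b /ℕ m) + a /ℕ m * + (b %ℕ m) + a /ℕ m * (b /ℕ m) * + m) * + m)
          (sym (ℤₚ.pos-* (a %ℕ m) (b %ℕ m))))))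
    where
    regroup : ∀ r q s t m → (r + q * m) * (s + t * m) ≡ r * s + (r * t + q * s + q * t * m) * m
    regroup = solve-∀

  %ℕ-neg : ∀ a → (- a) %ℕ m ≡ (m ℕ.∸ a %ℕ m) ℕ.% m
  %ℕ-neg a = %ℕ-cong m (- a) (+ (m ℕ.∸ a %ℕ m)) (- (+ 1) - a /ℕ m) (trans (cong -_ (a≡a%ℕn+[a/ℕn]*n a m))
    (trans (regroup (+ (a %ℕ m)) (a /ℕ m) (+ m))
      (cong (_+ (- (+ 1) - a /ℕ m) * + m)
        (trans (ℤₚ.m-n≡m⊖n m (a %ℕ m)) (ℤₚ.⊖-≥ (ℕₚ.<⇒≤ (n%ℕd<d a m)))))))
    where
    regroup : ∀ r q m → - (r + q * m) ≡ m - r + (- (+ 1) - q) * m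
    regroup = solve-∀

-- Deciding congruences by reflection

infixl 6 _:+_ _:-_
infixl 7 _:*_
data Poly (n : ℕ) : Set where
  var : Fin n → Poly n
  con : ℕ → Poly n
  _:+_ _:-_ _:*_ : Poly n → Poly n → Poly n
  :-_ : Poly n → Poly n

⟦_⟧ : ∀ {n} → Poly n → Vec ℤ n → ℤ
⟦ var i ⟧ ρ = lookup ρ i
⟦ con k ⟧ ρ = + k
⟦ e :+ f ⟧ ρ = ⟦ e ⟧ ρ + ⟦ f ⟧ ρ
⟦ e :- f ⟧ ρ = ⟦ e ⟧ ρ - ⟦ f ⟧ ρ
⟦ e :* f ⟧ ρ = ⟦ e ⟧ ρ * ⟦ f ⟧ ρ
⟦ :- e ⟧ ρ = - ⟦ e ⟧ ρ

residue : ∀ m .{{_ : NonZero m}} {n} → Poly n → Vec ℕ n → ℕ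
residue m (var i) ρ = lookup ρ i
residue m (con k) ρ = k ℕ.% m
residue m (e :+ f) ρ = (residue m e ρ ℕ.+ residue m f ρ) ℕ.% m
residue m (e :- f) ρ = (residue m e ρ ℕ.+ (m ℕ.∸ residue m f ρ) ℕ.% m) ℕ.% m
residue m (e :* f) ρ = (residue m e ρ ℕ.* residue m f ρ) ℕ.% m
residue m (:- e) ρ = (m ℕ.∸ residue m e ρ) ℕ.% m

residue-correct : ∀ m .{{_ : NonZero m}} {n} (e : Poly n) ρ → ⟦ e ⟧ ρ %ℕ m ≡ residue m e (Vec.map (_%ℕ m) ρ)
residue-correct m (var i) ρ = sym (lookup-map i (_%ℕ m) ρ)
residue-correct m (con k) ρ = refl
residue-correct m (e :+ f) ρ = trans (%ℕ-+ m (⟦ e ⟧ ρ) (⟦ f ⟧ ρ))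
  (cong₂ (λ x y → (x ℕ.+ y) ℕ.% m) (residue-correct m e ρ) (residue-correct m f ρ))
residue-correct m (e :- f) ρ = trans (%ℕ-+ m (⟦ e ⟧ ρ) (- ⟦ f ⟧ ρ))
    (trans (cong (λ z → (⟦ e ⟧ ρ %ℕ m ℕ.+ z) ℕ.% m) (%ℕ-neg m (⟦ f ⟧ ρ)))
  (cong₂ (λ x y → (x ℕ.+ (m ℕ.∸ y) ℕ.% m) ℕ.% m) (residue-correct m e ρ) (residue-correct m f ρ)))
residue-correct m (e :* f) ρ = trans (%ℕ-* m (⟦ e ⟧ ρ) (⟦ f ⟧ ρ))
  (cong₂ (λ x y → (x ℕ.* y) ℕ.% m) (residue-correct m e ρ) (residue-correct m f ρ))
residue-correct m (:- e) ρ = trans (%ℕ-neg m (⟦ e ⟧ ρ)) (cong (λ z → (m ℕ.∸ z) ℕ.% m) (residue-correct m e ρ))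

infix  4 _≈_
infixr 3 _&_
infixr 2 _∥_
infixr 1 _⇒_
data Formula (n : ℕ) : Set where
  _≈_ : Poly n → ℕ → Formula n
  _&_ _∥_ _⇒_ : Formula n → Formula n → Formula n
  never : Formula n

Holds : ∀ m .{{_ : NonZero m}} {n} → Formula n → Vec ℤ n → Set
Holds m (e ≈ r) ρ = ⟦ e ⟧ ρ %ℕ m ≡ r
Holds m (f & g) ρ = Holds m f ρ × Holds m g ρ
Holds m (f ∥ g) ρ = Holds m f ρ ⊎ Holds m g ρ
Holds m (f ⇒ g) ρ = Holds m f ρ → Holds m g ρ
Holds m never   ρ = ⊥

holds? : ∀ m .{{_ : NonZero m}} {n} → Formula n → Vec ℕ n → Bool
holds? m (e ≈ r) ρ = residue m e ρ ℕ.≡ᵇ r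
holds? m (f & g) ρ = holds? m f ρ ∧ holds? m g ρ
holds? m (f ∥ g) ρ = holds? m f ρ ∨ holds? m g ρ
holds? m (f ⇒ g) ρ = not (holds? m f ρ) ∨ holds? m g ρ
holds? m never   ρ = false

module _ (m : ℕ) .{{_ : NonZero m}} {n : ℕ} (ρ : Vec ℤ n) where
  private
    ρ̄ : Vec ℕ n
    ρ̄ = Vec.map (_%ℕ m) ρ

  -- Proved together with its converse because of implications: their hypotheses have to be carried
  -- from ℤ to the residues.
  holds-sound : ∀ f → Bool.T (holds? m f ρ̄) → Holds m f ρ
  holds-complete : ∀ f → Holds m f ρ → Bool.T (holds? m f ρ̄)
  holds-sound (e ≈ r) t = trans (residue-correct m e ρ) (ℕₚ.≡ᵇ⇒≡ _ r t)
  holds-sound (f & g) t with holds? m f ρ̄ in eq | t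
  ... | true | t′ = holds-sound f (subst Bool.T (sym eq) tt) , holds-sound g t′
  holds-sound (f ∥ g) t with holds? m f ρ̄ in eq | t
  ... | true  | _  = inj₁ (holds-sound f (subst Bool.T (sym eq) tt))
  ... | false | t′ = inj₂ (holds-sound g t′)
  holds-sound (f ⇒ g) t h with holds? m f ρ̄ | holds-complete f h | t
  ... | true | _ | t′ = holds-sound g t′
  holds-complete (e ≈ r) h = ℕₚ.≡⇒≡ᵇ _ r (trans (sym (residue-correct m e ρ)) h)
  holds-complete (f & g) (h , h′) with holds? m f ρ̄ | holds-complete f h
  ... | true | _ = holds-complete g h′
  holds-complete (f ∥ g) h with holds? m f ρ̄ in eq | h
  ... | true  | _ = tt
  ... | false | inj₁ h′ = ⊥-elim (subst Bool.T eq (holds-complete f h′))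
  ... | false | inj₂ h′ = holds-complete g h′
  holds-complete (f ⇒ g) h with holds? m f ρ̄ in eq
  ... | false = tt
  ... | true  = holds-complete g (h (holds-sound f (subst Bool.T (sym eq) tt)))

allBelow : ℕ → (ℕ → Bool) → Bool
allBelow zero    p = true
allBelow (suc k) p = p k ∧ allBelow k p

allBelow-sound : ∀ k p → Bool.T (allBelow k p) → ∀ r → r ℕ.< k → Bool.T (p r)
allBelow-sound (suc k) p t r r<k with p k in eq | t
... | true | t′ with r ℕ.≟ k
... | yes refl = subst Bool.T (sym eq) tt
... | no r≢k   = allBelow-sound k p t′ r (ℕₚ.≤∧≢⇒< (ℕ.s≤s⁻¹ r<k) r≢k)

allResidues : ∀ m n → (Vec ℕ n → Bool) → Bool
allResidues m zero    p = p Vec.[]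
allResidues m (suc n) p = allBelow m (λ r → allResidues m n (λ ρ → p (r Vec.∷ ρ)))

allResidues-sound : ∀ m .{{_ : NonZero m}} n p → Bool.T (allResidues m n p) → ∀ (ρ : Vec ℤ n) →
    Bool.T (p (Vec.map (_%ℕ m) ρ))
allResidues-sound m zero    p t Vec.[]        = t
allResidues-sound m (suc n) p t (a Vec.∷ ρ) = allResidues-sound m n _
  (allBelow-sound m _ t (a %ℕ m) (n%ℕd<d a m)) ρ

-- A congruence statement with universally quantified integer variables is decided by running through all residues.
abstract
  byResidues : ∀ m .{{_ : NonZero m}} {n} (f : Formula n) → {Bool.T (allResidues m n (holds? m f))} → ∀ ρ → Holds m f ρ
  byResidues m f {t} ρ = holds-sound m ρ f (allResidues-sound m _ (holds? m f) t ρ)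

x₀ : ∀ {n} → Poly (1 ℕ.+ n)
x₀ = var (# 0)
x₁ : ∀ {n} → Poly (2 ℕ.+ n)
x₁ = var (# 1)
x₂ : ∀ {n} → Poly (3 ℕ.+ n)
x₂ = var (# 2)
x₃ : ∀ {n} → Poly (4 ℕ.+ n)
x₃ = var (# 3)

quotient-form : ∀ m .{{_ : NonZero m}} a r → a %ℕ m ≡ r → a ≡ + m * (a /ℕ m) + + r
quotient-form m a r e = trans (a≡a%ℕn+[a/ℕn]*n a m)
  (trans (cong (λ z → + z + a /ℕ m * + m) e) (regroup (+ r) (a /ℕ m) (+ m)))
  where
  regroup : ∀ r q m → r + q * m ≡ m * q + r
  regroup = solve-∀


-- Lets one run through the residues modulo c d handle conditions modulo its divisors: c y ≡ c r
-- modulo c d encodes y ≡ r modulo d.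
scaled-residue : ∀ c d r .{{_ : NonZero c}} .{{_ : NonZero (c ℕ.* d)}} y →
  (+ c * y) %ℕ (c ℕ.* d) ≡ c ℕ.* r → ∃[ k ] y ≡ + d * k + + r
scaled-residue c d r {{c≢0}} y e = k , ℤₚ.*-cancelˡ-≡ (+ c) y (+ d * k + + r) {{c≢0}}
  (trans (quotient-form (c ℕ.* d) (+ c * y) (c ℕ.* r) e)
    (trans (cong₂ (λ x z → x * k + z) (ℤₚ.pos-* c d) (ℤₚ.pos-* c r)) (factor-out (+ c) (+ d) (+ r) k)))
  where
  k = (+ c * y) /ℕ (c ℕ.* d)
  factor-out : ∀ c d r k → c * d * k + c * r ≡ c * (d * k + r)
  factor-out = solve-∀

scaled-multiple : ∀ c d .{{_ : NonZero c}} .{{_ : NonZero (c ℕ.* d)}} y → (+ c * y) %ℕ (c ℕ.* d) ≡ 0 →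
    ∃[ k ] y ≡ + d * k
scaled-multiple c d y e with scaled-residue c d 0 y (trans e (sym (ℕₚ.*-zeroʳ c)))
... | k , y≡ = k , trans y≡ (ℤₚ.+-identityʳ (+ d * k))

vec₁ : ∀ {A : Set} → A → Vec A 1
vec₁ a = a Vec.∷ Vec.[]

vec₂ : ∀ {A : Set} → A → A → Vec A 2
vec₂ a b = a Vec.∷ vec₁ b

vec₃ : ∀ {A : Set} → A → A → A → Vec A 3
vec₃ a b c = a Vec.∷ vec₂ b c

vec₄ : ∀ {A : Set} → A → A → A → A → Vec A 4
vec₄ a b c d = a Vec.∷ vec₃ b c d

-- Reduction of binary quadratic forms

abs-unit-multiple : ∀ a → ∃[ s ] + ∣ a ∣ ≡ s * a
abs-unit-multiple (+ n)    = + 1 , sym (ℤₚ.*-identityˡ (+ n))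
abs-unit-multiple -[1+ n ] = - + 1 , sym (ℤₚ.-1*i≡-i -[1+ n ])

∣b-a∣≤ : ∀ {r m} → r ℕ.≤ m → ∣ + r - + m ∣ ≡ m ℕ.∸ r
∣b-a∣≤ {r} {m} r≤m = trans (cong ∣_∣ (ℤₚ.m-n≡m⊖n r m)) (ℤₚ.∣⊖∣-≤ r≤m)

balanced-remainder : ∀ a b → a ≢ + 0 → ∃[ t ] 2 ℕ.* ∣ b + t * a ∣ ℕ.≤ ∣ a ∣
balanced-remainder a b a≢0 = helper (2 ℕ.* r ℕ.≤? m)
  where
  m = ∣ a ∣
  instance
    m≢0 : ℕ.NonZero m
    m≢0 = ℕ.≢-nonZero λ e → a≢0 (ℤₚ.∣i∣≡0⇒i≡0 e)
  s = proj₁ (abs-unit-multiple a)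
  r = b %ℕ m
  q = b /ℕ m
  b≡ : b ≡ + r + q * (s * a)
  b≡ = trans (a≡a%ℕn+[a/ℕn]*n b m) (cong (λ z → + r + q * z) (proj₂ (abs-unit-multiple a)))
  cancel : ∀ r q s a → r + q * (s * a) + - (q * s) * a ≡ r
  cancel = solve-∀
  cancel′ : ∀ r q s a → r + q * (s * a) + - (q * s + s) * a ≡ r - s * a
  cancel′ = solve-∀
  helper : _ → ∃[ t ] 2 ℕ.* ∣ b + t * a ∣ ℕ.≤ m
  helper (yes 2r≤m) = - (q * s) ,
    subst (λ z → 2 ℕ.* ∣ z ∣ ℕ.≤ m) (sym (trans (cong (_+ - (q * s) * a) b≡) (cancel (+ r) q s a))) 2r≤m
  helper (no 2r≰m) = - (q * s + s) ,
    subst (λ z → 2 ℕ.* z ℕ.≤ m) (sym (trans (cong ∣_∣ (trans (cong (_+ - (q * s + s) * a) b≡)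
        (trans (cancel′ (+ r) q s a) (cong (λ z → + r - z) (sym (proj₂ (abs-unit-multiple a)))))))
      (∣b-a∣≤ (ℕₚ.<⇒≤ (n%ℕd<d b m)))))
    (begin
      2 ℕ.* (m ℕ.∸ r)        ≡⟨ ℕₚ.*-distribˡ-∸ 2 m r ⟩
      2 ℕ.* m ℕ.∸ 2 ℕ.* r    ≤⟨ ℕₚ.∸-monoʳ-≤ (2 ℕ.* m) (ℕₚ.<⇒≤ (ℕₚ.≰⇒> 2r≰m)) ⟩
      2 ℕ.* m ℕ.∸ m          ≡⟨ cong (ℕ._∸ m) (cong (m ℕ.+_) (ℕₚ.+-identityʳ m)) ⟩
      m ℕ.+ m ℕ.∸ m          ≡⟨ ℕₚ.m+n∸n≡m m m ⟩
      m                      ∎)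
    where open ℕₚ.≤-Reasoning

-- (a , b , c) stands for the form a X² + 2 b X Y + c Y²; it is obtained from the reduced form (α , β , γ)
-- by the substitution sending the two basis vectors to (x , y) and (z , w).
record Reduction (D a b c : ℤ) : Set where
  field
    α β γ x y z w : ℤ
    disc : α * γ ≡ β * β + D
    2∣β∣≤∣α∣ : 2 ℕ.* ∣ β ∣ ℕ.≤ ∣ α ∣
    ∣α∣≤∣γ∣ : ∣ α ∣ ℕ.≤ ∣ γ ∣
    a≡ : a ≡ α * x * x + + 2 * β * x * y + γ * y * y
    b≡ : b ≡ α * x * z + β * (x * w + y * z) + γ * y * w
    c≡ : c ≡ α * z * z + + 2 * β * z * w + γ * w * w

swap : ∀ {D a b c} → Reduction D c (- b) a → Reduction D a b c
swap {D} {a} {b} {c} R = record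
  { α = α ; β = β ; γ = γ ; x = z ; y = w ; z = - x ; w = - y
  ; disc = disc ; 2∣β∣≤∣α∣ = 2∣β∣≤∣α∣ ; ∣α∣≤∣γ∣ = ∣α∣≤∣γ∣
  ; a≡ = c≡
  ; b≡ = trans (sym (ℤₚ.neg-involutive b)) (trans (cong -_ b≡) (e₁ α β γ x y z w))
  ; c≡ = trans a≡ (e₂ α β γ x y) }
  where
  open Reduction R
  e₁ : ∀ α β γ x y z w → - (α * x * z + β * (x * w + y * z) + γ * y * w)
                         ≡ α * z * - x + β * (z * - y + w * - x) + γ * w * - y
  e₁ = solve-∀
  e₂ : ∀ α β γ x y → α * x * x + + 2 * β * x * y + γ * y * y
                     ≡ α * - x * - x + + 2 * β * - x * - y + γ * - y * - y
  e₂ = solve-∀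

shift : ∀ {D a b c} t → Reduction D a (b + t * a) (c + + 2 * t * b + t * t * a) → Reduction D a b c
shift {D} {a} {b} {c} t R = record
  { α = α ; β = β ; γ = γ ; x = x ; y = y ; z = z - t * x ; w = w - t * y
  ; disc = disc ; 2∣β∣≤∣α∣ = 2∣β∣≤∣α∣ ; ∣α∣≤∣γ∣ = ∣α∣≤∣γ∣
  ; a≡ = a≡
  ; b≡ = trans (u₁ a b t) (trans (cong₂ (λ p q → p - t * q) b≡ a≡) (e₁ α β γ x y z w t))
  ; c≡ = trans (u₂ a b c t) (trans (cong₂ (λ p q → p - q) c≡ (cong₂ (λ p q → + 2 * t * p - t * t * q) b≡ a≡))
           (e₂ α β γ x y z w t)) }
  where
  open Reduction R
  u₁ : ∀ a b t → b ≡ b + t * a - t * a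
  u₁ = solve-∀
  u₂ : ∀ a b c t → c ≡ c + + 2 * t * b + t * t * a - (+ 2 * t * (b + t * a) - t * t * a)
  u₂ = solve-∀
  e₁ : ∀ α β γ x y z w t →
    α * x * z + β * (x * w + y * z) + γ * y * w - t * (α * x * x + + 2 * β * x * y + γ * y * y)
    ≡ α * x * (z - t * x) + β * (x * (w - t * y) + y * (z - t * x)) + γ * y * (w - t * y)
  e₁ = solve-∀
  e₂ : ∀ α β γ x y z w t →
    α * z * z + + 2 * β * z * w + γ * w * w
      - (+ 2 * t * (α * x * z + β * (x * w + y * z) + γ * y * w) - t * t * (α * x * x + + 2 * β * x * y + γ * y * y))
    ≡ α * (z - t * x) * (z - t * x) + + 2 * β * (z - t * x) * (w - t * y) + γ * (w - t * y) * (w - t * y)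
  e₂ = solve-∀

-- Lagrange's reduction: a shift makes 2∣b∣ ≤ ∣a∣, and if then ∣c∣ < ∣a∣ the outer coefficients are
-- exchanged, which lowers ∣a∣. That -D is not a square keeps a nonzero.
reduction : ∀ D → (∀ b → b * b + D ≢ + 0) → ∀ a b c → a * c ≡ b * b + D → Reduction D a b c
reduction D nonSquare a b c = go a b c (<-wellFounded ∣ a ∣)
  where
  nonzero : ∀ a b c → a * c ≡ b * b + D → a ≢ + 0
  nonzero a b c e refl = nonSquare b (trans (sym e) (ℤₚ.*-zeroˡ c))
  go : ∀ a b c → Acc ℕ._<_ ∣ a ∣ → a * c ≡ b * b + D → Reduction D a b c
  go a b c (acc rs) ac≡ = shift {b = b} {c} t (step (∣ a ∣ ℕ.≤? ∣ c′ ∣))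
    where
    balanced = balanced-remainder a b (nonzero a b c ac≡)
    t  = proj₁ balanced
    b′ = b + t * a
    c′ = c + + 2 * t * b + t * t * a
    ac′≡ : a * c′ ≡ b′ * b′ + D
    ac′≡ = trans (expand a b c t) (trans (cong (_+ (+ 2 * t * a * b + t * t * a * a)) ac≡) (collect a b t D))
      where
      expand : ∀ a b c t → a * (c + + 2 * t * b + t * t * a) ≡ a * c + (+ 2 * t * a * b + t * t * a * a)
      expand = solve-∀
      collect : ∀ a b t D → b * b + D + (+ 2 * t * a * b + t * t * a * a) ≡ (b + t * a) * (b + t * a) + D
      collect = solve-∀
    c′a≡ : c′ * a ≡ (- b′) * (- b′) + D
    c′a≡ = trans (ℤₚ.*-comm c′ a) (trans ac′≡ (cong (_+ D) (neg-sq b′)))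
      where
      neg-sq : ∀ b → b * b ≡ (- b) * (- b)
      neg-sq = solve-∀
    step : _ → Reduction D a b′ c′
    step (no a≰c′) = swap {b = b′} (go c′ (- b′) a (rs (ℕₚ.≰⇒> a≰c′)) c′a≡)
    step (yes a≤c′) = record
      { α = a ; β = b′ ; γ = c′ ; x = + 1 ; y = + 0 ; z = + 0 ; w = + 1
      ; disc = ac′≡ ; 2∣β∣≤∣α∣ = proj₂ balanced ; ∣α∣≤∣γ∣ = a≤c′
      ; a≡ = e₁ a b′ c′ ; b≡ = e₂ a b′ c′ ; c≡ = e₃ a b′ c′ }
      where
      e₁ : ∀ a b c → a ≡ a * + 1 * + 1 + + 2 * b * + 1 * + 0 + c * + 0 * + 0
      e₁ = solve-∀
      e₂ : ∀ a b c → b ≡ a * + 1 * + 0 + b * (+ 1 * + 1 + + 0 * + 0) + c * + 0 * + 1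
      e₂ = solve-∀
      e₃ : ∀ a b c → c ≡ a * + 0 * + 0 + + 2 * b * + 0 * + 1 + c * + 1 * + 1
      e₃ = solve-∀

-- 3 α² ≤ 4 ∣D∣ for a reduced form.
∣α∣≤2 : ∀ {D a b c} → ∣ D ∣ ℕ.≤ 3 → (R : Reduction D a b c) → ∣ Reduction.α R ∣ ℕ.≤ 2
∣α∣≤2 {D} D≤3 R with ∣ Reduction.α R ∣ ℕ.≤? 2
... | yes p = p
... | no A≰2 = ⊥-elim (ℕₚ.<⇒≱ (3A²>12 (ℕₚ.≰⇒> A≰2)) 3A²≤12)
  where
  open Reduction R
  A = ∣ α ∣
  B = ∣ β ∣
  A²≤ : A ℕ.* A ℕ.≤ B ℕ.* B ℕ.+ 3
  A²≤ = begin
    A ℕ.* A                ≤⟨ ℕₚ.*-monoʳ-≤ A ∣α∣≤∣γ∣ ⟩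
    A ℕ.* ∣ γ ∣            ≡⟨ ℤₚ.abs-* α γ ⟨
    ∣ α * γ ∣              ≡⟨ cong ∣_∣ disc ⟩
    ∣ β * β + D ∣          ≤⟨ ℤₚ.∣i+j∣≤∣i∣+∣j∣ (β * β) D ⟩
    ∣ β * β ∣ ℕ.+ ∣ D ∣    ≤⟨ ℕₚ.+-mono-≤ (ℕₚ.≤-reflexive (ℤₚ.abs-* β β)) D≤3 ⟩
    B ℕ.* B ℕ.+ 3          ∎
    where open ℕₚ.≤-Reasoning
  4B²≤ : 2 ℕ.* B ℕ.* (2 ℕ.* B) ℕ.≤ A ℕ.* A
  4B²≤ = ℕₚ.*-mono-≤ 2∣β∣≤∣α∣ 2∣β∣≤∣α∣
  3A²≤12 : 3 ℕ.* (A ℕ.* A) ℕ.≤ 12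
  3A²≤12 = ℕₚ.+-cancelʳ-≤ (A ℕ.* A) (3 ℕ.* (A ℕ.* A)) 12 (begin
    3 ℕ.* (A ℕ.* A) ℕ.+ A ℕ.* A       ≡⟨ ℕₚ.+-comm (3 ℕ.* (A ℕ.* A)) (A ℕ.* A) ⟩
    4 ℕ.* (A ℕ.* A)                   ≤⟨ ℕₚ.*-monoʳ-≤ 4 A²≤ ⟩
    4 ℕ.* (B ℕ.* B ℕ.+ 3)             ≡⟨ ℕₚ.*-distribˡ-+ 4 (B ℕ.* B) 3 ⟩
    4 ℕ.* (B ℕ.* B) ℕ.+ 12            ≡⟨ cong (ℕ._+ 12) (ℕₚ.[m*n]*[o*p]≡[m*o]*[n*p] 2 2 B B) ⟩
    2 ℕ.* B ℕ.* (2 ℕ.* B) ℕ.+ 12      ≤⟨ ℕₚ.+-monoˡ-≤ 12 4B²≤ ⟩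
    A ℕ.* A ℕ.+ 12                    ≡⟨ ℕₚ.+-comm (A ℕ.* A) 12 ⟩
    12 ℕ.+ A ℕ.* A                    ∎)
    where open ℕₚ.≤-Reasoning
  3A²>12 : 3 ℕ.≤ A → 12 ℕ.< 3 ℕ.* (A ℕ.* A)
  3A²>12 3≤A = ℕₚ.<-≤-trans (ℕₚ.m≤m+n 13 14) (ℕₚ.*-monoʳ-≤ 3 (ℕₚ.*-mono-≤ 3≤A 3≤A))

IsUnit : ℤ → Set
IsUnit s = s ≡ + 1 ⊎ s ≡ - + 1

-- For odd D with ∣D∣ ≤ 3 a reduced form is ±(X² + DY²) or has ∣α∣ = 2 and ∣β∣ = 1. Of the latter
-- kind `Exceptional` retains what refutes it for D = 1, 3, -3: the equation for γ, its size, and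
-- the parity of the value.
Principal Exceptional : ℤ → ℤ → Set
Principal D a = ∃[ s ] ∃[ x ] ∃[ y ] IsUnit s × a ≡ s * (x * x + D * y * y)
Exceptional D a = ∃[ γ ] ∃[ u ] + 2 * γ ≡ + 1 + D × 2 ℕ.≤ ∣ γ ∣ × ∃[ y ] a ≡ + 2 * u + γ * y * y

module _ {D a b c : ℤ} (nonSquare : ∀ b → b * b + D ≢ + 0) (odd : D %ℕ 2 ≡ 1)
         (D≤3 : ∣ D ∣ ℕ.≤ 3) (R : Reduction D a b c) where

  private
    γ-plus : ∀ γ → + 1 * γ ≡ + 0 * + 0 + D → γ ≡ D
    γ-plus γ e = trans (sym (ℤₚ.*-identityˡ γ)) (trans e (ℤₚ.+-identityˡ D))
    γ-minus : ∀ γ → - + 1 * γ ≡ + 0 * + 0 + D → γ ≡ - D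
    γ-minus γ e = trans (l γ) (cong -_ (trans e (ℤₚ.+-identityˡ D)))
      where
      l : ∀ γ → γ ≡ - (- + 1 * γ)
      l = solve-∀
    even-disc : ∀ γ → + 2 * γ ≡ + 0 + D → ⊥
    even-disc γ e = byResidues 2 (con 2 :* x₀ ≈ 1 ⇒ never) (vec₁ γ)
        (trans (cong (_%ℕ 2) (trans e (ℤₚ.+-identityˡ D))) odd)

  classify : ∀ α β γ x y → ∣ α ∣ ℕ.≤ 2 → 2 ℕ.* ∣ β ∣ ℕ.≤ ∣ α ∣ → ∣ α ∣ ℕ.≤ ∣ γ ∣ → α * γ ≡ β * β + D →
    a ≡ α * x * x + + 2 * β * x * y + γ * y * y → Principal D a ⊎ Exceptional D a
  classify (+ 0) β γ x y _ _ _ disc _ = ⊥-elim (nonSquare β (sym disc))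
  classify (+ 1) (+ 0) γ x y _ _ _ disc a≡ with γ-plus γ disc
  ... | refl = inj₁ (+ 1 , x , y , inj₁ refl , trans a≡ (e x y γ))
    where
    e : ∀ x y γ → + 1 * x * x + + 2 * + 0 * x * y + γ * y * y ≡ + 1 * (x * x + γ * y * y)
    e = solve-∀
  classify (+ 2) (+ 0) γ x y _ _ _ disc _ = ⊥-elim (even-disc γ disc)
  classify (+ 2) (+ 1) γ x y _ _ 2≤γ disc a≡ = inj₂ (γ , x * x + x * y , disc , 2≤γ , y , trans a≡ (e x y γ))
    where
    e : ∀ x y γ → + 2 * x * x + + 2 * + 1 * x * y + γ * y * y ≡ + 2 * (x * x + x * y) + γ * y * y
    e = solve-∀
  classify (+ 2) -[1+ 0 ] γ x y _ _ 2≤γ disc a≡ = inj₂ (γ , x * x - x * y , disc , 2≤γ , y , trans a≡ (e x y γ))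
    where
    e : ∀ x y γ → + 2 * x * x + + 2 * - + 1 * x * y + γ * y * y ≡ + 2 * (x * x - x * y) + γ * y * y
    e = solve-∀
  classify -[1+ 0 ] (+ 0) γ x y _ _ _ disc a≡ = inj₁ (- + 1 , x , y , inj₂ refl ,
    trans a≡ (trans (cong (λ z → - + 1 * x * x + + 2 * + 0 * x * y + z * y * y) (γ-minus γ disc)) (e x y D)))
    where
    e : ∀ x y D → - + 1 * x * x + + 2 * + 0 * x * y + - D * y * y ≡ - + 1 * (x * x + D * y * y)
    e = solve-∀
  classify -[1+ 1 ] (+ 0) γ x y _ _ _ disc _ = ⊥-elim (even-disc (- γ) (trans (e γ) disc))
    where
    e : ∀ γ → + 2 * - γ ≡ - + 2 * γ
    e = solve-∀
  classify -[1+ 1 ] (+ 1) γ x y _ _ 2≤γ disc a≡ =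
    inj₂ (- γ , - (x * x) + x * y + γ * y * y , trans (e₁ γ) disc , subst (2 ℕ.≤_) (sym (ℤₚ.∣-i∣≡∣i∣ γ)) 2≤γ , y ,
        trans a≡ (e x y γ))
    where
    e₁ : ∀ γ → + 2 * - γ ≡ - + 2 * γ
    e₁ = solve-∀
    e : ∀ x y γ → - + 2 * x * x + + 2 * + 1 * x * y + γ * y * y ≡ + 2 * (- (x * x) + x * y + γ * y * y) + - γ * y * y
    e = solve-∀
  classify -[1+ 1 ] -[1+ 0 ] γ x y _ _ 2≤γ disc a≡ =
    inj₂ (- γ , - (x * x) - x * y + γ * y * y , trans (e₁ γ) disc , subst (2 ℕ.≤_) (sym (ℤₚ.∣-i∣≡∣i∣ γ)) 2≤γ , y ,
        trans a≡ (e x y γ))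
    where
    e₁ : ∀ γ → + 2 * - γ ≡ - + 2 * γ
    e₁ = solve-∀
    e : ∀ x y γ → - + 2 * x * x + + 2 * - + 1 * x * y + γ * y * y ≡ + 2 * (- (x * x) - x * y + γ * y * y) + - γ * y * y
    e = solve-∀
  classify (+ 1) (+ suc n) γ x y _ (s≤s p) with subst (ℕ._≤ 0) (ℕₚ.+-suc n (n ℕ.+ 0)) p
  ... | ()
  classify (+ 1) -[1+ n ] γ x y _ (s≤s p) with subst (ℕ._≤ 0) (ℕₚ.+-suc n (n ℕ.+ 0)) p
  ... | ()
  classify -[1+ 0 ] (+ suc n) γ x y _ (s≤s p) with subst (ℕ._≤ 0) (ℕₚ.+-suc n (n ℕ.+ 0)) p
  ... | ()
  classify -[1+ 0 ] -[1+ n ] γ x y _ (s≤s p) with subst (ℕ._≤ 0) (ℕₚ.+-suc n (n ℕ.+ 0)) p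
  ... | ()
  classify (+ 2) (+ suc (suc n)) γ x y _ (s≤s p) with subst (ℕ._≤ 1) (ℕₚ.+-suc (suc n) (suc n ℕ.+ 0)) p
  ... | s≤s ()
  classify (+ 2) -[1+ suc n ] γ x y _ (s≤s p) with subst (ℕ._≤ 1) (ℕₚ.+-suc (suc n) (suc n ℕ.+ 0)) p
  ... | s≤s ()
  classify -[1+ 1 ] (+ suc (suc n)) γ x y _ (s≤s p) with subst (ℕ._≤ 1) (ℕₚ.+-suc (suc n) (suc n ℕ.+ 0)) p
  ... | s≤s ()
  classify -[1+ 1 ] -[1+ suc n ] γ x y _ (s≤s p) with subst (ℕ._≤ 1) (ℕₚ.+-suc (suc n) (suc n ℕ.+ 0)) p
  ... | s≤s ()
  classify (+ suc (suc (suc n))) β γ x y (s≤s (s≤s ()))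
  classify -[1+ suc (suc n) ] β γ x y (s≤s (s≤s ()))

  principal-or-exceptional : Principal D a ⊎ Exceptional D a
  principal-or-exceptional = classify α β γ x y (∣α∣≤2 D≤3 R) 2∣β∣≤∣α∣ ∣α∣≤∣γ∣ disc a≡
    where open Reduction R

square-nonneg : ∀ x → ∃[ n ] x * x ≡ + n
square-nonneg (+ n)    = n ℕ.* n , sym (ℤₚ.pos-* n n)
square-nonneg -[1+ n ] = suc n ℕ.* suc n , refl

norm-nonneg : ∀ k x y → ∃[ n ] x * x + + k * y * y ≡ + n
norm-nonneg k x y with square-nonneg x | square-nonneg y
... | m , e | n , f = m ℕ.+ k ℕ.* n , trans (cong₂ _+_ e (trans (ℤₚ.*-assoc (+ k) y y) (cong (λ z → + k * z) f)))
  (trans (cong (λ z → + m + z) (sym (ℤₚ.pos-* k n))) (sym (ℤₚ.pos-+ m (k ℕ.* n))))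

positive-not-negative : ∀ p k x y → + suc p ≢ - + 1 * (x * x + + k * y * y)
positive-not-negative p k x y e with norm-nonneg k x y
... | zero  , f with trans e (cong (λ z → - + 1 * z) f)
... | ()
positive-not-negative p k x y e | suc n , f with trans e (cong (λ z → - + 1 * z) f)
... | ()

nonSquare⁺ : ∀ k b → b * b + + suc k ≢ + 0
nonSquare⁺ k b e with square-nonneg b
... | n , f with trans (sym (ℤₚ.pos-+ n (suc k))) (trans (cong (_+ + suc k) (sym f)) e)
... | q with trans (sym (ℕₚ.+-suc n k)) (ℤₚ.+-injective q)
... | ()

nonSquare⁻³ : ∀ b → b * b + - + 3 ≢ + 0
nonSquare⁻³ b e = byResidues 9 (x₀ :* x₀ :- con 3 ≈ 0 ⇒ never) (vec₁ b) (cong (_%ℕ 9) e)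

-- A root b of -1 modulo n = `suc p` makes (n, b, c) a form of determinant 1 with value n, hence
-- equivalent to ±(X² + Y²); positivity fixes the sign. An exceptional form would have γ = 1, which
-- is too small.
two-squares : ∀ p b c → + suc p * c ≡ b * b + + 1 → ∃[ x ] ∃[ y ] + suc p ≡ x * x + y * y
two-squares p b c e with principal-or-exceptional (nonSquare⁺ 0) refl (s≤s z≤n)
    (reduction (+ 1) (nonSquare⁺ 0) (+ suc p) b c e)
... | inj₁ (s , x , y , inj₁ refl , f) = x , y , trans f (l x y)
  where
  l : ∀ x y → + 1 * (x * x + + 1 * y * y) ≡ x * x + y * y
  l = solve-∀
... | inj₁ (s , x , y , inj₂ refl , f) = ⊥-elim (positive-not-negative p 1 x y f)
... | inj₂ (γ , u , 2γ≡ , 2≤γ , _) with ℤₚ.*-cancelˡ-≡ (+ 2) γ (+ 1) 2γ≡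
... | refl with 2≤γ
... | s≤s ()

-- For determinant 3 the exceptional forms have γ = 2 and take only even values, so oddness excludes
-- them.
square+3square : ∀ p b c → + suc p * c ≡ b * b + + 3 → + suc p %ℕ 2 ≡ 1 → ∃[ x ] ∃[ y ] + suc p ≡ x * x + + 3 * y * y
square+3square p b c e odd with principal-or-exceptional (nonSquare⁺ 2) refl (s≤s (s≤s (s≤s z≤n)))
    (reduction (+ 3) (nonSquare⁺ 2) (+ suc p) b c e)
... | inj₁ (s , x , y , inj₁ refl , f) = x , y , trans f (ℤₚ.*-identityˡ (x * x + + 3 * y * y))
... | inj₁ (s , x , y , inj₂ refl , f) = ⊥-elim (positive-not-negative p 3 x y f)
... | inj₂ (γ , u , 2γ≡ , 2≤γ , y , f) with ℤₚ.*-cancelˡ-≡ (+ 2) γ (+ 2) 2γ≡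
... | refl = ⊥-elim (even-form u y (trans (cong (_%ℕ 2) (sym f)) odd))
  where
  even-form : ∀ u y → (+ 2 * u + + 2 * y * y) %ℕ 2 ≢ 1
  even-form u y = byResidues 2 (con 2 :* x₀ :+ con 2 :* x₁ :* x₁ ≈ 1 ⇒ never) (vec₂ u y)

-- The exceptional forms would have γ = -1. The form X² - 3Y² is indefinite, so here both signs
-- remain.
square-3square : ∀ d b c → d * c ≡ b * b + - + 3 → Principal (- + 3) d
square-3square d b c e with principal-or-exceptional nonSquare⁻³ refl (s≤s (s≤s (s≤s z≤n)))
    (reduction (- + 3) nonSquare⁻³ d b c e)
... | inj₁ r = r
... | inj₂ (γ , u , 2γ≡ , 2≤γ , _) with ℤₚ.*-cancelˡ-≡ (+ 2) γ (- + 1) 2γ≡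
... | refl with 2≤γ
... | s≤s ()

-- Prime divisors of u² + 3v²

prime-factor : ∀ n → n ≢ 0 → n ≢ 1 → ∃[ q ] Prime q × q ℕ.∣ n
prime-factor n n≢0 n≢1 with factorise n {{ℕ.≢-nonZero n≢0}}
... | record { factors = [] ; isFactorisation = e } = ⊥-elim (n≢1 e)
... | record { factors = q ∷ qs ; isFactorisation = e ; factorsPrime = p All.∷ _ } =
  q , p , ℕ.divides (product qs) (trans e (ℕₚ.*-comm q (product qs)))

euclid : ∀ {q} a b → Prime q → + q ∣ℤ a * b → + q ∣ℤ a ⊎ + q ∣ℤ b
euclid {q} a b p d with euclidsLemma ∣ a ∣ ∣ b ∣ p (subst (q ℕ.∣_) (ℤₚ.abs-* a b) (∣⇒∣ᵤ d))
... | inj₁ x = inj₁ (∣ᵤ⇒∣ x)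
... | inj₂ x = inj₂ (∣ᵤ⇒∣ x)

euclid² : ∀ {q} a → Prime q → + q ∣ℤ a * a → + q ∣ℤ a
euclid² a p d = [ (λ x → x) , (λ x → x) ]′ (euclid a a p d)

prime>1 : ∀ {q} → Prime q → 1 ℕ.< q
prime>1 p = ℕ.nonTrivial⇒n>1 _ {{prime⇒nonTrivial p}}

pos-linear : ∀ x y m n → 1 ℕ.+ y ℕ.* n ≡ x ℕ.* m → + 1 + + y * + n ≡ + x * + m
pos-linear x y m n eq = begin
  + 1 + + y * + n      ≡⟨ cong (λ z → + 1 + z) (ℤₚ.pos-* y n) ⟨
  + 1 + + (y ℕ.* n)    ≡⟨ ℤₚ.pos-+ 1 (y ℕ.* n) ⟨
  + (1 ℕ.+ y ℕ.* n)    ≡⟨ cong +_ eq ⟩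
  + (x ℕ.* m)          ≡⟨ ℤₚ.pos-* x m ⟩
  + x * + m            ∎
  where open ≡-Reasoning

bezout-combine₁ : ∀ x y s t a b m n → + 1 + y * n ≡ x * m → m ≡ s * a → n ≡ t * b → a * (x * s) + b * - (y * t) ≡ + 1
bezout-combine₁ x y s t a b m n e f g = by₃ (- + 1) e (- x) f y g (solve (x ∷ y ∷ s ∷ t ∷ a ∷ b ∷ m ∷ n ∷ []))
bezout-combine₂ : ∀ x y s t a b m n → + 1 + x * m ≡ y * n → m ≡ s * a → n ≡ t * b → a * - (x * s) + b * (y * t) ≡ + 1
bezout-combine₂ x y s t a b m n e f g = by₃ (- + 1) e x f (- y) g (solve (x ∷ y ∷ s ∷ t ∷ a ∷ b ∷ m ∷ n ∷ []))

bezout : ∀ a b → Coprime ∣ a ∣ ∣ b ∣ → ∃[ s ] ∃[ t ] a * s + b * t ≡ + 1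
bezout a b c = from (coprime-Bézout c) (abs-unit-multiple a) (abs-unit-multiple b)
  where
  from : Bézout.Identity 1 ∣ a ∣ ∣ b ∣ → (∃[ s ] + ∣ a ∣ ≡ s * a) → (∃[ t ] + ∣ b ∣ ≡ t * b) →
      ∃[ s ] ∃[ t ] a * s + b * t ≡ + 1
  from (Bézout.+- x y eq) (s , e) (t , f) = + x * s , - (+ y * t) ,
    bezout-combine₁ (+ x) (+ y) s t a b (+ ∣ a ∣) (+ ∣ b ∣) (pos-linear x y ∣ a ∣ ∣ b ∣ eq) e f
  from (Bézout.-+ x y eq) (s , e) (t , f) = - (+ x * s) , + y * t ,
    bezout-combine₂ (+ x) (+ y) s t a b (+ ∣ a ∣) (+ ∣ b ∣) (pos-linear y x ∣ b ∣ ∣ a ∣ eq) e f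

bezout-or-common : ∀ a b → a ≢ + 0 →
  (∃[ s ] ∃[ t ] a * s + b * t ≡ + 1) ⊎ (∃[ q ] Prime q × + q ∣ℤ a × + q ∣ℤ b)
bezout-or-common a b a≢0 with gcd ∣ a ∣ ∣ b ∣ ℕ.≟ 1
... | yes e = inj₁ (bezout a b (gcd≡1⇒coprime e))
... | no g≢1 with prime-factor (gcd ∣ a ∣ ∣ b ∣) g≢0 g≢1
  where
  g≢0 : gcd ∣ a ∣ ∣ b ∣ ≢ 0
  g≢0 e = a≢0 (ℤₚ.∣i∣≡0⇒i≡0 (ℕ.0∣⇒≡0 (subst (ℕ._∣ ∣ a ∣) e (gcd[m,n]∣m ∣ a ∣ ∣ b ∣))))
... | q , p , d = inj₂ (q , p , ∣ᵤ⇒∣ (ℕ.∣-trans d (gcd[m,n]∣m ∣ a ∣ ∣ b ∣)) , ∣ᵤ⇒∣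
    (ℕ.∣-trans d (gcd[m,n]∣n ∣ a ∣ ∣ b ∣)))

+prime≢0 : ∀ {q} → Prime q → + q ≢ + 0
+prime≢0 p refl = ℕ.≢-nonZero⁻¹ 0 {{prime⇒nonZero p}} refl

bezout-prime : ∀ {q} b → Prime q → ¬ + q ∣ℤ b → ∃[ s ] ∃[ t ] + q * s + b * t ≡ + 1
bezout-prime {q} b p q∤b with bezout-or-common (+ q) b (+prime≢0 p)
... | inj₁ r = r
... | inj₂ (r , pr , r∣q , r∣b) with prime⇒irreducible p (∣⇒∣ᵤ r∣q)
... | inj₁ refl = ⊥-elim (ℕₚ.<-irrefl refl (prime>1 pr))
... | inj₂ refl = ⊥-elim (q∤b r∣b)

cancel-prime : ∀ {q} a b → Prime q → + q * a ≡ + q * b → a ≡ b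
cancel-prime {q} a b p = ℤₚ.*-cancelˡ-≡ (+ q) a b {{prime⇒nonZero p}}

-- u + v √-3 = (x + y √-3)(u′ + v′ √-3), where x + y √-3 has norm q.
record Splits (q : ℕ) (u v : ℤ) : Set where
  field
    x y u′ v′ : ℤ
    q≡ : + q ≡ x * x + + 3 * y * y
    u≡ : u ≡ x * u′ - + 3 * y * v′
    v≡ : v ≡ x * v′ + y * u′

module _ (q u v k x y : ℤ) (e : u * u + + 3 * v * v ≡ k * q) (q≡ : q ≡ x * x + + 3 * y * y) where

  -- Modulo q both u² ≡ -3v² and x² ≡ -3y², so u/v and x/y agree up to sign; the two factors
  -- correspond to the two signs.
  split-product : (v * x - u * y) * (v * x + u * y) ≡ (v * v - y * y * k) * q
  split-product = by₂ (- (y * y)) e (- (v * v)) q≡ (solve (q ∷ u ∷ v ∷ k ∷ x ∷ y ∷ []))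

  module _ (v′ : ℤ) (f : v * x - u * y ≡ v′ * q) where

    split-square : (u * x + + 3 * v * y) * (u * x + + 3 * v * y) ≡ (k * q - + 3 * v′ * (v * x - u * y)) * q
    split-square = by₃ (x * x + + 3 * y * y) e (- (k * q)) q≡ (- + 3 * (v * x - u * y)) f
      (solve (q ∷ u ∷ v ∷ k ∷ x ∷ y ∷ v′ ∷ []))

    module _ (u′ : ℤ) (g : u * x + + 3 * v * y ≡ u′ * q) where

      split-u : q * u ≡ q * (x * u′ - + 3 * y * v′)
      split-u = by₃ u q≡ (- + 3 * y) f x g (solve (q ∷ u ∷ v ∷ x ∷ y ∷ u′ ∷ v′ ∷ []))

      split-v : q * v ≡ q * (x * v′ + y * u′)
      split-v = by₃ v q≡ x f y g (solve (q ∷ u ∷ v ∷ x ∷ y ∷ u′ ∷ v′ ∷ []))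

-- The product (u + v√-3)(x - y√-3) has norm divisible by q² and, by assumption, its √-3-coordinate
-- v x - u y divisible by q. Hence its rational coordinate is divisible as well, and dividing by q
-- gives the quotient of u + v√-3 by x + y√-3.
split-divisor : ∀ {q} u v k x y → Prime q → u * u + + 3 * v * v ≡ k * + q → + q ≡ x * x + + 3 * y * y →
  + q ∣ℤ v * x - u * y → Splits q u v
split-divisor {q} u v k x y p e q≡ (divides v′ f) =
  build (euclid² (u * x + + 3 * v * y) p
      (divides (k * + q - + 3 * v′ * (v * x - u * y)) (split-square (+ q) u v k x y e q≡ v′ f)))
  where
  build : + q ∣ℤ u * x + + 3 * v * y → Splits q u v
  build (divides u′ g) = record { x = x ; y = y ; u′ = u′ ; v′ = v′ ; q≡ = q≡
    ; u≡ = cancel-prime u (x * u′ - + 3 * y * v′) p (split-u (+ q) u v k x y e q≡ v′ f u′ g)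
    ; v≡ = cancel-prime v (x * v′ + y * u′) p (split-v (+ q) u v k x y e q≡ v′ f u′ g) }

split-form : ∀ {q} u v k x y → Prime q → u * u + + 3 * v * v ≡ k * + q → + q ≡ x * x + + 3 * y * y → Splits q u v
split-form {q} u v k x y p e q≡ = choose (euclid (v * x - u * y) (v * x + u * y) p
    (divides (v * v - y * y * k) (split-product (+ q) u v k x y e q≡)))
  where
  neg-y : ∀ x y → x * x + + 3 * y * y ≡ x * x + + 3 * - y * - y
  neg-y = solve-∀
  neg-uy : ∀ u v x y → v * x + u * y ≡ v * x - u * - y
  neg-uy = solve-∀
  choose : + q ∣ℤ (v * x - u * y) ⊎ + q ∣ℤ (v * x + u * y) → Splits q u v
  choose (inj₁ d) = split-divisor u v k x y p e q≡ d
  choose (inj₂ (divides m f)) = split-divisor u v k x (- y) p e (trans q≡ (neg-y x y))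
    (divides m (trans (sym (neg-uy u v x y)) f))

prime-divides-v : ∀ q u v k l → u * u + + 3 * v * v ≡ k * q → v ≡ l * q → u * u ≡ (k - + 3 * l * v) * q
prime-divides-v q u v k l e f = by₂ (+ 1) e (- + 3 * v) f (solve (q ∷ u ∷ v ∷ k ∷ l ∷ []))

-- Since t inverts v modulo q, u t is a square root of -3 modulo q; the equation is in the shape
-- needed for reducing a form.
inverse-form : ∀ q u v k s t → u * u + + 3 * v * v ≡ k * q → q * s + v * t ≡ + 1 →
  q * (t * t * k + + 3 * s * (+ 1 + v * t)) ≡ u * t * (u * t) + + 3
inverse-form q u v k s t e bz = by₂ (- (t * t)) e (+ 3 * (+ 1 + v * t)) bz (solve (q ∷ u ∷ v ∷ k ∷ s ∷ t ∷ []))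

-- Substitute for unique factorisation: if q does not divide v, then u/v is a root of -3 modulo q,
-- so q is a norm x² + 3y², and one of x ± y√-3 divides u + v√-3.
split-prime : ∀ {q} u v → Prime q → + q %ℕ 2 ≡ 1 → + q ∣ℤ u * u + + 3 * v * v → (+ q ∣ℤ u × + q ∣ℤ v) ⊎ Splits q u v
split-prime {zero} u v p odd d = ⊥-elim (+prime≢0 p refl)
split-prime {suc q-1} u v p odd (divides k e) = by-v (+ suc q-1 ∣? v)
  where
  q = suc q-1
  unit : (∃[ s ] ∃[ t ] + q * s + v * t ≡ + 1) → Splits q u v
  unit (s , t , bz) = from (square+3square q-1 (u * t) (t * t * k + + 3 * s * (+ 1 + v * t))
      (inverse-form (+ q) u v k s t e bz) odd)
    where
    from : (∃[ x ] ∃[ y ] + q ≡ x * x + + 3 * y * y) → Splits q u v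
    from (x , y , q≡) = split-form u v k x y p e q≡
  by-v : _ → (+ q ∣ℤ u × + q ∣ℤ v) ⊎ Splits q u v
  by-v (yes (divides l f)) = inj₁
      (euclid² u p (divides (k - + 3 * l * v) (prime-divides-v (+ q) u v k l e f)) , divides l f)
  by-v (no q∤v) = inj₂ (unit (bezout-prime v p q∤v))

-- Comparison of p = A² + 9B² with p = u² + 12e²

unit12 : ∀ {n} → Poly n → Formula n
unit12 e = e ≈ 1 ∥ e ≈ 5 ∥ e ≈ 7 ∥ e ≈ 11

±1mod12 ±5mod12 : ∀ {n} → Poly n → Formula n
±1mod12 e = e ≈ 1 ∥ e ≈ 11
±5mod12 e = e ≈ 5 ∥ e ≈ 7

Unit12 ±1Mod12 ±5Mod12 : ℤ → Set
Unit12 a = a %ℕ 12 ≡ 1 ⊎ a %ℕ 12 ≡ 5 ⊎ a %ℕ 12 ≡ 7 ⊎ a %ℕ 12 ≡ 11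
±1Mod12 a = a %ℕ 12 ≡ 1 ⊎ a %ℕ 12 ≡ 11
±5Mod12 a = a %ℕ 12 ≡ 5 ⊎ a %ℕ 12 ≡ 7

unit12-nonzero : ∀ d → Unit12 d → d ≢ + 0
unit12-nonzero d (inj₁ ()) refl
unit12-nonzero d (inj₂ (inj₁ ())) refl
unit12-nonzero d (inj₂ (inj₂ (inj₁ ()))) refl
unit12-nonzero d (inj₂ (inj₂ (inj₂ ()))) refl

abs-grows : ∀ {q} m → m ≢ + 0 → Prime q → ∣ m ∣ ℕ.< ∣ m * + q ∣
abs-grows {q} m m≢0 p = subst (∣ m ∣ ℕ.<_) (sym (ℤₚ.abs-* m (+ q)))
  (ℕₚ.m<m*n ∣ m ∣ q {{ℕ.≢-nonZero (λ e → m≢0 (ℤₚ.∣i∣≡0⇒i≡0 e))}} (prime>1 p))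

abs-grows² : ∀ {q} m → m ≢ + 0 → Prime q → ∣ m ∣ ℕ.< ∣ m * + q * + q ∣
abs-grows² {q} m m≢0 p = ℕₚ.<-trans (abs-grows m m≢0 p) (abs-grows (m * + q) mq≢0 p)
  where
  mq≢0 : m * + q ≢ + 0
  mq≢0 e = [ m≢0 , +prime≢0 p ]′ (ℤₚ.i*j≡0⇒i≡0∨j≡0 m e)

CommonPrime : ℤ → ℤ → ℤ → ℤ → Set
CommonPrime a b x y = ∃[ q ] Prime q × (+ q ∣ℤ a) × (+ q ∣ℤ b) × (+ q ∣ℤ x) × (+ q ∣ℤ y)

principal-unit : ∀ d → Unit12 d → Principal (- + 3) d → ±1Mod12 d
principal-unit d unit (s , x , y , inj₁ refl , refl) =
  byResidues 12 (unit12 N ⇒ ±1mod12 N) (vec₂ x y) unit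
  where
  N : Poly 2
  N = con 1 :* (x₀ :* x₀ :+ :- con 3 :* x₁ :* x₁)
principal-unit d unit (s , x , y , inj₂ refl , refl) =
  byResidues 12 (unit12 N ⇒ ±1mod12 N) (vec₂ x y) unit
  where
  N : Poly 2
  N = :- con 1 :* (x₀ :* x₀ :+ :- con 3 :* x₁ :* x₁)

module _ (d d₂ x y q : ℤ) (e : d * d₂ ≡ x * x - + 3 * y * y) (d′ y′ : ℤ) (d≡ : d ≡ d′ * q) (y≡ : y ≡ y′ * q) where

  divisor-x² : x * x ≡ (d′ * d₂ + + 3 * y′ * y) * q
  divisor-x² = by₃ (- + 1) e d₂ d≡ (+ 3 * y) y≡ (solve (d ∷ d₂ ∷ x ∷ y ∷ q ∷ d′ ∷ y′ ∷ []))

  module _ (x′ : ℤ) (x≡ : x ≡ x′ * q) where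

    divisor-dd₂ : x * x - + 3 * y * y ≡ q * ((x′ * x′ - + 3 * y′ * y′) * q)
    divisor-dd₂ = by₂ (x + x′ * q) x≡ (- + 3 * (y + y′ * q)) y≡ (solve (x ∷ y ∷ q ∷ x′ ∷ y′ ∷ []))

    divisor-d′d₂ : q * (d′ * d₂) ≡ q * ((x′ * x′ - + 3 * y′ * y′) * q)
    divisor-d′d₂ = by₃ (- d₂) d≡ (+ 1) e (+ 1) divisor-dd₂ (solve (d ∷ d₂ ∷ x ∷ y ∷ q ∷ d′ ∷ x′ ∷ y′ ∷ []))

divisor-d″d₂ : ∀ q d′ d″ d₂ N → d′ * d₂ ≡ N * q → d′ ≡ d″ * q → q * (d″ * d₂) ≡ q * N
divisor-d″d₂ q d′ d″ d₂ N e f = by₂ (+ 1) e (- d₂) f (solve (q ∷ d′ ∷ d″ ∷ d₂ ∷ N ∷ []))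

divisor-form : ∀ d d₂ x y s t → d * d₂ ≡ x * x - + 3 * y * y → d * s + y * t ≡ + 1 →
  d * (t * t * d₂ - + 3 * s * (+ 1 + y * t)) ≡ x * t * (x * t) + - + 3
divisor-form d d₂ x y s t e bz = by₂ (t * t) e (- + 3 * (+ 1 + y * t)) bz (solve (d ∷ d₂ ∷ x ∷ y ∷ s ∷ t ∷ []))

-- Common prime factors of d and y are divided out; once d is prime to y, it is of the form ±(X² - 3Y²).
divisor-±1 : ∀ d d₂ x y → d * d₂ ≡ x * x - + 3 * y * y → Unit12 d → ¬ CommonPrime d d₂ x y → ±1Mod12 d
divisor-±1 d d₂ x y = go d x y (<-wellFounded ∣ d ∣)
  where
  go : ∀ d x y → Acc ℕ._<_ ∣ d ∣ → d * d₂ ≡ x * x - + 3 * y * y → Unit12 d → ¬ CommonPrime d d₂ x y → ±1Mod12 d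
  go d x y (acc rs) e unit noCommon = split (bezout-or-common d y (unit12-nonzero d unit))
    where
    split : _ → ±1Mod12 d
    split (inj₁ (s , t , bz)) = principal-unit d unit
      (square-3square d (x * t) (t * t * d₂ - + 3 * s * (+ 1 + y * t)) (divisor-form d d₂ x y s t e bz))
    split (inj₂ (q , p , divides d′ d≡ , divides y′ y≡)) =
      extract-x (euclid² x p (divides (d′ * d₂ + + 3 * y′ * y) (divisor-x² d d₂ x y (+ q) e d′ y′ d≡ y≡)))
      where
      extract-x : + q ∣ℤ x → ±1Mod12 d
      extract-x (divides x′ x≡) = extract-d (euclid d′ d₂ p (divides N d′d₂≡))
        where
        N = x′ * x′ - + 3 * y′ * y′
        d′d₂≡ : d′ * d₂ ≡ N * + q
        d′d₂≡ = cancel-prime (d′ * d₂) (N * + q) p (divisor-d′d₂ d d₂ x y (+ q) e d′ y′ d≡ y≡ x′ x≡)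
        extract-d : + q ∣ℤ d′ ⊎ + q ∣ℤ d₂ → ±1Mod12 d
        extract-d (inj₂ q∣d₂) = ⊥-elim (noCommon (q , p , divides d′ d≡ , q∣d₂ , divides x′ x≡ , divides y′ y≡))
        -- `d` and `d″` differ by the square of a unit modulo 12, hence are congruent.
        extract-d (inj₁ (divides d″ d′≡)) = subst ±1Mod12 (sym d≡d″qq)
          (byResidues 12 (±1mod12 x₀ ⇒ unit12 (x₀ :* x₁ :* x₁) ⇒ ±1mod12 (x₀ :* x₁ :* x₁)) (vec₂ d″ (+ q))
            (go d″ x′ y′ (rs (subst (λ z → ∣ d″ ∣ ℕ.< ∣ z ∣) (sym d≡d″qq) (abs-grows² d″ (unit12-nonzero d″ unit″) p)))
              (cancel-prime (d″ * d₂) N p (divisor-d″d₂ (+ q) d′ d″ d₂ N d′d₂≡ d′≡))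
              unit″ noCommon″)
            unit′)
          where
          d≡d″qq : d ≡ d″ * + q * + q
          d≡d″qq = trans d≡ (cong (_* + q) d′≡)
          unit′ : Unit12 (d″ * + q * + q)
          unit′ = subst Unit12 d≡d″qq unit
          unit″ : Unit12 d″
          unit″ = byResidues 12 (unit12 (x₀ :* x₁ :* x₁) ⇒ unit12 x₀) (vec₂ d″ (+ q)) unit′
          multiple : ∀ {r z z′ q} → z ≡ z′ * q → r ∣ℤ z′ → r ∣ℤ z
          multiple {r} {z} {z′} {q} z≡ (divides k z′≡) = divides (k * q) (l r z z′ q k z≡ z′≡)
            where
            l : ∀ r z z′ q k → z ≡ z′ * q → z′ ≡ k * r → z ≡ k * q * r
            l r z z′ q k e f = by₂ (+ 1) e q f (solve (r ∷ z ∷ z′ ∷ q ∷ k ∷ []))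
          noCommon″ : ¬ CommonPrime d″ d₂ x′ y′
          noCommon″ (r , pr , r∣d″ , r∣d₂ , r∣x′ , r∣y′) =
            noCommon (r , pr , multiple d≡ (multiple d′≡ r∣d″) , r∣d₂ , multiple x≡ r∣x′ , multiple y≡ r∣y′)

prime-not-square-multiple : ∀ {p q} k → Prime p → Prime q → + p ≢ k * + q * + q
prime-not-square-multiple {p} {q} k pp pq e with prime⇒irreducible pp (∣⇒∣ᵤ (divides (k * + q) e))
... | inj₁ refl = ℕₚ.<-irrefl refl (prime>1 pq)
... | inj₂ refl = ℕₚ.<⇒≱ (prime>1 pp) (ℕ.∣⇒≤ (∣⇒∣ᵤ (divides k (cancel-prime (+ 1) (k * + p) pp
    (trans (ℤₚ.*-identityʳ (+ p)) (trans e (ℤₚ.*-comm (k * + p) (+ p))))))))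

prime∣2 : ∀ {q} → Prime q → + q ∣ℤ + 2 → q ≡ 2
prime∣2 {zero} p d = ⊥-elim (+prime≢0 p refl)
prime∣2 {suc zero} p d = ⊥-elim (ℕₚ.<-irrefl refl (prime>1 p))
prime∣2 {suc (suc zero)} p d = refl
prime∣2 {suc (suc (suc q))} p d with ℕ.∣⇒≤ (∣⇒∣ᵤ d)
... | s≤s (s≤s ())

unit12-divisor : ∀ {q} d → Prime q → Unit12 d → + q ∣ℤ d → Unit12 (+ q)
unit12-divisor {q} d p unit (divides k refl) = byResidues 12 (unit12 (x₀ :* x₁) ⇒ unit12 x₁) (vec₂ k (+ q)) unit

odd-prime-half : ∀ {q} d a → Prime q → Unit12 d → + q ∣ℤ d → + q ∣ℤ + 2 * a → + q ∣ℤ a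
odd-prime-half {q} d a p unit q∣d q∣2a with euclid (+ 2) a p q∣2a
... | inj₂ r = r
... | inj₁ q∣2 with prime∣2 p q∣2
... | refl with unit12-divisor d p unit q∣d
... | inj₁ ()
... | inj₂ (inj₁ ())
... | inj₂ (inj₂ (inj₁ ()))
... | inj₂ (inj₂ (inj₂ ()))

unit12⇒odd : ∀ u → Unit12 u → (+ 4 * u) %ℕ 8 ≡ 4
unit12⇒odd u (inj₁ e) = subst (λ z → (+ 4 * z) %ℕ 8 ≡ 4) (sym (quotient-form 12 u 1 e))
  (byResidues 8 (con 4 :* (con 12 :* x₀ :+ con 1) ≈ 4) (vec₁ (u /ℕ 12)))
unit12⇒odd u (inj₂ (inj₁ e)) = subst (λ z → (+ 4 * z) %ℕ 8 ≡ 4) (sym (quotient-form 12 u 5 e))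
  (byResidues 8 (con 4 :* (con 12 :* x₀ :+ con 5) ≈ 4) (vec₁ (u /ℕ 12)))
unit12⇒odd u (inj₂ (inj₂ (inj₁ e))) = subst (λ z → (+ 4 * z) %ℕ 8 ≡ 4) (sym (quotient-form 12 u 7 e))
  (byResidues 8 (con 4 :* (con 12 :* x₀ :+ con 7) ≈ 4) (vec₁ (u /ℕ 12)))
unit12⇒odd u (inj₂ (inj₂ (inj₂ e))) = subst (λ z → (+ 4 * z) %ℕ 8 ≡ 4) (sym (quotient-form 12 u 11 e))
  (byResidues 8 (con 4 :* (con 12 :* x₀ :+ con 11) ≈ 4) (vec₁ (u /ℕ 12)))

-- Both congruences say that z is even; this carries a parity found modulo 8 over to computations
-- modulo 12.
even-8⇒12 : ∀ z → (+ 4 * z) %ℕ 8 ≡ 0 → (+ 6 * z) %ℕ 12 ≡ 0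
even-8⇒12 z e = from (scaled-multiple 4 2 z e)
  where
  from : (∃[ k ] z ≡ + 2 * k) → (+ 6 * z) %ℕ 12 ≡ 0
  from (k , refl) = byResidues 12 (con 6 :* (con 2 :* x₀) ≈ 0) (vec₁ k)

square-sum-divisor : ∀ {p q} k x y → Prime p → Prime q → + p ≡ x * x + k * y * y → + q ∣ℤ x → + q ∣ℤ y → ⊥
square-sum-divisor {p} {q} k x y pp pq e (divides x′ x≡) (divides y′ y≡) =
  prime-not-square-multiple (x′ * x′ + k * y′ * y′) pp pq (trans e (l k x y x′ y′ (+ q) x≡ y≡))
  where
  l : ∀ k x y x′ y′ q → x ≡ x′ * q → y ≡ y′ * q → x * x + k * y * y ≡ (x′ * x′ + k * y′ * y′) * q * q
  l k x y x′ y′ q e f = by₂ (x + x′ * q) e (k * (y + y′ * q)) f (solve (k ∷ x ∷ y ∷ x′ ∷ y′ ∷ q ∷ []))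

∣-linear : ∀ {q a b} m n → q ∣ℤ a → q ∣ℤ b → q ∣ℤ m * a + n * b
∣-linear {q} m n (divides k refl) (divides l refl) = divides (m * k + n * l) (i m n k l q)
  where
  i : ∀ m n k l q → m * (k * q) + n * (l * q) ≡ (m * k + n * l) * q
  i = solve-∀

unit-u : ∀ {p} u e → + p %ℕ 12 ≡ 1 → + p ≡ u * u + + 12 * e * e → Unit12 u
unit-u u e p≡1 p≡ = byResidues 12 (x₀ :* x₀ :+ con 12 :* x₁ :* x₁ ≈ 1 ⇒ unit12 x₀) (vec₂ u e)
    (trans (cong (_%ℕ 12) (sym p≡)) p≡1)

module _ {p} (pp : Prime p) (p≡1 : + p %ℕ 12 ≡ 1) where

  -- Subtracting the two representations gives (2a + u)(2a - u) = 3((2e)² - 3B²). As 3 divides 2a -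
  -- u, the factor d = 2a + u divides some x² - 3y² and is ±1 mod 12. Since a ≡ e mod 2, u + 6e is d
  -- mod 4 but -d mod 3, which is the class ±5.
  link-even₁ : ∀ a B u e → + p ≡ + 4 * a * a + + 9 * B * B → + p ≡ u * u + + 12 * e * e →
    (+ 4 * (+ 2 * a - u)) %ℕ 12 ≡ 0 → ±5Mod12 (u + + 6 * e)
  link-even₁ a B u e p≡₁ p≡₂ A≡u = byResidues 12
      (±1mod12 (con 2 :* x₀ :+ x₁) ⇒ con 4 :* (con 2 :* x₀ :- x₁) ≈ 0 ⇒ con 6 :* (x₀ :- x₂) ≈ 0 ⇒
          ±5mod12 (x₁ :+ con 6 :* x₂))
      (vec₃ a u e) (divisor-±1 d d₂ (+ 2 * e) B dd₂≡ unit-d noCommon) A≡u a≡e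
    where
    d = + 2 * a + u
    third = scaled-multiple 4 3 (+ 2 * a - u) A≡u
    d₂ = proj₁ third
    A-u≡ : + 2 * a - u ≡ + 3 * d₂
    A-u≡ = proj₂ third
    3dd₂≡ : ∀ p a B u e d₂ → p ≡ + 4 * a * a + + 9 * B * B → p ≡ u * u + + 12 * e * e → + 2 * a - u ≡ + 3 * d₂ →
      + 3 * ((+ 2 * a + u) * d₂) ≡ + 3 * (+ 2 * e * (+ 2 * e) - + 3 * B * B)
    3dd₂≡ p a B u e d₂ f g h = by₃ (- + 1) f (+ 1) g (- (+ 2 * a + u)) h (solve (p ∷ a ∷ B ∷ u ∷ e ∷ d₂ ∷ []))
    dd₂≡ : d * d₂ ≡ + 2 * e * (+ 2 * e) - + 3 * B * B
    dd₂≡ = ℤₚ.*-cancelˡ-≡ (+ 3) (d * d₂) (+ 2 * e * (+ 2 * e) - + 3 * B * B) (3dd₂≡ (+ p) a B u e d₂ p≡₁ p≡₂ A-u≡)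
    unit-d : Unit12 d
    unit-d = byResidues 12 (unit12 x₁ ⇒ con 4 :* (con 2 :* x₀ :- x₁) ≈ 0 ⇒ unit12 (con 2 :* x₀ :+ x₁))
      (vec₂ a u) (unit-u u e p≡1 p≡₂) A≡u
    mod8 : ∀ a B u e p → p ≡ + 4 * a * a + + 9 * B * B → p ≡ u * u + + 12 * e * e →
      + 4 * a * a + + 9 * B * B - (u * u + + 12 * e * e) ≡ + 0
    mod8 a B u e p f g = by₂ (- + 1) f (+ 1) g (solve (a ∷ B ∷ u ∷ e ∷ p ∷ []))
    -- `u` and `B` are odd, so modulo 8 the two representations of p leave 4a² ≡ 4e².
    a≡e : (+ 6 * (a - e)) %ℕ 12 ≡ 0
    a≡e = even-8⇒12 (a - e) (byResidues 8
      (con 4 :* x₀ :* x₀ :+ con 9 :* x₁ :* x₁ :- (x₂ :* x₂ :+ con 12 :* x₃ :* x₃) ≈ 0 ⇒ con 4 :* x₂ ≈ 4 ⇒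
          con 4 :* (x₀ :- x₃) ≈ 0)
      (vec₄ a B u e) (cong (_%ℕ 8) (mod8 a B u e (+ p) p≡₁ p≡₂)) (unit12⇒odd u (unit-u u e p≡1 p≡₂)))
    noCommon : ¬ CommonPrime d d₂ (+ 2 * e) B
    noCommon (q , pq , q∣d , q∣d₂ , _ , q∣B) = square-sum-divisor (+ 9) (+ 2 * a) B pp pq (trans p≡₁ (l a B)) q∣A q∣B
      where
      l : ∀ a B → + 4 * a * a + + 9 * B * B ≡ + 2 * a * (+ 2 * a) + + 9 * B * B
      l = solve-∀
      2x≡ : ∀ a u d₂ → + 2 * a - u ≡ + 3 * d₂ → + 1 * (+ 2 * a + u) + + 3 * d₂ ≡ + 2 * (+ 2 * a)
      2x≡ a u d₂ h = by₁ (- + 1) h (solve (a ∷ u ∷ d₂ ∷ []))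
      q∣A : + q ∣ℤ + 2 * a
      q∣A = odd-prime-half d (+ 2 * a) pq unit-d q∣d (subst (+ q ∣ℤ_) (2x≡ a u d₂ A-u≡) (∣-linear (+ 1) (+ 3) q∣d q∣d₂))

  -- As p ≡ 1 mod 3, one of ±u is congruent to 2a mod 3; changing the sign of u preserves the class
  -- ±5.
  link-even : ∀ a B u e → + p ≡ + 4 * a * a + + 9 * B * B → + p ≡ u * u + + 12 * e * e → ±5Mod12 (u + + 6 * e)
  link-even a B u e p≡₁ p≡₂ with byResidues 12
      (con 4 :* x₀ :* x₀ :+ con 9 :* x₁ :* x₁ ≈ 1 ⇒ unit12 x₂ ⇒ con 4 :* (con 2 :* x₀ :- x₂) ≈ 0 ∥
          con 4 :* (con 2 :* x₀ :- :- x₂) ≈ 0)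
      (vec₃ a B u) (trans (cong (_%ℕ 12) (sym p≡₁)) p≡1) (unit-u u e p≡1 p≡₂)
  ... | inj₁ A≡u = link-even₁ a B u e p≡₁ p≡₂ A≡u
  ... | inj₂ A≡-u = byResidues 12 (±5mod12 (:- x₀ :+ con 6 :* x₁) ⇒ ±5mod12 (x₀ :+ con 6 :* x₁)) (vec₂ u e)
    (link-even₁ a B (- u) e p≡₁ (trans p≡₂ (l u e)) A≡-u)
    where
    l : ∀ u e → u * u + + 12 * e * e ≡ - u * - u + + 12 * e * e
    l = solve-∀

  -- Here (u + 6b)(u - 6b) = A² - 3(2e)², so u + 6b is ±1 mod 12; modulo 8 one finds b ≡ e mod 2,
  -- hence u + 6e ≡ u + 6b mod 12.
  link-odd : ∀ A b u e → + p ≡ A * A + + 36 * b * b → + p ≡ u * u + + 12 * e * e → ±1Mod12 (u + + 6 * e)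
  link-odd A b u e p≡₁ p≡₂ = byResidues 12
      (±1mod12 (x₀ :+ con 6 :* x₁) ⇒ con 6 :* (x₁ :- x₂) ≈ 0 ⇒ ±1mod12 (x₀ :+ con 6 :* x₂))
      (vec₃ u b e) (divisor-±1 d d₂ A (+ 2 * e) (dd₂≡ (+ p) A b u e p≡₁ p≡₂) unit-d noCommon) b≡e
    where
    d d₂ : ℤ
    d = u + + 6 * b
    d₂ = u - + 6 * b
    dd₂≡ : ∀ p A b u e → p ≡ A * A + + 36 * b * b → p ≡ u * u + + 12 * e * e →
      (u + + 6 * b) * (u - + 6 * b) ≡ A * A - + 3 * (+ 2 * e) * (+ 2 * e)
    dd₂≡ p A b u e f g = by₂ (+ 1) f (- + 1) g (solve (p ∷ A ∷ b ∷ u ∷ e ∷ []))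
    unit : Unit12 u
    unit = unit-u u e p≡1 p≡₂
    unit-d : Unit12 d
    unit-d = byResidues 12 (unit12 x₀ ⇒ unit12 (x₀ :+ con 6 :* x₁)) (vec₂ u b) unit
    mod8 : ∀ A b u e p → p ≡ A * A + + 36 * b * b → p ≡ u * u + + 12 * e * e →
      A * A + + 36 * b * b - (u * u + + 12 * e * e) ≡ + 0
    mod8 A b u e p f g = by₂ (- + 1) f (+ 1) g (solve (A ∷ b ∷ u ∷ e ∷ p ∷ []))
    b≡e : (+ 6 * (b - e)) %ℕ 12 ≡ 0
    b≡e = even-8⇒12 (b - e) (byResidues 8
      (x₀ :* x₀ :+ con 36 :* x₁ :* x₁ :- (x₂ :* x₂ :+ con 12 :* x₃ :* x₃) ≈ 0 ⇒ con 4 :* x₂ ≈ 4 ⇒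
          con 4 :* (x₁ :- x₃) ≈ 0)
      (vec₄ A b u e) (cong (_%ℕ 8) (mod8 A b u e (+ p) p≡₁ p≡₂)) (unit12⇒odd u unit))
    noCommon : ¬ CommonPrime d d₂ A (+ 2 * e)
    noCommon (q , pq , q∣d , q∣d₂ , _ , q∣2e) = square-sum-divisor (+ 12) u e pp pq p≡₂
      (odd-prime-half d u pq unit-d q∣d (subst (+ q ∣ℤ_) (2x≡ u b) (∣-linear (+ 1) (+ 1) q∣d q∣d₂)))
      (odd-prime-half d e pq unit-d q∣d q∣2e)
      where
      2x≡ : ∀ u b → + 1 * (u + + 6 * b) + + 1 * (u - + 6 * b) ≡ + 2 * u
      2x≡ = solve-∀

-- Counting orbits of a permutation without short orbits

indicator : Bool → ℕ
indicator true  = 1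
indicator false = 0

sum-1 : ∀ n → sum {n} (λ _ → 1) ≡ n
sum-1 zero    = refl
sum-1 (suc n) = cong suc (sum-1 n)

<ᵇ-flip : ∀ {a b} → a ≢ b → (b <ᵇ a) ≡ not (a <ᵇ b)
<ᵇ-flip {zero}  {zero}  ne = ⊥-elim (ne refl)
<ᵇ-flip {zero}  {suc b} ne = refl
<ᵇ-flip {suc a} {zero}  ne = refl
<ᵇ-flip {suc a} {suc b} ne = <ᵇ-flip (ne ∘ cong suc)

<ᵇ-asym₃ : ∀ a b c → (a <ᵇ b) ≡ true → (b <ᵇ c) ≡ true → (c <ᵇ a) ≡ true → ⊥
<ᵇ-asym₃ a b c p q r = ℕₚ.<-irrefl refl (ℕₚ.<-trans (lt a b p) (ℕₚ.<-trans (lt b c q) (lt c a r)))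
  where
  lt : ∀ x y → (x <ᵇ y) ≡ true → x ℕ.< y
  lt x y e = ℕₚ.<ᵇ⇒< x y (subst Bool.T (sym e) _)

-- Marks the least element of an orbit of length 3, so that its sum over a set counts orbits.
least₃ : ℕ → ℕ → ℕ → ℕ
least₃ a b c = indicator ((a <ᵇ b) ∧ (a <ᵇ c))

least₃-unique : ∀ a b c → a ≢ b → b ≢ c → c ≢ a → least₃ a b c ℕ.+ (least₃ b c a ℕ.+ least₃ c a b) ≡ 1
least₃-unique a b c a≢b b≢c c≢a
  rewrite <ᵇ-flip a≢b | <ᵇ-flip b≢c | <ᵇ-flip c≢a
  with a <ᵇ b in p | b <ᵇ c in q | c <ᵇ a in r
... | true  | true  | true  = ⊥-elim (<ᵇ-asym₃ a b c p q r)
... | true  | true  | false = refl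
... | true  | false | true  = refl
... | true  | false | false = refl
... | false | true  | true  = refl
... | false | true  | false = refl
... | false | false | true  = refl
... | false | false | false = ⊥-elim
    (<ᵇ-asym₃ a c b (trans (<ᵇ-flip c≢a) (cong not r)) (trans (<ᵇ-flip b≢c) (cong not q))
        (trans (<ᵇ-flip a≢b) (cong not p)))

-- A knockout: first against the opposite element of the orbit, then between the two minima. Three
-- comparisons thus settle all four rotations.
least₄ : ℕ → ℕ → ℕ → ℕ → ℕ
least₄ a b c d = indicator ((a <ᵇ c) ∧ (a ℕ.⊓ c <ᵇ b ℕ.⊓ d))

least₄-unique : ∀ a b c d → a ≢ c → b ≢ d → a ℕ.⊓ c ≢ b ℕ.⊓ d →
  least₄ a b c d ℕ.+ (least₄ b c d a ℕ.+ (least₄ c d a b ℕ.+ least₄ d a b c)) ≡ 1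
least₄-unique a b c d a≢c b≢d u≢v
  rewrite ℕₚ.⊓-comm c a | ℕₚ.⊓-comm d b | <ᵇ-flip a≢c | <ᵇ-flip b≢d | <ᵇ-flip u≢v
  with a <ᵇ c | b <ᵇ d | a ℕ.⊓ c <ᵇ b ℕ.⊓ d
... | true  | true  | true  = refl
... | true  | true  | false = refl
... | true  | false | true  = refl
... | true  | false | false = refl
... | false | true  | true  = refl
... | false | true  | false = refl
... | false | false | true  = refl
... | false | false | false = refl

module _ {n} (φ : Fin n → Fin n) where

  toℕ-≢ : ∀ {x y : Fin n} → x ≢ y → toℕ x ≢ toℕ y
  toℕ-≢ ne = ne ∘ Finₚ.toℕ-injective

  -- Each orbit contains exactly one marked element, so m + m∘φ + m∘φ² is constantly 1. Its three
  -- parts have equal sums because φ permutes the set.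
  order3 : (∀ x → φ (φ (φ x)) ≡ x) → (∀ x → φ x ≢ x) → ∃[ k ] n ≡ 3 ℕ.* k
  order3 cube free = sum m , (begin
      n                                                   ≡⟨ sum-1 n ⟨
      sum {n} (λ _ → 1)                                   ≡⟨ sum-cong-≗ one ⟨
      sum (λ x → m x ℕ.+ (m (φ x) ℕ.+ m (φ (φ x))))       ≡⟨ ∑-distrib-+ m (λ x → m (φ x) ℕ.+ m (φ (φ x))) ⟩
      sum m ℕ.+ sum (λ x → m (φ x) ℕ.+ m (φ (φ x)))       ≡⟨ cong (sum m ℕ.+_) (∑-distrib-+ (m ∘ φ) (m ∘ φ ∘ φ)) ⟩
      sum m ℕ.+ (sum (m ∘ φ) ℕ.+ sum (m ∘ φ ∘ φ))         ≡⟨ cong₂ (λ x y → sum m ℕ.+ (x ℕ.+ y)) (sum-permute m π)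
          (trans (sum-permute m π) (sum-permute (m ∘ φ) π)) ⟨
      sum m ℕ.+ (sum m ℕ.+ sum m)                         ≡⟨ cong (λ x → sum m ℕ.+ (sum m ℕ.+ x))
          (ℕₚ.+-identityʳ (sum m)) ⟨
      3 ℕ.* sum m                                         ∎)
    where
    open ≡-Reasoning
    m : Fin n → ℕ
    m x = least₃ (toℕ x) (toℕ (φ x)) (toℕ (φ (φ x)))
    π : Permutation′ n
    π = permutation φ (φ ∘ φ) cube cube
    one : ∀ x → m x ℕ.+ (m (φ x) ℕ.+ m (φ (φ x))) ≡ 1
    one x rewrite cube x = least₃-unique (toℕ x) (toℕ (φ x)) (toℕ (φ (φ x)))
      (toℕ-≢ (free x ∘ sym)) (toℕ-≢ (free (φ x) ∘ sym)) (toℕ-≢ (λ e → free (φ (φ x)) (trans (cube x) (sym e))))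

  -- Freeness of φ² already excludes orbits of length 1 and 2, so all orbits have length 4 and the
  -- marked elements count a quarter of the set.
  order4 : (∀ x → φ (φ (φ (φ x))) ≡ x) → (∀ x → φ (φ x) ≢ x) → ∃[ k ] n ≡ 4 ℕ.* k
  order4 fourth free₂ = sum m , (begin
      n                                                   ≡⟨ sum-1 n ⟨
      sum {n} (λ _ → 1)                                   ≡⟨ sum-cong-≗ one ⟨
      sum (λ x → m x ℕ.+ (m (φ x) ℕ.+ (m (φ (φ x)) ℕ.+ m (φ (φ (φ x))))))
        ≡⟨ ∑-distrib-+ m (λ x → m (φ x) ℕ.+ (m (φ (φ x)) ℕ.+ m (φ (φ (φ x))))) ⟩
      sum m ℕ.+ sum (λ x → m (φ x) ℕ.+ (m (φ (φ x)) ℕ.+ m (φ (φ (φ x)))))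
        ≡⟨ cong (sum m ℕ.+_) (∑-distrib-+ (m ∘ φ) (λ x → m (φ (φ x)) ℕ.+ m (φ (φ (φ x))))) ⟩
      sum m ℕ.+ (sum (m ∘ φ) ℕ.+ sum (λ x → m (φ (φ x)) ℕ.+ m (φ (φ (φ x)))))
        ≡⟨ cong (λ z → sum m ℕ.+ (sum (m ∘ φ) ℕ.+ z)) (∑-distrib-+ (m ∘ φ ∘ φ) (m ∘ φ ∘ φ ∘ φ)) ⟩
      sum m ℕ.+ (sum (m ∘ φ) ℕ.+ (sum (m ∘ φ ∘ φ) ℕ.+ sum (m ∘ φ ∘ φ ∘ φ)))
        ≡⟨ cong₂ (λ x y → sum m ℕ.+ (x ℕ.+ y)) e₁ (cong₂ ℕ._+_ e₂ e₃) ⟨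
      sum m ℕ.+ (sum m ℕ.+ (sum m ℕ.+ sum m))             ≡⟨ cong (λ x → sum m ℕ.+ (sum m ℕ.+ (sum m ℕ.+ x)))
          (ℕₚ.+-identityʳ (sum m)) ⟨
      4 ℕ.* sum m                                         ∎)
    where
    open ≡-Reasoning
    m : Fin n → ℕ
    m x = least₄ (toℕ x) (toℕ (φ x)) (toℕ (φ (φ x))) (toℕ (φ (φ (φ x))))
    π : Permutation′ n
    π = permutation φ (φ ∘ φ ∘ φ) fourth fourth
    e₁ = sum-permute m π
    e₂ = trans e₁ (sum-permute (m ∘ φ) π)
    e₃ = trans e₂ (sum-permute (m ∘ φ ∘ φ) π)
    free : ∀ x → φ x ≢ x
    free x e = free₂ x (trans (cong φ e) e)
    free₃ : ∀ x → φ (φ (φ x)) ≢ x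
    free₃ x e = free x (trans (cong φ (sym e)) (fourth x))
    minima : ∀ x → toℕ x ℕ.⊓ toℕ (φ (φ x)) ≢ toℕ (φ x) ℕ.⊓ toℕ (φ (φ (φ x)))
    minima x e with ℕₚ.⊓-sel (toℕ x) (toℕ (φ (φ x))) | ℕₚ.⊓-sel (toℕ (φ x)) (toℕ (φ (φ (φ x))))
    ... | inj₁ a | inj₁ b = toℕ-≢ (free x ∘ sym) (trans (sym a) (trans e b))
    ... | inj₁ a | inj₂ b = toℕ-≢ (free₃ x ∘ sym) (trans (sym a) (trans e b))
    ... | inj₂ a | inj₁ b = toℕ-≢ (free (φ x)) (trans (sym a) (trans e b))
    ... | inj₂ a | inj₂ b = toℕ-≢ (free (φ (φ x)) ∘ sym) (trans (sym a) (trans e b))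
    one : ∀ x → m x ℕ.+ (m (φ x) ℕ.+ (m (φ (φ x)) ℕ.+ m (φ (φ (φ x))))) ≡ 1
    one x rewrite fourth x =
      least₄-unique (toℕ x) (toℕ (φ x)) (toℕ (φ (φ x))) (toℕ (φ (φ (φ x))))
        (toℕ-≢ (free₂ x ∘ sym)) (toℕ-≢ (free₂ (φ x) ∘ sym)) (minima x)

-- Square roots of -1 and -3 modulo a prime

prime∤small : ∀ {p} m → Prime p → m ≢ 0 → m ℕ.< p → ¬ (+ p ∣ℤ + m)
prime∤small m pp m≢0 m<p d = ℕₚ.<⇒≱ m<p (ℕ.∣⇒≤ {{ℕ.≢-nonZero m≢0}} (∣⇒∣ᵤ d))

small-congruent⇒≡ : ∀ p .{{_ : ℕ.NonZero p}} a b → a ℕ.< p → b ℕ.< p → + p ∣ℤ + a - + b → a ≡ b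
small-congruent⇒≡ p a b a<p b<p (divides k e) = begin
    a            ≡⟨ ℕ.m<n⇒m%n≡m a<p ⟨
    + a %ℕ p     ≡⟨ %ℕ-cong p (+ a) (+ b) k (move (+ a) (+ b) (k * + p) e) ⟩
    + b %ℕ p     ≡⟨ ℕ.m<n⇒m%n≡m b<p ⟩
    b            ∎
  where
  open ≡-Reasoning
  move : ∀ a b m → a - b ≡ m → a ≡ b + m
  move a b m e = by₁ (+ 1) e (solve (a ∷ b ∷ m ∷ []))

-- Residues from 2 on: 0 and 1 lie on the orbit of ∞ under the maps used below and are left out.
val : ∀ {n} → Fin n → ℤ
val x = + (2 ℕ.+ toℕ x)

residue-0-1-else : ∀ p .{{_ : ℕ.NonZero p}} a → ¬ (+ p ∣ℤ a) → ¬ (+ p ∣ℤ a - + 1) →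
  ∃[ r ] 2 ℕ.+ r ℕ.< p × + p ∣ℤ + (2 ℕ.+ r) - a
residue-0-1-else p a a≢0 a≢1 = by-residue (a %ℕ p) refl
  where
  q = a /ℕ p
  move : ∀ a r q p → a ≡ r + q * p → a - r ≡ q * p
  move a r q p e = by₁ (+ 1) e (solve (a ∷ r ∷ q ∷ p ∷ []))
  move′ : ∀ a r q p → a ≡ r + q * p → r - a ≡ - q * p
  move′ a r q p e = by₁ (- + 1) e (solve (a ∷ r ∷ q ∷ p ∷ []))
  a≡ : ∀ {r} → a %ℕ p ≡ r → a ≡ + r + q * + p
  a≡ e = trans (a≡a%ℕn+[a/ℕn]*n a p) (cong (λ z → + z + q * + p) e)
  by-residue : ∀ r → a %ℕ p ≡ r → ∃[ r ] 2 ℕ.+ r ℕ.< p × + p ∣ℤ + (2 ℕ.+ r) - a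
  by-residue zero e = ⊥-elim (a≢0 (divides q (trans (a≡ e) (ℤₚ.+-identityˡ (q * + p)))))
  by-residue (suc zero) e = ⊥-elim (a≢1 (divides q (move a (+ 1) q (+ p) (a≡ e))))
  by-residue (suc (suc r)) e = r , subst (ℕ._< p) e (n%ℕd<d a p) , divides (- q) (move′ a (+ (2 ℕ.+ r)) q (+ p) (a≡ e))

1-val : ∀ {n p} → Prime p → (x : Fin n) → 2 ℕ.+ toℕ x ℕ.< p → ¬ (+ p ∣ℤ + 1 - val x)
1-val {p = p} pp x val<p (divides k e) = prime∤small (1 ℕ.+ toℕ x) pp (λ ()) (ℕₚ.<-trans (ℕₚ.n<1+n _) val<p)
  (divides (- k) (negate (+ (1 ℕ.+ toℕ x)) k (+ p) e))
  where
  negate : ∀ m k p → + 1 - (+ 1 + m) ≡ k * p → m ≡ - k * p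
  negate m k p e = by₁ (- + 1) e (solve (m ∷ k ∷ p ∷ []))

inverse-nonzero : ∀ p s t X j → p * s + (+ 1 - X) * t ≡ + 1 → t ≡ j * p → + 1 ≡ (s + (+ 1 - X) * j) * p
inverse-nonzero p s t X j bz e = by₂ (- + 1) bz (+ 1 - X) e (solve (p ∷ s ∷ t ∷ X ∷ j ∷ []))

-- The map x ↦ 1/(1 - x) of order 3 on the projective line modulo p. It permutes 0, 1, ∞ cyclically
-- and hence acts on the n = p - 2 residues 2, ..., p - 1. A fixed point satisfies x² - x + 1 ≡ 0,
-- so 2x - 1 is a square root of -3.
module CubicMap {n} (pp : Prime (2 ℕ.+ n)) where
  private
    p : ℕ
    p = 2 ℕ.+ n
    P : ℤ
    P = + p

  val<p : ∀ (x : Fin n) → 2 ℕ.+ toℕ x ℕ.< p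
  val<p x = s≤s (s≤s (Finₚ.toℕ<n x))

  abstract
    image : ∀ (x : Fin n) → ∃[ y ] ∃[ k ] val {n} y * (+ 1 - val x) ≡ + 1 + k * P
    image x = from (bezout-prime (+ 1 - val x) pp (1-val pp x (val<p x)))
      where
      X : ℤ
      X = val x
      from : (∃[ s ] ∃[ t ] P * s + (+ 1 - X) * t ≡ + 1) → ∃[ y ] ∃[ k ] val {n} y * (+ 1 - X) ≡ + 1 + k * P
      from (s , t , bz) = pack (residue-0-1-else p t t≢0 t≢1)
        where
        l₁ : ∀ p s t X j → p * s + (+ 1 - X) * t ≡ + 1 → t - + 1 ≡ j * p → X ≡ (s + (+ 1 - X) * j) * p
        l₁ p s t X j bz e = by₂ (- + 1) bz (+ 1 - X) e (solve (p ∷ s ∷ t ∷ X ∷ j ∷ []))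
        l₂ : ∀ p s t X Y j → p * s + (+ 1 - X) * t ≡ + 1 → Y - t ≡ j * p → Y * (+ 1 - X) ≡ + 1 + (j * (+ 1 - X) - s) * p
        l₂ p s t X Y j bz e = by₂ (+ 1) bz (+ 1 - X) e (solve (p ∷ s ∷ t ∷ X ∷ Y ∷ j ∷ []))
        t≢0 : ¬ (P ∣ℤ t)
        t≢0 (divides j e) = prime∤small 1 pp (λ ()) (prime>1 pp)
            (divides (s + (+ 1 - X) * j) (inverse-nonzero P s t X j bz e))
        t≢1 : ¬ (P ∣ℤ t - + 1)
        t≢1 (divides j e) = prime∤small (2 ℕ.+ toℕ x) pp (λ ()) (val<p x)
            (divides (s + (+ 1 - X) * j) (l₁ P s t X j bz e))
        pack : (∃[ r ] 2 ℕ.+ r ℕ.< p × P ∣ℤ + (2 ℕ.+ r) - t) → ∃[ y ] ∃[ k ] val {n} y * (+ 1 - X) ≡ + 1 + k * P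
        pack (r , s≤s (s≤s r<n) , divides j e) = fromℕ< r<n , j * (+ 1 - X) - s ,
          l₂ P s t X (val (fromℕ< r<n)) j bz (subst (λ z → + (2 ℕ.+ z) - t ≡ j * P) (sym (Finₚ.toℕ-fromℕ< r<n)) e)

  φ : Fin n → Fin n
  φ x = proj₁ (image x)

  k : Fin n → ℤ
  k x = proj₁ (proj₂ (image x))

  φ-spec : ∀ x → val (φ x) * (+ 1 - val x) ≡ + 1 + k x * P
  φ-spec x = proj₂ (proj₂ (image x))

  cube : ∀ x → φ (φ (φ x)) ≡ x
  cube x = Finₚ.toℕ-injective (ℕₚ.+-cancelˡ-≡ 2 (toℕ w) (toℕ x)
      (small-congruent⇒≡ p (2 ℕ.+ toℕ w) (2 ℕ.+ toℕ x) (val<p w) (val<p x)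
    (divides (- (val w * val z * k x) - val w * k y * (+ 1 - val x) + val x * k z)
      (l P (val x) (val y) (val z) (val w) (k x) (k y) (k z) (φ-spec x) (φ-spec y) (φ-spec z)))))
    where
    y z w : Fin n
    y = φ x
    z = φ y
    w = φ z
    l : ∀ p a Y Z W k₁ k₂ k₃ → Y * (+ 1 - a) ≡ + 1 + k₁ * p → Z * (+ 1 - Y) ≡ + 1 + k₂ * p →
        W * (+ 1 - Z) ≡ + 1 + k₃ * p →
      W - a ≡ (- (W * Z * k₁) - W * k₂ * (+ 1 - a) + a * k₃) * p
    l p a Y Z W k₁ k₂ k₃ e f g = by₃ (- (W * Z)) e (- (W * (+ 1 - a))) f a g
        (solve (p ∷ a ∷ Y ∷ Z ∷ W ∷ k₁ ∷ k₂ ∷ k₃ ∷ []))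

  fixed-point-root : ∀ x → φ x ≡ x → ∃[ r ] ∃[ c ] P * c ≡ r * r + + 3
  fixed-point-root x e = + 2 * val x - + 1 , - + 4 * k x ,
    l P (val x) (k x) (subst (λ y → val y * (+ 1 - val x) ≡ + 1 + k x * P) e (φ-spec x))
    where
    l : ∀ p X k → X * (+ 1 - X) ≡ + 1 + k * p → p * (- + 4 * k) ≡ (+ 2 * X - + 1) * (+ 2 * X - + 1) + + 3
    l p X k e = by₁ (+ 4) e (solve (p ∷ X ∷ k ∷ []))

-- Without a fixed point, n = p - 2 would be a multiple of 3, whereas it is 2 mod 3.
√-3 : ∀ {p} → Prime p → p ℕ.% 3 ≡ 1 → ∃[ r ] ∃[ c ] + p * c ≡ r * r + + 3
√-3 {zero} pp e = ⊥-elim (+prime≢0 pp refl)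
√-3 {suc zero} pp e = ⊥-elim (ℕₚ.<-irrefl refl (prime>1 pp))
√-3 {suc (suc n)} pp e = decide (Finₚ.any? (λ x → φ x Fin.≟ x))
  where
  open CubicMap pp
  contra : ∃[ k ] n ≡ 3 ℕ.* k → ⊥
  contra (k , n≡) = absurd (trans (sym e)
      (trans (cong (λ z → (2 ℕ.+ z) ℕ.% 3) (trans n≡ (ℕₚ.*-comm 3 k))) (ℕ.[m+kn]%n≡m%n 2 k 3)))
    where
    absurd : 1 ≢ 2
    absurd ()
  decide : _ → ∃[ r ] ∃[ c ] + (2 ℕ.+ n) * c ≡ r * r + + 3
  decide (yes (x , fixed)) = fixed-point-root x fixed
  decide (no none) = ⊥-elim (contra (order3 φ cube (λ x fixed → none (x , fixed))))

-- The map x ↦ (1 + x)/(1 - x) of order 4, whose square is x ↦ -1/x. It permutes 0, 1, ∞, -1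
-- cyclically and hence acts on the n = p - 3 residues 2, ..., p - 2. A fixed point of its square is
-- a square root of -1.
module QuarticMap {n} (pp : Prime (3 ℕ.+ n)) where
  private
    p : ℕ
    p = 3 ℕ.+ n
    P : ℤ
    P = + p

  val+1<p : ∀ (x : Fin n) → 3 ℕ.+ toℕ x ℕ.< p
  val+1<p x = s≤s (s≤s (s≤s (Finₚ.toℕ<n x)))

  val<p : ∀ (x : Fin n) → 2 ℕ.+ toℕ x ℕ.< p
  val<p x = ℕₚ.<-trans (ℕₚ.n<1+n _) (val+1<p x)

  p∤1 : ¬ (P ∣ℤ + 1)
  p∤1 = prime∤small 1 pp (λ ()) (s≤s (s≤s z≤n))

  p∤2 : ¬ (P ∣ℤ + 2)
  p∤2 = prime∤small 2 pp (λ ()) (s≤s (s≤s (s≤s z≤n)))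

  abstract
    image : ∀ (x : Fin n) → ∃[ y ] ∃[ k ] val {n} y * (+ 1 - val x) ≡ + 1 + val x + k * P
    image x = from (bezout-prime (+ 1 - val x) pp (1-val pp x (val<p x)))
      where
      X : ℤ
      X = val x
      from : (∃[ s ] ∃[ t ] P * s + (+ 1 - X) * t ≡ + 1) → ∃[ y ] ∃[ k ] val {n} y * (+ 1 - X) ≡ + 1 + X + k * P
      from (s , t , bz) = pack (residue-0-1-else p a a≢0 a≢1)
        where
        a : ℤ
        a = t * (+ 1 + X)
        l₁ : ∀ p s t X j → p * s + (+ 1 - X) * t ≡ + 1 → t * (+ 1 + X) - + 1 ≡ j * p →
          + 2 * X ≡ ((+ 1 - X) * j + (+ 1 + X) * s) * p
        l₁ p s t X j bz e = by₂ (- (+ 1 + X)) bz (+ 1 - X) e (solve (p ∷ s ∷ t ∷ X ∷ j ∷ []))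
        l₋₁ : ∀ p s t X j → p * s + (+ 1 - X) * t ≡ + 1 → t * (+ 1 + X) + + 1 ≡ j * p →
          + 2 ≡ ((+ 1 - X) * j + (+ 1 + X) * s) * p
        l₋₁ p s t X j bz e = by₂ (- (+ 1 + X)) bz (+ 1 - X) e (solve (p ∷ s ∷ t ∷ X ∷ j ∷ []))
        l₂ : ∀ p s t X Y j → p * s + (+ 1 - X) * t ≡ + 1 → Y - t * (+ 1 + X) ≡ j * p →
          Y * (+ 1 - X) ≡ + 1 + X + (j * (+ 1 - X) - (+ 1 + X) * s) * p
        l₂ p s t X Y j bz e = by₂ (+ 1 + X) bz (+ 1 - X) e (solve (p ∷ s ∷ t ∷ X ∷ Y ∷ j ∷ []))
        a≢0 : ¬ (P ∣ℤ a)
        a≢0 d with euclid t (+ 1 + X) pp d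
        ... | inj₁ (divides j e) = p∤1 (divides (s + (+ 1 - X) * j) (inverse-nonzero P s t X j bz e))
        ... | inj₂ d′ = prime∤small (3 ℕ.+ toℕ x) pp (λ ()) (val+1<p x) d′
        a≢1 : ¬ (P ∣ℤ a - + 1)
        a≢1 (divides j e) with euclid (+ 2) X pp (divides ((+ 1 - X) * j + (+ 1 + X) * s) (l₁ P s t X j bz e))
        ... | inj₁ d = p∤2 d
        ... | inj₂ d = prime∤small (2 ℕ.+ toℕ x) pp (λ ()) (val<p x) d
        a≢-1 : ¬ (P ∣ℤ a + + 1)
        a≢-1 (divides j e) = p∤2 (divides ((+ 1 - X) * j + (+ 1 + X) * s) (l₋₁ P s t X j bz e))
        last : ∀ N p a j → p ≡ + 1 + N → N - a ≡ j * p → a + + 1 ≡ (+ 1 - j) * p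
        last N p a j e f = by₂ (- + 1) e (- + 1) f (solve (N ∷ p ∷ a ∷ j ∷ []))
        pack : (∃[ r ] 2 ℕ.+ r ℕ.< p × P ∣ℤ + (2 ℕ.+ r) - a) → ∃[ y ] ∃[ k ] val {n} y * (+ 1 - X) ≡ + 1 + X + k * P
        pack (r , s≤s (s≤s r<1+n) , divides j e) = y , j * (+ 1 - X) - (+ 1 + X) * s ,
            l₂ P s t X (val y) j bz (subst (λ z → + (2 ℕ.+ z) - a ≡ j * P) (sym (Finₚ.toℕ-fromℕ< r<n)) e)
          where
          r≢n : r ≢ n
          r≢n refl = a≢-1 (divides (+ 1 - j) (last (+ (2 ℕ.+ n)) P a j refl e))
          r<n : r ℕ.< n
          r<n = ℕₚ.≤∧≢⇒< (ℕ.s≤s⁻¹ r<1+n) r≢n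
          y : Fin n
          y = fromℕ< r<n

  φ : Fin n → Fin n
  φ x = proj₁ (image x)

  k : Fin n → ℤ
  k x = proj₁ (proj₂ (image x))

  φ-spec : ∀ x → val (φ x) * (+ 1 - val x) ≡ + 1 + val x + k x * P
  φ-spec x = proj₂ (proj₂ (image x))

  φφ : ∀ x → P ∣ℤ val x * val (φ (φ x)) + + 1
  φφ x = half (euclid (+ 2) (val x * val (φ (φ x)) + + 1) pp
      (divides (- k x - k (φ x) * (+ 1 - val x) - val (φ (φ x)) * k x)
      (l P (val x) (val (φ x)) (val (φ (φ x))) (k x) (k (φ x)) (φ-spec x) (φ-spec (φ x)))))
    where
    l : ∀ p X Y Z k₁ k₂ → Y * (+ 1 - X) ≡ + 1 + X + k₁ * p → Z * (+ 1 - Y) ≡ + 1 + Y + k₂ * p →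
      + 2 * (X * Z + + 1) ≡ (- k₁ - k₂ * (+ 1 - X) - Z * k₁) * p
    l p X Y Z k₁ k₂ e f = by₂ (- (Z + + 1)) e (- (+ 1 - X)) f (solve (p ∷ X ∷ Y ∷ Z ∷ k₁ ∷ k₂ ∷ []))
    half : P ∣ℤ + 2 ⊎ P ∣ℤ (val x * val (φ (φ x)) + + 1) → P ∣ℤ val x * val (φ (φ x)) + + 1
    half (inj₁ d) = ⊥-elim (p∤2 d)
    half (inj₂ d) = d

  fourth : ∀ x → φ (φ (φ (φ x))) ≡ x
  fourth x = Finₚ.toℕ-injective (ℕₚ.+-cancelˡ-≡ 2 (toℕ (φ (φ (φ (φ x))))) (toℕ x)
    (small-congruent⇒≡ p (2 ℕ.+ toℕ (φ (φ (φ (φ x))))) (2 ℕ.+ toℕ x) (val<p (φ (φ (φ (φ x))))) (val<p x)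
        (combine (φφ x) (φφ (φ (φ x))))))
    where
    l : ∀ p X Z V j k → X * Z + + 1 ≡ j * p → Z * V + + 1 ≡ k * p → V - X ≡ (V * j - X * k) * p
    l p X Z V j k e f = by₂ V e (- X) f (solve (p ∷ X ∷ Z ∷ V ∷ j ∷ k ∷ []))
    combine : P ∣ℤ val x * val (φ (φ x)) + + 1 → P ∣ℤ val (φ (φ x)) * val (φ (φ (φ (φ x)))) + + 1 →
      P ∣ℤ val (φ (φ (φ (φ x)))) - val x
    combine (divides j e) (divides k f) = divides (val (φ (φ (φ (φ x)))) * j - val x * k)
      (l P (val x) (val (φ (φ x))) (val (φ (φ (φ (φ x))))) j k e f)

  fixed-point-root : ∀ x → φ (φ x) ≡ x → ∃[ r ] ∃[ c ] P * c ≡ r * r + + 1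
  fixed-point-root x e = from (subst (λ y → P ∣ℤ val x * val y + + 1) e (φφ x))
    where
    from : P ∣ℤ val x * val x + + 1 → ∃[ r ] ∃[ c ] P * c ≡ r * r + + 1
    from (divides c f) = val x , c , trans (ℤₚ.*-comm P c) (sym f)

-- If the square of the map had no fixed point, n = p - 3 would be a multiple of 4, whereas it is 2
-- mod 4.
√-1 : ∀ {p} → Prime p → p ℕ.% 4 ≡ 1 → ∃[ r ] ∃[ c ] + p * c ≡ r * r + + 1
√-1 {zero} pp e = ⊥-elim (+prime≢0 pp refl)
√-1 {suc zero} pp e = ⊥-elim (ℕₚ.<-irrefl refl (prime>1 pp))
√-1 {suc (suc zero)} pp ()
√-1 {suc (suc (suc n))} pp e = decide (Finₚ.any? (λ x → φ (φ x) Fin.≟ x))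
  where
  open QuarticMap pp
  contra : ∃[ k ] n ≡ 4 ℕ.* k → ⊥
  contra (k , n≡) = absurd (trans (sym e)
      (trans (cong (λ z → (3 ℕ.+ z) ℕ.% 4) (trans n≡ (ℕₚ.*-comm 4 k))) (ℕ.[m+kn]%n≡m%n 3 k 4)))
    where
    absurd : 1 ≢ 3
    absurd ()
  decide : _ → ∃[ r ] ∃[ c ] + (3 ℕ.+ n) * c ≡ r * r + + 1
  decide (yes (x , fixed)) = fixed-point-root x fixed
  decide (no none) = ⊥-elim (contra (order4 φ fourth (λ x fixed → none (x , fixed))))

unit12-odd : ∀ a → Unit12 a → a %ℕ 2 ≡ 1
unit12-odd a (inj₁ e) = subst (λ z → z %ℕ 2 ≡ 1) (sym (quotient-form 12 a 1 e))
    (byResidues 2 (con 12 :* x₀ :+ con 1 ≈ 1) (vec₁ (a /ℕ 12)))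
unit12-odd a (inj₂ (inj₁ e)) = subst (λ z → z %ℕ 2 ≡ 1) (sym (quotient-form 12 a 5 e))
    (byResidues 2 (con 12 :* x₀ :+ con 5 ≈ 1) (vec₁ (a /ℕ 12)))
unit12-odd a (inj₂ (inj₂ (inj₁ e))) = subst (λ z → z %ℕ 2 ≡ 1) (sym (quotient-form 12 a 7 e))
    (byResidues 2 (con 12 :* x₀ :+ con 7 ≈ 1) (vec₁ (a /ℕ 12)))
unit12-odd a (inj₂ (inj₂ (inj₂ e))) = subst (λ z → z %ℕ 2 ≡ 1) (sym (quotient-form 12 a 11 e))
    (byResidues 2 (con 12 :* x₀ :+ con 11 ≈ 1) (vec₁ (a /ℕ 12)))

even-half : ∀ a → a %ℕ 2 ≡ 0 → ∃[ h ] a ≡ + 2 * h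
even-half a e = a /ℕ 2 , trans (quotient-form 2 a 0 e) (ℤₚ.+-identityʳ (+ 2 * (a /ℕ 2)))

prime-divisor : ∀ n → n ≢ + 0 → ∣ n ∣ ≢ 1 → ∃[ q ] Prime q × + q ∣ℤ n
prime-divisor n n≢0 n≢±1 with prime-factor ∣ n ∣ (λ e → n≢0 (ℤₚ.∣i∣≡0⇒i≡0 e)) n≢±1
... | q , p , d = q , p , ∣ᵤ⇒∣ d

-- Prime factors 7 mod 12 of norms

N₃ : ℤ → ℤ → ℤ
N₃ u v = u * u + + 3 * v * v

scale : ∀ u v u′ v′ q → u ≡ u′ * q → v ≡ v′ * q → N₃ u v ≡ N₃ u′ v′ * q * q
scale u v u′ v′ q e f = by₂ (u + u′ * q) e (+ 3 * (v + v′ * q)) f (identity u v u′ v′ q)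
  where
  identity : ∀ u v u′ v′ q →
    u * u + + 3 * v * v + ((u + u′ * q) * (u′ * q) + + 3 * (v + v′ * q) * (v′ * q))
    ≡ (u′ * u′ + + 3 * v′ * v′) * q * q + ((u + u′ * q) * u + + 3 * (v + v′ * q) * v)
  identity = solve-∀

multiply : ∀ u v u′ v′ x y q → q ≡ N₃ x y → u ≡ x * u′ - + 3 * y * v′ → v ≡ x * v′ + y * u′ → N₃ u v ≡ N₃ u′ v′ * q
multiply u v u′ v′ x y q q≡ u≡ v≡ =
    trans (cong₂ N₃ u≡ v≡) (trans (identity u′ v′ x y) (cong (λ z → N₃ u′ v′ * z) (sym q≡)))
  where
  identity : ∀ u′ v′ x y →
    (x * u′ - + 3 * y * v′) * (x * u′ - + 3 * y * v′) + + 3 * (x * v′ + y * u′) * (x * v′ + y * u′)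
    ≡ (u′ * u′ + + 3 * v′ * v′) * (x * x + + 3 * y * y)
  identity = solve-∀

n₃ : ∀ {n} → Poly n → Poly n → Poly n
n₃ u v = u :* u :+ con 3 :* v :* v

≡7-nonunit : ∀ n → n %ℕ 12 ≡ 7 → ∣ n ∣ ≢ 1
≡7-nonunit (+ 1) () refl
≡7-nonunit -[1+ 0 ] () refl

Seven : ℤ → Set
Seven n = ∃[ p ] Prime7 p × + p ∣ℤ n

seven-multiple : ∀ {n} n′ m → n ≡ n′ * m → Seven n′ → Seven n
seven-multiple {n} n′ m e (p , p7 , divides k f) = p , p7 , divides (k * m) (l n n′ m k (+ p) e f)
  where
  l : ∀ n n′ m k p → n ≡ n′ * m → n′ ≡ k * p → n ≡ k * m * p
  l n n′ m k p e f = by₂ (+ 1) e m f (solve (n ∷ n′ ∷ m ∷ k ∷ p ∷ []))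

-- Descent on the norm. A prime dividing both coordinates is removed with its square, which is 1 mod
-- 12. Any other prime factor is itself a norm, hence 1 or 7 mod 12, and is split off if it is 1.
-- The residue 7 persists, so the norm cannot run down to 1.
norm7-has-prime7 : ∀ u v → N₃ u v %ℕ 12 ≡ 7 → Seven (N₃ u v)
norm7-has-prime7 u v = go u v (<-wellFounded ∣ N₃ u v ∣)
  where
  go : ∀ u v → Acc ℕ._<_ ∣ N₃ u v ∣ → N₃ u v %ℕ 12 ≡ 7 → Seven (N₃ u v)
  go u v (acc rs) ≡7 = from (prime-divisor (N₃ u v) (unit12-nonzero (N₃ u v) (inj₂ (inj₂ (inj₁ ≡7))))
      (≡7-nonunit (N₃ u v) ≡7))
    where
    from : (∃[ q ] Prime q × + q ∣ℤ N₃ u v) → Seven (N₃ u v)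
    from (q , p , d) = by-split (split-prime u v p (unit12-odd (+ q) unit) d) unit
      where
      unit : Unit12 (+ q)
      unit = unit12-divisor (N₃ u v) p (inj₂ (inj₂ (inj₁ ≡7))) d
      common : + q ∣ℤ u → + q ∣ℤ v → Seven (N₃ u v)
      common (divides u′ u≡) (divides v′ v≡) = seven-multiple (N₃ u′ v′) (+ q * + q)
          (trans n≡ (ℤₚ.*-assoc (N₃ u′ v′) (+ q) (+ q)))
          (go u′ v′ (rs (subst (λ z → ∣ N₃ u′ v′ ∣ ℕ.< ∣ z ∣) (sym n≡)
            (abs-grows² (N₃ u′ v′) (unit12-nonzero (N₃ u′ v′) (inj₂ (inj₂ (inj₁ ≡7′)))) p))) ≡7′)
        where
        n≡ : N₃ u v ≡ N₃ u′ v′ * + q * + q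
        n≡ = scale u v u′ v′ (+ q) u≡ v≡
        ≡7′ : N₃ u′ v′ %ℕ 12 ≡ 7
        ≡7′ = byResidues 12 (n₃ x₀ x₁ :* x₂ :* x₂ ≈ 7 ⇒ unit12 x₂ ⇒ n₃ x₀ x₁ ≈ 7) (vec₃ u′ v′ (+ q))
          (subst (λ z → z %ℕ 12 ≡ 7) n≡ ≡7) unit
      by-split : (+ q ∣ℤ u × + q ∣ℤ v) ⊎ Splits q u v → Unit12 (+ q) → Seven (N₃ u v)
      by-split (inj₁ (q∣u , q∣v)) _ = common q∣u q∣v
      by-split (inj₂ S) (inj₁ ≡1) = seven-multiple (N₃ u′ v′) (+ q) n≡
          (go u′ v′ (rs (subst (λ z → ∣ N₃ u′ v′ ∣ ℕ.< ∣ z ∣) (sym n≡)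
            (abs-grows (N₃ u′ v′) (unit12-nonzero (N₃ u′ v′) (inj₂ (inj₂ (inj₁ ≡7′)))) p))) ≡7′)
        where
        open Splits S
        n≡ : N₃ u v ≡ N₃ u′ v′ * + q
        n≡ = multiply u v u′ v′ x y (+ q) q≡ u≡ v≡
        ≡7′ : N₃ u′ v′ %ℕ 12 ≡ 7
        ≡7′ = byResidues 12 (n₃ x₀ x₁ :* x₂ ≈ 7 ⇒ x₂ ≈ 1 ⇒ n₃ x₀ x₁ ≈ 7) (vec₃ u′ v′ (+ q))
            (subst (λ z → z %ℕ 12 ≡ 7) n≡ ≡7) ≡1
      by-split (inj₂ S) (inj₂ (inj₁ ≡5)) = ⊥-elim (byResidues 12 (n₃ x₀ x₁ ≈ 5 ⇒ never) (vec₂ (Splits.x S) (Splits.y S))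
        (subst (λ z → z %ℕ 12 ≡ 5) (Splits.q≡ S) ≡5))
      by-split (inj₂ S) (inj₂ (inj₂ (inj₁ ≡7q))) = q , (p , ≡7q) , d
      by-split (inj₂ S) (inj₂ (inj₂ (inj₂ ≡11))) =
          ⊥-elim (byResidues 12 (n₃ x₀ x₁ ≈ 11 ⇒ never) (vec₂ (Splits.x S) (Splits.y S))
        (subst (λ z → z %ℕ 12 ≡ 11) (Splits.q≡ S) ≡11))

-- Recognising the primes of P1

P1-intro : ∀ {p} → Prime p → p ℕ.% 12 ≡ 1 → ∀ A B → + p ≡ A * A + B * B →
  A %ℕ 6 ≡ 2 ⊎ A %ℕ 6 ≡ 4 → B %ℕ 6 ≡ 3 → P1 p
P1-intro {p} pp p≡1 A B e (inj₁ A≡2) B≡3 = pp , p≡1 , A /ℕ 6 , B /ℕ 6 ,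
  trans e (trans (cong₂ (λ x y → x * x + y * y) (quotient-form 6 A 2 A≡2) (quotient-form 6 B 3 B≡3))
      (l (A /ℕ 6) (B /ℕ 6)))
  where
  l : ∀ k t → (+ 6 * k + + 2) * (+ 6 * k + + 2) + (+ 6 * t + + 3) * (+ 6 * t + + 3)
    ≡ (+ 6 * k + + 2) * ((+ 6 * k + + 2) * + 1) + (+ 6 * t + + 3) * ((+ 6 * t + + 3) * + 1)
  l = solve-∀
P1-intro {p} pp p≡1 A B e (inj₂ A≡4) B≡3 = P1-intro pp p≡1 (- A) B (trans e (l A B))
    (inj₁ (byResidues 6 (x₀ ≈ 4 ⇒ :- x₀ ≈ 2) (vec₁ A) A≡4)) B≡3
  where
  l : ∀ A B → A * A + B * B ≡ - A * - A + B * B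
  l = solve-∀

±1-not-±5 : ∀ w → ±1Mod12 w → ±5Mod12 w → ⊥
±1-not-±5 w a b = byResidues 12 (±1mod12 x₀ ⇒ ±5mod12 x₀ ⇒ never) (vec₁ w) a b

%12⇒%4 : ∀ n → n ℕ.% 12 ≡ 1 → n ℕ.% 4 ≡ 1
%12⇒%4 n e = subst (λ z → z %ℕ 4 ≡ 1) (sym (quotient-form 12 (+ n) 1 e))
    (byResidues 4 (con 12 :* x₀ :+ con 1 ≈ 1) (vec₁ (+ n /ℕ 12)))

%12⇒%3 : ∀ n r → n ℕ.% 12 ≡ r → r ℕ.% 3 ≡ 1 → n ℕ.% 3 ≡ 1
%12⇒%3 n r e r≡1 = trans (cong (_%ℕ 3) (quotient-form 12 (+ n) r e))
    (trans (%ℕ-cong 3 (+ 12 * k + + r) (+ r) (+ 4 * k) (l k (+ r))) r≡1)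
  where
  k = + n /ℕ 12
  l : ∀ k r → + 12 * k + r ≡ r + + 4 * k * + 3
  l = solve-∀

-- Modulo 6 there are two shapes of p = A² + B²: up to order, B ≡ 0, or A ≡ ±2 and B ≡ 3. The first
-- is of the kind in `link-odd` and would put u + 6e into the class ±1; the second is the defining
-- shape of `P1`.
P1-from-class : ∀ {p} → Prime p → p ℕ.% 12 ≡ 1 → ∀ u e → + p ≡ u * u + + 12 * e * e → ±5Mod12 (u + + 6 * e) → P1 p
P1-from-class {zero} pp p≡1 = ⊥-elim (+prime≢0 pp refl)
P1-from-class {p@(suc p-1)} pp p≡1 u e p≡ class = from-root (√-1 pp (%12⇒%4 p p≡1))
  where
  contra : ∀ A B → + p ≡ A * A + B * B → B %ℕ 6 ≡ 0 → P1 p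
  contra A B f B≡0 = ⊥-elim (±1-not-±5 (u + + 6 * e) (link-odd pp p≡1 A (B /ℕ 6) u e
    (trans f (trans (cong (λ z → A * A + z * z) (quotient-form 6 B 0 B≡0)) (l A (B /ℕ 6)))) p≡) class)
    where
    l : ∀ A b → A * A + (+ 6 * b + + 0) * (+ 6 * b + + 0) ≡ A * A + + 36 * b * b
    l = solve-∀
  from-squares : (∃[ A ] ∃[ B ] + p ≡ A * A + B * B) → P1 p
  from-squares (A , B , f) = by-residue (byResidues 6
      (x₀ :* x₀ :+ x₁ :* x₁ ≈ 1 ⇒ (x₀ ≈ 2 ∥ x₀ ≈ 4) & x₁ ≈ 3 ∥ (x₁ ≈ 2 ∥ x₁ ≈ 4) & x₀ ≈ 3 ∥ x₁ ≈ 0 ∥ x₀ ≈ 0)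
      (vec₂ A B) (trans (cong (_%ℕ 6) (trans (sym f) (quotient-form 12 (+ p) 1 p≡1)))
        (byResidues 6 (con 12 :* x₀ :+ con 1 ≈ 1) (vec₁ (+ p /ℕ 12)))))
    where
    f′ : + p ≡ B * B + A * A
    f′ = trans f (ℤₚ.+-comm (A * A) (B * B))
    by-residue : _ → P1 p
    by-residue (inj₁ (a , b)) = P1-intro pp p≡1 A B f a b
    by-residue (inj₂ (inj₁ (b , a))) = P1-intro pp p≡1 B A f′ b a
    by-residue (inj₂ (inj₂ (inj₁ b))) = contra A B f b
    by-residue (inj₂ (inj₂ (inj₂ a))) = contra B A f′ a
  from-root : (∃[ r ] ∃[ c ] + p * c ≡ r * r + + 1) → P1 p
  from-root (r , c , g) = from-squares (two-squares p-1 r c g)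

-- The divisors k of norms in the nontrivial class

N₁₂ : ℤ → ℤ → ℤ
N₁₂ u e = u * u + + 12 * e * e

N₁₂≡N₃ : ∀ u e → N₁₂ u e ≡ N₃ u (+ 2 * e)
N₁₂≡N₃ = identity
  where
  identity : ∀ u e → u * u + + 12 * e * e ≡ u * u + + 3 * (+ 2 * e) * (+ 2 * e)
  identity = solve-∀

HasKVal : ℤ → Set
HasKVal n = ∃[ k ] KVal k × k ∣ℤ n

kval-multiple : ∀ {n} n′ m → n ≡ n′ * m → HasKVal n′ → HasKVal n
kval-multiple {n} n′ m e (k , kv , divides j f) = k , kv , divides (j * m) (l n n′ m j k e f)
  where
  l : ∀ n n′ m j k → n ≡ n′ * m → n′ ≡ j * k → n ≡ j * m * k
  l n n′ m j k e f = by₂ (+ 1) e m f (solve (n ∷ n′ ∷ m ∷ j ∷ k ∷ []))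

N₁₂≡1 : ∀ u e → ±5Mod12 (u + + 6 * e) → N₁₂ u e %ℕ 12 ≡ 1
N₁₂≡1 u e = byResidues 12 (±5mod12 (x₀ :+ con 6 :* x₁) ⇒ x₀ :* x₀ :+ con 12 :* x₁ :* x₁ ≈ 1) (vec₂ u e)

sum≡1 : ∀ m l → m ℕ.+ 12 ℕ.* l ≡ 1 → l ≡ 0
sum≡1 m zero e = refl
sum≡1 m (suc l) e = ⊥-elim (ℕₚ.<⇒≱ (ℕₚ.<-≤-trans (s≤s (s≤s z≤n)) 12≤) (ℕₚ.≤-reflexive e))
  where
  12≤ : 12 ℕ.≤ m ℕ.+ 12 ℕ.* suc l
  12≤ = ℕₚ.≤-trans (ℕₚ.*-monoʳ-≤ 12 (s≤s z≤n)) (ℕₚ.m≤n+m (12 ℕ.* suc l) m)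

class-nonunit : ∀ u e → ±5Mod12 (u + + 6 * e) → ∣ N₁₂ u e ∣ ≢ 1
class-nonunit u e class abs≡1 = from (square-nonneg u) (square-nonneg e)
  where
  unit-square : ∀ u → u * u ≡ + 1 → ±5Mod12 u → ⊥
  unit-square u sq = by-abs u (ℕₚ.m*n≡1⇒m≡1 ∣ u ∣ ∣ u ∣ (trans (sym (ℤₚ.abs-* u u)) (cong ∣_∣ sq)))
    where
    by-abs : ∀ u → ∣ u ∣ ≡ 1 → ±5Mod12 u → ⊥
    by-abs (+ 1) refl (inj₁ ())
    by-abs (+ 1) refl (inj₂ ())
    by-abs -[1+ 0 ] refl (inj₁ ())
    by-abs -[1+ 0 ] refl (inj₂ ())
  from : (∃[ m ] u * u ≡ + m) → (∃[ l ] e * e ≡ + l) → ⊥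
  from (m , f) (l , g) = unit-square u u²≡1
      (subst ±5Mod12 (trans (cong (λ z → u + + 6 * z) e≡0) (ℤₚ.+-identityʳ u)) class)
    where
    n≡ : N₁₂ u e ≡ + (m ℕ.+ 12 ℕ.* l)
    n≡ = trans (cong₂ _+_ f (trans (ℤₚ.*-assoc (+ 12) e e) (trans (cong (λ z → + 12 * z) g) (sym (ℤₚ.pos-* 12 l)))))
      (sym (ℤₚ.pos-+ m (12 ℕ.* l)))
    l≡0 : l ≡ 0
    l≡0 = sum≡1 m l (trans (sym (cong ∣_∣ n≡)) abs≡1)
    e≡0 : e ≡ + 0
    e≡0 = [ (λ z → z) , (λ z → z) ]′ (ℤₚ.i*j≡0⇒i≡0∨j≡0 e (trans g (cong +_ l≡0)))
    u²≡1 : u * u ≡ + 1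
    u²≡1 = trans (trans f (cong +_ (trans (sym (ℕₚ.+-identityʳ m)) (cong (λ z → m ℕ.+ 12 ℕ.* z) (sym l≡0)))))
      (cong +_ (trans (sym (cong ∣_∣ n≡)) abs≡1))

-- Modulo 12 the quantity u + 6e is multiplicative.
class-product : ∀ u e x f u′ e′ → u ≡ x * u′ - + 12 * f * e′ → e ≡ x * e′ + f * u′ →
  u + + 6 * e ≡ (x + + 6 * f) * (u′ + + 6 * e′) - + 48 * (f * e′)
class-product u e x f u′ e′ a b = by₂ (+ 1) a (+ 6) b (solve (u ∷ e ∷ x ∷ f ∷ u′ ∷ e′ ∷ []))

record EvenSplit (q : ℕ) (u e : ℤ) : Set where
  field
    x f u′ e′ : ℤ
    q≡ : + q ≡ N₁₂ x f
    u≡ : u ≡ x * u′ - + 12 * f * e′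
    e≡ : e ≡ x * e′ + f * u′

-- For q ≡ 1 mod 12 the factor x + y√-3 has x odd and y even, and then 2e = x v′ + y u′ forces v′ to
-- be even. So the factorisation stays inside ℤ[2√-3], where the class is defined.
even-split : ∀ {q} u e → + q %ℕ 12 ≡ 1 → Splits q u (+ 2 * e) → EvenSplit q u e
even-split {q} u e q≡1 S = from-y
    (scaled-multiple 6 2 y (byResidues 12 (n₃ x₀ x₁ ≈ 1 ⇒ con 6 :* x₁ ≈ 0) (vec₂ x y) q≡1′))
  where
  open Splits S
  q≡1′ : N₃ x y %ℕ 12 ≡ 1
  q≡1′ = subst (λ z → z %ℕ 12 ≡ 1) q≡ q≡1
  q-odd : N₃ x y %ℕ 2 ≡ 1
  q-odd = unit12-odd (N₃ x y) (inj₁ q≡1′)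
  from-y : (∃[ f ] y ≡ + 2 * f) → EvenSplit q u e
  from-y (f , y≡) = from-v (even-half v′ v′-even)
    where
    x-odd : x %ℕ 2 ≡ 1
    x-odd = byResidues 2 (n₃ x₀ (con 2 :* x₁) ≈ 1 ⇒ x₀ ≈ 1) (vec₂ x f) (subst (λ z → N₃ x z %ℕ 2 ≡ 1) y≡ q-odd)
    xv′ : ∀ e x v′ y u′ f → + 2 * e ≡ x * v′ + y * u′ → y ≡ + 2 * f → x * v′ ≡ + 2 * (e - f * u′)
    xv′ e x v′ y u′ f a b = by₂ (- + 1) a (- u′) b (solve (e ∷ x ∷ v′ ∷ y ∷ u′ ∷ f ∷ []))
    v′-even : v′ %ℕ 2 ≡ 0
    v′-even = byResidues 2 (x₀ :* x₁ ≈ 0 ⇒ x₀ ≈ 1 ⇒ x₁ ≈ 0) (vec₂ x v′)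
      (trans (cong (_%ℕ 2) (xv′ e x v′ y u′ f v≡ y≡)) (byResidues 2 (con 2 :* x₀ ≈ 0) (vec₁ (e - f * u′)))) x-odd
    from-v : (∃[ e′ ] v′ ≡ + 2 * e′) → EvenSplit q u e
    from-v (e′ , v′≡) = record { x = x ; f = f ; u′ = u′ ; e′ = e′
      ; q≡ = trans q≡ (trans (cong (N₃ x) y≡) (sym (N₁₂≡N₃ x f)))
      ; u≡ = lu u x u′ y v′ f e′ u≡ y≡ v′≡
      ; e≡ = ℤₚ.*-cancelˡ-≡ (+ 2) e (x * e′ + f * u′) (le e x u′ y v′ f e′ v≡ y≡ v′≡) }
      where
      lu : ∀ u x u′ y v′ f e′ → u ≡ x * u′ - + 3 * y * v′ → y ≡ + 2 * f → v′ ≡ + 2 * e′ → u ≡ x * u′ - + 12 * f * e′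
      lu u x u′ y v′ f e′ a b c = by₃ (+ 1) a (- (+ 3 * v′)) b (- (+ 6 * f)) c
          (solve (u ∷ x ∷ u′ ∷ y ∷ v′ ∷ f ∷ e′ ∷ []))
      le : ∀ e x u′ y v′ f e′ → + 2 * e ≡ x * v′ + y * u′ → y ≡ + 2 * f → v′ ≡ + 2 * e′ →
          + 2 * e ≡ + 2 * (x * e′ + f * u′)
      le e x u′ y v′ f e′ a b c = by₃ (+ 1) a u′ b x c (solve (e ∷ x ∷ u′ ∷ y ∷ v′ ∷ f ∷ e′ ∷ []))

-- Descent on the norm within the class ±5, which does not contain norm 1. A prime q dividing both
-- coordinates is divided out if it is ±1 mod 12, and otherwise q² is the divisor sought. If q
-- splits and is 7 mod 12, the cofactor is 7 mod 12 too and supplies the second prime. If q splits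
-- and is 1 mod 12, it either has class ±5 and lies in `P1`, or has class ±1 and is divided out.
class-has-kval : ∀ u e → ±5Mod12 (u + + 6 * e) → HasKVal (N₁₂ u e)
class-has-kval u e = go u e (<-wellFounded ∣ N₁₂ u e ∣)
  where
  go : ∀ u e → Acc ℕ._<_ ∣ N₁₂ u e ∣ → ±5Mod12 (u + + 6 * e) → HasKVal (N₁₂ u e)
  go u e (acc rs) class = from (prime-divisor n (unit12-nonzero n (inj₁ n≡1)) (class-nonunit u e class))
    where
    n : ℤ
    n = N₁₂ u e
    n≡1 : n %ℕ 12 ≡ 1
    n≡1 = N₁₂≡1 u e class
    from : (∃[ q ] Prime q × + q ∣ℤ n) → HasKVal n
    from (q , p , d) = by-split (split-prime u (+ 2 * e) p (unit12-odd (+ q) unit) (subst (+ q ∣ℤ_) (N₁₂≡N₃ u e) d))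
        unit
      where
      unit : Unit12 (+ q)
      unit = unit12-divisor n p (inj₁ n≡1) d
      smaller : ∀ u′ e′ m → n ≡ N₁₂ u′ e′ * m → ∣ N₁₂ u′ e′ ∣ ℕ.< ∣ N₁₂ u′ e′ * m ∣ → ±5Mod12 (u′ + + 6 * e′) →
          HasKVal n
      smaller u′ e′ m n≡ lt class′ = kval-multiple (N₁₂ u′ e′) m n≡
        (go u′ e′ (rs (subst (λ z → ∣ N₁₂ u′ e′ ∣ ℕ.< ∣ z ∣) (sym n≡) lt)) class′)
      module Common (u′ e′ : ℤ) (u≡ : u ≡ u′ * + q) (e≡ : e ≡ e′ * + q) where
        n′ : ℤ
        n′ = N₁₂ u′ e′
        2e≡ : ∀ e e′ q → e ≡ e′ * q → + 2 * e ≡ + 2 * e′ * q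
        2e≡ e e′ q f = by₁ (+ 2) f (solve (e ∷ e′ ∷ q ∷ []))
        n≡ : n ≡ n′ * + q * + q
        n≡ = trans (N₁₂≡N₃ u e) (trans (scale u (+ 2 * e) u′ (+ 2 * e′) (+ q) u≡ (2e≡ e e′ (+ q) e≡))
          (cong (λ z → z * + q * + q) (sym (N₁₂≡N₃ u′ e′))))
        descend : ±1Mod12 (+ q) → HasKVal n
        descend q≡ = smaller u′ e′ (+ q * + q) (trans n≡ (ℤₚ.*-assoc n′ (+ q) (+ q)))
            (subst (λ z → ∣ n′ ∣ ℕ.< ∣ z ∣) (ℤₚ.*-assoc n′ (+ q) (+ q))
              (abs-grows² n′ (unit12-nonzero n′ (inj₁ (N₁₂≡1 u′ e′ class′))) p)) class′
          where
          class′ : ±5Mod12 (u′ + + 6 * e′)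
          class′ = byResidues 12 (±5mod12 (x₀ :* x₂ :+ con 6 :* (x₁ :* x₂)) ⇒ ±1mod12 x₂ ⇒ ±5mod12 (x₀ :+ con 6 :* x₁))
            (vec₃ u′ e′ (+ q)) (subst ±5Mod12 (cong₂ (λ a b → a + + 6 * b) u≡ e≡) class) q≡
        by-residue : Unit12 (+ q) → HasKVal n
        by-residue (inj₁ ≡1) = descend (inj₁ ≡1)
        by-residue (inj₂ (inj₁ ≡5)) = (+ q) ^ 2 , k-sq5 q (p , ≡5) , divides n′ (trans n≡ (l n′ (+ q)))
          where
          l : ∀ n q → n * q * q ≡ n * (q * (q * + 1))
          l = solve-∀
        by-residue (inj₂ (inj₂ (inj₁ ≡7))) = + q * + q , k-77 q q (p , ≡7) (p , ≡7) , divides n′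
            (trans n≡ (ℤₚ.*-assoc n′ (+ q) (+ q)))
        by-residue (inj₂ (inj₂ (inj₂ ≡11))) = descend (inj₂ ≡11)
      common : + q ∣ℤ u → + q ∣ℤ e → HasKVal n
      common (divides u′ u≡) (divides e′ e≡) = Common.by-residue u′ e′ u≡ e≡ unit
      by-split : (+ q ∣ℤ u × + q ∣ℤ + 2 * e) ⊎ Splits q u (+ 2 * e) → Unit12 (+ q) → HasKVal n
      by-split (inj₁ (q∣u , q∣2e)) _ = common q∣u (odd-prime-half n e p (inj₁ n≡1) d q∣2e)
      by-split (inj₂ S) (inj₂ (inj₁ ≡5)) = ⊥-elim (byResidues 12 (n₃ x₀ x₁ ≈ 5 ⇒ never) (vec₂ (Splits.x S) (Splits.y S))
        (subst (λ z → z %ℕ 12 ≡ 5) (Splits.q≡ S) ≡5))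
      by-split (inj₂ S) (inj₂ (inj₂ (inj₂ ≡11))) =
          ⊥-elim (byResidues 12 (n₃ x₀ x₁ ≈ 11 ⇒ never) (vec₂ (Splits.x S) (Splits.y S))
        (subst (λ z → z %ℕ 12 ≡ 11) (Splits.q≡ S) ≡11))
      by-split (inj₂ S) (inj₂ (inj₂ (inj₁ ≡7))) = second (norm7-has-prime7 u′ v′ ≡7′)
        where
        open Splits S
        n≡ : n ≡ N₃ u′ v′ * + q
        n≡ = trans (N₁₂≡N₃ u e) (multiply u (+ 2 * e) u′ v′ x y (+ q) q≡ u≡ v≡)
        ≡7′ : N₃ u′ v′ %ℕ 12 ≡ 7
        ≡7′ = byResidues 12 (n₃ x₀ x₁ :* x₂ ≈ 1 ⇒ x₂ ≈ 7 ⇒ n₃ x₀ x₁ ≈ 7) (vec₃ u′ v′ (+ q))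
            (subst (λ z → z %ℕ 12 ≡ 1) n≡ n≡1) ≡7
        second : Seven (N₃ u′ v′) → HasKVal n
        second (r , r7 , divides j f) = + r * + q , k-77 r q r7 (p , ≡7) , divides j
            (trans n≡ (trans (cong (_* + q) f) (ℤₚ.*-assoc j (+ r) (+ q))))
      by-split (inj₂ S) (inj₁ ≡1) = by-class
          (byResidues 12 (x₀ :* x₀ :+ con 12 :* x₁ :* x₁ ≈ 1 ⇒ ±5mod12 w ∥ ±1mod12 w) (vec₂ x f)
          (subst (λ z → z %ℕ 12 ≡ 1) q≡ ≡1))
        where
        open EvenSplit (even-split u e ≡1 S)
        w : Poly 2
        w = x₀ :+ con 6 :* x₁
        four : ∀ x y → + 12 * x * y ≡ + 3 * (+ 2 * x) * (+ 2 * y)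
        four = solve-∀
        n≡ : n ≡ N₁₂ u′ e′ * + q
        n≡ = trans (N₁₂≡N₃ u e) (trans (multiply u (+ 2 * e) u′ (+ 2 * e′) x (+ 2 * f) (+ q)
            (trans q≡ (N₁₂≡N₃ x f)) (trans u≡ (cong (λ z → x * u′ - z) (four f e′))) (dbl e x e′ f u′ e≡))
                (cong (_* + q) (sym (N₁₂≡N₃ u′ e′))))
          where
          dbl : ∀ e x e′ f u′ → e ≡ x * e′ + f * u′ → + 2 * e ≡ x * (+ 2 * e′) + + 2 * f * u′
          dbl e x e′ f u′ a = by₁ (+ 2) a (solve (e ∷ x ∷ e′ ∷ f ∷ u′ ∷ []))
        by-class : ±5Mod12 (x + + 6 * f) ⊎ ±1Mod12 (x + + 6 * f) → HasKVal n
        by-class (inj₁ ±5) = + q , k-P1 q (P1-from-class p ≡1 x f q≡ ±5) , divides (N₁₂ u′ e′) n≡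
        by-class (inj₂ ±1) = smaller u′ e′ (+ q) n≡
            (abs-grows (N₁₂ u′ e′) (unit12-nonzero (N₁₂ u′ e′) (inj₁ (N₁₂≡1 u′ e′ class′))) p) class′
          where
          class′ : ±5Mod12 (u′ + + 6 * e′)
          class′ = byResidues 12 (±5mod12 (x₀ :* x₁ :- con 48 :* x₂) ⇒ ±1mod12 x₀ ⇒ ±5mod12 x₁)
            (vec₃ (x + + 6 * f) (u′ + + 6 * e′) (f * e′)) (subst ±5Mod12 (class-product u e x f u′ e′ u≡ e≡) class) ±1

-- Elements of the nontrivial class with norm k

norm-in-class-5 : ∀ k u e → k ≡ N₁₂ u e → ±5Mod12 (u + + 6 * e) → ∃[ u ] ∃[ e ] k ≡ N₁₂ u e × (u + + 6 * e) %ℕ 12 ≡ 5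
norm-in-class-5 k u e k≡ (inj₁ ≡5) = u , e , k≡ , ≡5
norm-in-class-5 k u e k≡ (inj₂ ≡7) = - u , - e , trans k≡ (identity u e) ,
  byResidues 12 (x₀ :+ con 6 :* x₁ ≈ 7 ⇒ :- x₀ :+ con 6 :* :- x₁ ≈ 5) (vec₂ u e) ≡7
  where
  identity : ∀ u e → u * u + + 12 * e * e ≡ - u * - u + + 12 * - e * - e
  identity = solve-∀

prime-norm : ∀ {p} → Prime p → p ℕ.% 3 ≡ 1 → + p %ℕ 2 ≡ 1 → ∃[ u ] ∃[ v ] + p ≡ N₃ u v
prime-norm {zero} pp _ _ = ⊥-elim (+prime≢0 pp refl)
prime-norm {suc p-1} pp ≡1 odd = from (√-3 pp ≡1)
  where
  from : (∃[ r ] ∃[ c ] + suc p-1 * c ≡ r * r + + 3) → ∃[ u ] ∃[ v ] + suc p-1 ≡ N₃ u v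
  from (r , c , g) = square+3square p-1 r c g odd

prime7-norm : ∀ p → Prime7 p → ∃[ a ] ∃[ v ] + p ≡ + 4 * a * a + + 3 * v * v
prime7-norm p (pp , ≡7) = from (prime-norm pp (%12⇒%3 p 7 ≡7 refl) (unit12-odd (+ p) (inj₂ (inj₂ (inj₁ ≡7)))))
  where
  from : (∃[ u ] ∃[ v ] + p ≡ N₃ u v) → ∃[ a ] ∃[ v ] + p ≡ + 4 * a * a + + 3 * v * v
  from (u , v , p≡) = half (scaled-multiple 6 2 u
      (byResidues 12 (n₃ x₀ x₁ ≈ 7 ⇒ con 6 :* x₀ ≈ 0) (vec₂ u v) (subst (λ z → z %ℕ 12 ≡ 7) p≡ ≡7)))
    where
    half : (∃[ a ] u ≡ + 2 * a) → ∃[ a ] ∃[ v ] + p ≡ + 4 * a * a + + 3 * v * v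
    half (a , u≡) = a , v , trans p≡ (trans (cong (λ z → N₃ z v) u≡) (l a v))
      where
      l : ∀ a v → + 2 * a * (+ 2 * a) + + 3 * v * v ≡ + 4 * a * a + + 3 * v * v
      l = solve-∀

-- For p² the element is p itself, and for p in `P1` the class is found by `link-even`. For two
-- primes 7 mod 12, 2a + v√-3 and 2b + w√-3 are multiplied directly or after conjugating the first:
-- the two values of u + 6e differ by 6vw ≡ 6 mod 12, so one of them is ±5.
kval-norm : ∀ {k} → KVal k → ∃[ u ] ∃[ e ] k ≡ N₁₂ u e × (u + + 6 * e) %ℕ 12 ≡ 5
kval-norm (k-sq5 p (pp , ≡5)) = + p , + 0 , l (+ p) , byResidues 12 (x₀ ≈ 5 ⇒ x₀ :+ con 6 :* con 0 ≈ 5) (vec₁ (+ p)) ≡5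
  where
  l : ∀ p → p * (p * + 1) ≡ p * p + + 12 * + 0 * + 0
  l = solve-∀
kval-norm (k-P1 p (pp , ≡1 , k , t , p≡)) = from (prime-norm pp (%12⇒%3 p 1 ≡1 refl) (unit12-odd (+ p) (inj₁ ≡1)))
  where
  p≡′ : + p ≡ + 4 * (+ 3 * k + + 1) * (+ 3 * k + + 1) + + 9 * (+ 2 * t + + 1) * (+ 2 * t + + 1)
  p≡′ = trans p≡ (l k t)
    where
    l : ∀ k t → (+ 6 * k + + 2) * ((+ 6 * k + + 2) * + 1) + (+ 6 * t + + 3) * ((+ 6 * t + + 3) * + 1)
      ≡ + 4 * (+ 3 * k + + 1) * (+ 3 * k + + 1) + + 9 * (+ 2 * t + + 1) * (+ 2 * t + + 1)
    l = solve-∀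
  from : (∃[ u ] ∃[ v ] + p ≡ N₃ u v) → ∃[ u ] ∃[ e ] + p ≡ N₁₂ u e × (u + + 6 * e) %ℕ 12 ≡ 5
  from (u , v , q) = half (scaled-multiple 6 2 v
      (byResidues 12 (n₃ x₀ x₁ ≈ 1 ⇒ con 6 :* x₁ ≈ 0) (vec₂ u v) (subst (λ z → z %ℕ 12 ≡ 1) q ≡1)))
    where
    half : (∃[ e ] v ≡ + 2 * e) → ∃[ u ] ∃[ e ] + p ≡ N₁₂ u e × (u + + 6 * e) %ℕ 12 ≡ 5
    half (e , v≡) = norm-in-class-5 (+ p) u e p≡″ (link-even pp ≡1 (+ 3 * k + + 1) (+ 2 * t + + 1) u e p≡′ p≡″)
      where
      p≡″ : + p ≡ N₁₂ u e
      p≡″ = trans q (trans (cong (N₃ u) v≡) (sym (N₁₂≡N₃ u e)))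
kval-norm (k-77 p₁ p₂ s₁ s₂) = from (prime7-norm p₁ s₁) (prime7-norm p₂ s₂)
  where
  from : (∃[ a ] ∃[ v ] + p₁ ≡ + 4 * a * a + + 3 * v * v) → (∃[ a ] ∃[ v ] + p₂ ≡ + 4 * a * a + + 3 * v * v) →
    ∃[ u ] ∃[ e ] + p₁ * + p₂ ≡ N₁₂ u e × (u + + 6 * e) %ℕ 12 ≡ 5
  from (a , v , e₁) (b , w , e₂) = by-class (byResidues 12
      (con 4 :* x₀ :* x₀ :+ con 3 :* x₁ :* x₁ ≈ 7 ⇒ con 4 :* x₂ :* x₂ :+ con 3 :* x₃ :* x₃ ≈ 7 ⇒
        ±5mod12 (con 4 :* x₀ :* x₂ :- con 3 :* x₁ :* x₃ :+ con 6 :* (x₀ :* x₃ :+ x₂ :* x₁)) ∥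
        ±5mod12 (con 4 :* x₀ :* x₂ :+ con 3 :* x₁ :* x₃ :+ con 6 :* (x₀ :* x₃ :- x₂ :* x₁)))
      (vec₄ a v b w) (subst (λ z → z %ℕ 12 ≡ 7) e₁ (proj₂ s₁)) (subst (λ z → z %ℕ 12 ≡ 7) e₂ (proj₂ s₂)))
    where
    l₁ : ∀ a v b w → (+ 4 * a * a + + 3 * v * v) * (+ 4 * b * b + + 3 * w * w) ≡
      (+ 4 * a * b - + 3 * v * w) * (+ 4 * a * b - + 3 * v * w) + + 12 * (a * w + b * v) * (a * w + b * v)
    l₁ = solve-∀
    l₂ : ∀ a v b w → (+ 4 * a * a + + 3 * v * v) * (+ 4 * b * b + + 3 * w * w) ≡
      (+ 4 * a * b + + 3 * v * w) * (+ 4 * a * b + + 3 * v * w) + + 12 * (a * w - b * v) * (a * w - b * v)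
    l₂ = solve-∀
    by-class : ±5Mod12 (+ 4 * a * b - + 3 * v * w + + 6 * (a * w + b * v)) ⊎ ±5Mod12
        (+ 4 * a * b + + 3 * v * w + + 6 * (a * w - b * v)) →
      ∃[ u ] ∃[ e ] + p₁ * + p₂ ≡ N₁₂ u e × (u + + 6 * e) %ℕ 12 ≡ 5
    by-class (inj₁ c) = norm-in-class-5 (+ p₁ * + p₂) (+ 4 * a * b - + 3 * v * w) (a * w + b * v)
        (trans (cong₂ _*_ e₁ e₂) (l₁ a v b w)) c
    by-class (inj₂ c) = norm-in-class-5 (+ p₁ * + p₂) (+ 4 * a * b + + 3 * v * w) (a * w - b * v)
        (trans (cong₂ _*_ e₁ e₂) (l₂ a v b w)) c

-- The determinant for ℤ₂ × ℤ₂ over ℤ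

-- 3d ≡ 3 mod 12 stands for d ≡ 1 mod 4, and 6y ≡ 6 for y odd, so that these conditions combine with
-- residues mod 3 in one modulus.
data IntegerPart (d : ℤ) : Set where
  odd   : (+ 3 * d) %ℕ 12 ≡ 3 → IntegerPart d
  two⁴  : ∀ y → d ≡ + 16 * y → (+ 6 * y) %ℕ 12 ≡ 6 → IntegerPart d
  two⁶  : ∀ y → d ≡ + 64 * y → IntegerPart d

-- All four factors have the same parity. If a + b + c + d = 2t, halving them leaves t, t - b - d, t
-- - c - d, t - b - c, whose sum is even: either all four are odd, or at least two are even and the
-- product is a multiple of 4.
integerPart : ∀ a b c d →
  IntegerPart ((a + b + c + d) * (a - b + c - d) * ((a + b - c - d) * (a - b - c + d)))
integerPart a b c d = by-parity (byResidues 4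
    (con 2 :* s ≈ 0 ∥ s :* (x₀ :- x₁ :+ x₂ :- x₃) :* ((x₀ :+ x₁ :- x₂ :- x₃) :* (x₀ :- x₁ :- x₂ :+ x₃)) ≈ 1)
    (vec₄ a b c d))
  where
  s : Poly 4
  s = x₀ :+ x₁ :+ x₂ :+ x₃
  D = (a + b + c + d) * (a - b + c - d) * ((a + b - c - d) * (a - b - c + d))
  by-parity : _ → IntegerPart D
  by-parity (inj₂ ≡1) = odd (subst (λ z → (+ 3 * z) %ℕ 12 ≡ 3) (sym (quotient-form 4 D 1 ≡1))
    (byResidues 12 (con 3 :* (con 4 :* x₀ :+ con 1) ≈ 3) (vec₁ (D /ℕ 4))))
  by-parity (inj₁ ≡0) = halved (scaled-multiple 2 2 (a + b + c + d) ≡0)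
    where
    halved : (∃[ t ] a + b + c + d ≡ + 2 * t) → IntegerPart D
    halved (t , s≡) = by-residue (byResidues 4 (y′ ≈ 0 ∥ con 2 :* y′ ≈ 2) (vec₄ t b c d))
      where
      y = t * (t - b - d) * ((t - c - d) * (t - b - c))
      y′ : Poly 4
      y′ = x₀ :* (x₀ :- x₁ :- x₃) :* ((x₀ :- x₂ :- x₃) :* (x₀ :- x₁ :- x₂))
      solve-a : ∀ a b c d t → a + b + c + d ≡ + 2 * t → a ≡ + 2 * t - b - c - d
      solve-a a b c d t e = by₁ (+ 1) e (solve (a ∷ b ∷ c ∷ d ∷ t ∷ []))
      expand : ∀ b c d t → let a = + 2 * t - b - c - d in
        (a + b + c + d) * (a - b + c - d) * ((a + b - c - d) * (a - b - c + d))
        ≡ + 16 * (t * (t - b - d) * ((t - c - d) * (t - b - c)))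
      expand b c d t = identity b c d t
        where
        identity : ∀ b c d t →
          (+ 2 * t - b - c - d + b + c + d) * (+ 2 * t - b - c - d - b + c - d) *
          ((+ 2 * t - b - c - d + b - c - d) * (+ 2 * t - b - c - d - b - c + d))
          ≡ + 16 * (t * (t - b - d) * ((t - c - d) * (t - b - c)))
        identity = solve-∀
      D≡ : D ≡ + 16 * y
      D≡ = trans (cong (λ a → (a + b + c + d) * (a - b + c - d) * ((a + b - c - d) * (a - b - c + d)))
          (solve-a a b c d t s≡)) (expand b c d t)
      by-residue : y %ℕ 4 ≡ 0 ⊎ (+ 2 * y) %ℕ 4 ≡ 2 → IntegerPart D
      by-residue (inj₁ y≡0) = two⁶ (y /ℕ 4)
          (trans D≡ (trans (cong (λ z → + 16 * z) (quotient-form 4 y 0 y≡0)) (l (y /ℕ 4))))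
        where
        l : ∀ k → + 16 * (+ 4 * k + + 0) ≡ + 64 * k
        l = solve-∀
      by-residue (inj₂ 2y≡2) = odd-quotient (scaled-residue 2 2 1 y 2y≡2)
        where
        odd-quotient : (∃[ k ] y ≡ + 2 * k + + 1) → IntegerPart D
        odd-quotient (k , y≡) = two⁴ y D≡ (subst (λ z → (+ 6 * z) %ℕ 12 ≡ 6) (sym y≡)
          (byResidues 12 (con 6 :* (con 2 :* x₀ :+ con 1) ≈ 6) (vec₁ k)))

-- Eisenstein integers P + Qω

mulP mulQ : ℤ → ℤ → ℤ → ℤ → ℤ
mulP P Q P′ Q′ = P * P′ - Q * Q′
mulQ P Q P′ Q′ = P * Q′ + Q * P′ - Q * Q′

norm-mul : ∀ P Q P′ Q′ → norm P Q * norm P′ Q′ ≡ norm (mulP P Q P′ Q′) (mulQ P Q P′ Q′)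
norm-mul = identity
  where
  identity : ∀ P Q P′ Q′ → (P * P - P * Q + Q * Q) * (P′ * P′ - P′ * Q′ + Q′ * Q′) ≡
    (P * P′ - Q * Q′) * (P * P′ - Q * Q′) - (P * P′ - Q * Q′) * (P * Q′ + Q * P′ - Q * Q′)
    + (P * Q′ + Q * P′ - Q * Q′) * (P * Q′ + Q * P′ - Q * Q′)
  identity = solve-∀

-- P + Qω ↦ P + Q is the reduction modulo √-3.
mul-sum : ∀ P Q P′ Q′ k l → (P + Q + + 3 * k) * (P′ + Q′ + + 3 * l) ≡
  mulP P Q P′ Q′ + mulQ P Q P′ Q′ + + 3 * (Q * Q′ + k * (P′ + Q′) + (P + Q) * l + + 3 * (k * l))
mul-sum = identity
  where
  identity : ∀ P Q P′ Q′ k l → (P + Q + + 3 * k) * (P′ + Q′ + + 3 * l) ≡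
    P * P′ - Q * Q′ + (P * Q′ + Q * P′ - Q * Q′) + + 3 * (Q * Q′ + k * (P′ + Q′) + (P + Q) * l + + 3 * (k * l))
  identity = solve-∀

-- `odd`: up to a unit or conjugation E = u + 2e√-3 with w = u + 6e, whose residue mod 3 is that of
-- E mod √-3. `even`: E = 16(P + Qω), and 16 ≡ 1 mod 3 leaves the residue P + Q.
data EisensteinPart (D₁ N : ℤ) : Set where
  odd  : ∀ w e k → N ≡ N₁₂ (w - + 6 * e) e → w %ℕ 4 ≡ 1 → D₁ ≡ w + + 3 * k → EisensteinPart D₁ N
  even : ∀ P Q k → N ≡ + 256 * norm P Q → D₁ ≡ P + Q + + 3 * k → EisensteinPart D₁ N

-- The three shapes are E ≡ 1, ω, ω² mod 4. Swapping the coordinates brings ω to 1, multiplication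
-- by ω brings ω² to 1; both keep the norm and the residue mod √-3.
eisenstein-odd : ∀ P Q k D₁ N → N ≡ norm P Q → D₁ ≡ P + Q + + 3 * k →
  (P %ℕ 4 ≡ 1 × Q %ℕ 4 ≡ 0) ⊎ (P %ℕ 4 ≡ 0 × Q %ℕ 4 ≡ 1) ⊎ (P %ℕ 4 ≡ 3 × Q %ℕ 4 ≡ 3) → EisensteinPart D₁ N
eisenstein-odd P Q k D₁ N N≡ D₁≡ (inj₁ (P≡1 , Q≡0)) =
  odd (P + Q) e k (trans N≡ (l P Q e (quotient-form 4 Q 0 Q≡0)))
    (byResidues 4 (x₀ ≈ 1 ⇒ x₁ ≈ 0 ⇒ x₀ :+ x₁ ≈ 1) (vec₂ P Q) P≡1 Q≡0) D₁≡
  where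
  e = Q /ℕ 4
  l : ∀ P Q e → Q ≡ + 4 * e + + 0 → norm P Q ≡ N₁₂ (P + Q - + 6 * e) e
  l P _ e refl = identity P e
    where
    identity : ∀ P e → P * P - P * (+ 4 * e + + 0) + (+ 4 * e + + 0) * (+ 4 * e + + 0) ≡
      (P + (+ 4 * e + + 0) - + 6 * e) * (P + (+ 4 * e + + 0) - + 6 * e) + + 12 * e * e
    identity = solve-∀
eisenstein-odd P Q k D₁ N N≡ D₁≡ (inj₂ (inj₁ (P≡0 , Q≡1))) =
  eisenstein-odd Q P k D₁ N (trans N≡ (l P Q)) (trans D₁≡ (cong (_+ + 3 * k) (ℤₚ.+-comm P Q))) (inj₁ (Q≡1 , P≡0))
  where
  l : ∀ P Q → P * P - P * Q + Q * Q ≡ Q * Q - Q * P + P * P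
  l = solve-∀
eisenstein-odd P Q k D₁ N N≡ D₁≡ (inj₂ (inj₂ (P≡3 , Q≡3))) =
  eisenstein-odd (- Q) (P - Q) (Q + k) D₁ N (trans N≡ (l P Q)) (trans D₁≡ (s P Q k))
    (inj₁ (byResidues 4 (x₁ ≈ 3 ⇒ :- x₁ ≈ 1) (vec₂ P Q) Q≡3 , byResidues 4 (x₀ ≈ 3 ⇒ x₁ ≈ 3 ⇒ x₀ :- x₁ ≈ 0) (vec₂ P Q)
        P≡3 Q≡3))
  where
  l : ∀ P Q → P * P - P * Q + Q * Q ≡ - Q * - Q - - Q * (P - Q) + (P - Q) * (P - Q)
  l = solve-∀
  s : ∀ P Q k → P + Q + + 3 * k ≡ - Q + (P - Q) + + 3 * (Q + k)
  s = solve-∀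

-- The four conjugates are E₁ = x₁+x₂+x₃+x₄, E₃ = x₁-x₂+x₃-x₄, E₂ = x₁+x₂-x₃-x₄, E₄ = x₁-x₂-x₃+x₄.
-- Modulo 4 both E₁E₃ = X² - Y² and E₂E₄ agree, so their product is a square of an odd number, a power of ω.
module FourConjugates (p₁ p₂ p₃ p₄ q₁ q₂ q₃ q₄ k₁ k₂ k₃ k₄ : ℤ) where

  P₁ P₂ P₃ P₄ Q₁ Q₂ Q₃ Q₄ : ℤ
  P₁ = p₁ + p₂ + p₃ + p₄
  P₂ = p₁ + p₂ - p₃ - p₄
  P₃ = p₁ - p₂ + p₃ - p₄
  P₄ = p₁ - p₂ - p₃ + p₄
  Q₁ = q₁ + q₂ + q₃ + q₄
  Q₂ = q₁ + q₂ - q₃ - q₄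
  Q₃ = q₁ - q₂ + q₃ - q₄
  Q₄ = q₁ - q₂ - q₃ + q₄

  D N : ℤ
  D = (P₁ + Q₁ + + 3 * k₁) * (P₃ + Q₃ + + 3 * k₃) * ((P₂ + Q₂ + + 3 * k₂) * (P₄ + Q₄ + + 3 * k₄))
  N = norm P₁ Q₁ * norm P₃ Q₃ * (norm P₂ Q₂ * norm P₄ Q₄)

  product-sum : ∀ T T′ V V′ k l {d} → d ≡ (T + T′ + + 3 * k) * (V + V′ + + 3 * l) →
    d ≡ mulP T T′ V V′ + mulQ T T′ V V′ + + 3 * (T′ * V′ + k * (V + V′) + (T + T′) * l + + 3 * (k * l))
  product-sum T T′ V V′ k l e = trans e (mul-sum T T′ V V′ k l)

  when-odd : (+ 2 * P₁) %ℕ 4 ≡ 2 ⊎ (+ 2 * Q₁) %ℕ 4 ≡ 2 → EisensteinPart D N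
  when-odd parity = eisenstein-odd (mulP T T′ V V′) (mulQ T T′ V V′)
      (T′ * V′ + k * (V + V′) + (T + T′) * l + + 3 * (k * l)) D N
      (trans (cong₂ _*_ (norm-mul P₁ Q₁ P₃ Q₃) (norm-mul P₂ Q₂ P₄ Q₄)) (norm-mul T T′ V V′))
      (product-sum T T′ V V′ k l (cong₂ _*_ (mul-sum P₁ Q₁ P₃ Q₃ k₁ k₃) (mul-sum P₂ Q₂ P₄ Q₄ k₂ k₄)))
      (subst₂ (λ v v′ → Shape (mulP T T′ v v′) (mulQ T T′ v v′)) (sym V≡) (sym V′≡)
        (byResidues 4 (con 2 :* x₀ ≈ 2 ∥ con 2 :* x₁ ≈ 2 ⇒ shape x₀ x₁ (x₀ :+ con 4 :* x₂) (x₁ :+ con 4 :* x₃))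
          (vec₄ T T′ S S′) T-odd))
    where
    T T′ V V′ S S′ k l : ℤ
    T = mulP P₁ Q₁ P₃ Q₃
    T′ = mulQ P₁ Q₁ P₃ Q₃
    V = mulP P₂ Q₂ P₄ Q₄
    V′ = mulQ P₂ Q₂ P₄ Q₄
    k = Q₁ * Q₃ + k₁ * (P₃ + Q₃) + (P₁ + Q₁) * k₃ + + 3 * (k₁ * k₃)
    l = Q₂ * Q₄ + k₂ * (P₄ + Q₄) + (P₂ + Q₂) * k₄ + + 3 * (k₂ * k₄)
    S = p₂ * p₄ - q₂ * q₄ - (p₁ * p₃ - q₁ * q₃)
    S′ = p₂ * q₄ + q₂ * p₄ - q₂ * q₄ - (p₁ * q₃ + q₁ * p₃ - q₁ * q₃)
    Shape : ℤ → ℤ → Set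
    Shape a b = (a %ℕ 4 ≡ 1 × b %ℕ 4 ≡ 0) ⊎ (a %ℕ 4 ≡ 0 × b %ℕ 4 ≡ 1) ⊎ (a %ℕ 4 ≡ 3 × b %ℕ 4 ≡ 3)
    shape : ∀ {n} → (a b c d : Poly n) → Formula n
    shape a b c d = (m ≈ 1 & m′ ≈ 0) ∥ (m ≈ 0 & m′ ≈ 1) ∥ (m ≈ 3 & m′ ≈ 3)
      where
      m m′ : Poly _
      m = a :* c :- b :* d
      m′ = a :* d :+ b :* c :- b :* d
    identity : ∀ p₁ p₂ p₃ p₄ q₁ q₂ q₃ q₄ →
      (p₁ + p₂ - p₃ - p₄) * (p₁ - p₂ - p₃ + p₄) - (q₁ + q₂ - q₃ - q₄) * (q₁ - q₂ - q₃ + q₄) ≡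
      (p₁ + p₂ + p₃ + p₄) * (p₁ - p₂ + p₃ - p₄) - (q₁ + q₂ + q₃ + q₄) * (q₁ - q₂ + q₃ - q₄)
      + + 4 * (p₂ * p₄ - q₂ * q₄ - (p₁ * p₃ - q₁ * q₃))
    identity = solve-∀
    V≡ : V ≡ T + + 4 * S
    V≡ = identity p₁ p₂ p₃ p₄ q₁ q₂ q₃ q₄
    identity′ : ∀ p₁ p₂ p₃ p₄ q₁ q₂ q₃ q₄ →
      (p₁ + p₂ - p₃ - p₄) * (q₁ - q₂ - q₃ + q₄) + (q₁ + q₂ - q₃ - q₄) * (p₁ - p₂ - p₃ + p₄)
          - (q₁ + q₂ - q₃ - q₄) * (q₁ - q₂ - q₃ + q₄) ≡
      (p₁ + p₂ + p₃ + p₄) * (q₁ - q₂ + q₃ - q₄) + (q₁ + q₂ + q₃ + q₄) * (p₁ - p₂ + p₃ - p₄)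
          - (q₁ + q₂ + q₃ + q₄) * (q₁ - q₂ + q₃ - q₄)
      + + 4 * (p₂ * q₄ + q₂ * p₄ - q₂ * q₄ - (p₁ * q₃ + q₁ * p₃ - q₁ * q₃))
    identity′ = solve-∀
    V′≡ : V′ ≡ T′ + + 4 * S′
    V′≡ = identity′ p₁ p₂ p₃ p₄ q₁ q₂ q₃ q₄
    conj : ∀ a b c d → a - b + c - d ≡ a + b + c + d - + 2 * (b + d)
    conj = solve-∀
    -- E₃ ≡ E₁ mod 2, so E₁E₃ ≡ E₁² is nonzero in the field ℤ[ω]/2.
    T-odd : (+ 2 * T) %ℕ 4 ≡ 2 ⊎ (+ 2 * T′) %ℕ 4 ≡ 2
    T-odd = subst₂ (λ a b → (+ 2 * mulP P₁ Q₁ a b) %ℕ 4 ≡ 2 ⊎ (+ 2 * mulQ P₁ Q₁ a b) %ℕ 4 ≡ 2)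
      (sym (conj p₁ p₂ p₃ p₄)) (sym (conj q₁ q₂ q₃ q₄))
      (byResidues 4 (con 2 :* x₀ ≈ 2 ∥ con 2 :* x₁ ≈ 2 ⇒
          con 2 :* (x₀ :* (x₀ :- con 2 :* x₂) :- x₁ :* (x₁ :- con 2 :* x₃)) ≈ 2 ∥
          con 2 :* (x₀ :* (x₁ :- con 2 :* x₃) :+ x₁ :* (x₀ :- con 2 :* x₂) :- x₁ :* (x₁ :- con 2 :* x₃)) ≈ 2)
        (vec₄ P₁ Q₁ (p₂ + p₄) (q₂ + q₄)) parity)

  -- The four conjugates agree mod 2, so 2 divides each of them and 16 divides E. The factor 4
  -- removed from each pair is 1 mod 3, hence the residue mod √-3 is kept; `carry` is the multiple
  -- of 3 that arises.
  when-even : (∃[ t ] P₁ ≡ + 2 * t) → (∃[ t ] Q₁ ≡ + 2 * t) → EisensteinPart D N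
  when-even (a₁ , P₁≡) (b₁ , Q₁≡) = even (mulP T T′ V V′) (mulQ T T′ V V′)
      (T′ * V′ + k * (V + V′) + (T + T′) * l + + 3 * (k * l)) N≡
      (product-sum T T′ V V′ k l (cong₂ _*_ (pair P₁≡ Q₁≡ P₃≡ Q₃≡) (pair P₂≡ Q₂≡ P₄≡ Q₄≡)))
    where
    a₂ a₃ a₄ b₂ b₃ b₄ T T′ V V′ k l : ℤ
    a₂ = a₁ - (p₃ + p₄)
    a₃ = a₁ - (p₂ + p₄)
    a₄ = a₁ - (p₂ + p₃)
    b₂ = b₁ - (q₃ + q₄)
    b₃ = b₁ - (q₂ + q₄)
    b₄ = b₁ - (q₂ + q₃)
    half₂ : ∀ x₁ x₂ x₃ x₄ t → x₁ + x₂ + x₃ + x₄ ≡ + 2 * t → x₁ + x₂ - x₃ - x₄ ≡ + 2 * (t - (x₃ + x₄))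
    half₂ x₁ x₂ x₃ x₄ t e = by₁ (+ 1) e (solve (x₁ ∷ x₂ ∷ x₃ ∷ x₄ ∷ t ∷ []))
    half₃ : ∀ x₁ x₂ x₃ x₄ t → x₁ + x₂ + x₃ + x₄ ≡ + 2 * t → x₁ - x₂ + x₃ - x₄ ≡ + 2 * (t - (x₂ + x₄))
    half₃ x₁ x₂ x₃ x₄ t e = by₁ (+ 1) e (solve (x₁ ∷ x₂ ∷ x₃ ∷ x₄ ∷ t ∷ []))
    half₄ : ∀ x₁ x₂ x₃ x₄ t → x₁ + x₂ + x₃ + x₄ ≡ + 2 * t → x₁ - x₂ - x₃ + x₄ ≡ + 2 * (t - (x₂ + x₃))
    half₄ x₁ x₂ x₃ x₄ t e = by₁ (+ 1) e (solve (x₁ ∷ x₂ ∷ x₃ ∷ x₄ ∷ t ∷ []))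
    P₂≡ = half₂ p₁ p₂ p₃ p₄ a₁ P₁≡
    P₃≡ = half₃ p₁ p₂ p₃ p₄ a₁ P₁≡
    P₄≡ = half₄ p₁ p₂ p₃ p₄ a₁ P₁≡
    Q₂≡ = half₂ q₁ q₂ q₃ q₄ b₁ Q₁≡
    Q₃≡ = half₃ q₁ q₂ q₃ q₄ b₁ Q₁≡
    Q₄≡ = half₄ q₁ q₂ q₃ q₄ b₁ Q₁≡
    T = mulP a₁ b₁ a₃ b₃
    T′ = mulQ a₁ b₁ a₃ b₃
    V = mulP a₂ b₂ a₄ b₄
    V′ = mulQ a₂ b₂ a₄ b₄
    carry : (a b a′ b′ c c′ : ℤ) → ℤ
    carry a b a′ b′ c c′ = (a + b) * (a′ + b′) + b * b′ + + 2 * c * (a′ + b′) + + 2 * c′ * (a + b) + + 3 * c * c′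
    k = carry a₁ b₁ a₃ b₃ k₁ k₃
    l = carry a₂ b₂ a₄ b₄ k₂ k₄
    identity : ∀ a b a′ b′ c c′ → (+ 2 * a + + 2 * b + + 3 * c) * (+ 2 * a′ + + 2 * b′ + + 3 * c′) ≡
      a * a′ - b * b′ + (a * b′ + b * a′ - b * b′) +
      + 3 * ((a + b) * (a′ + b′) + b * b′ + + 2 * c * (a′ + b′) + + 2 * c′ * (a + b) + + 3 * c * c′)
    identity = solve-∀
    pair : ∀ {P Q P′ Q′ a b a′ b′ c c′} → P ≡ + 2 * a → Q ≡ + 2 * b → P′ ≡ + 2 * a′ → Q′ ≡ + 2 * b′ →
      (P + Q + + 3 * c) * (P′ + Q′ + + 3 * c′) ≡ mulP a b a′ b′ + mulQ a b a′ b′ + + 3 * carry a b a′ b′ c c′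
    pair {a = a} {b} {a′} {b′} {c} {c′} refl refl refl refl = identity a b a′ b′ c c′
    double : ∀ a b → + 2 * a * (+ 2 * a) - + 2 * a * (+ 2 * b) + + 2 * b * (+ 2 * b) ≡ + 4 * (a * a - a * b + b * b)
    double = solve-∀
    quadruple : ∀ {P Q a b} → P ≡ + 2 * a → Q ≡ + 2 * b → norm P Q ≡ + 4 * norm a b
    quadruple {a = a} {b} refl refl = double a b
    collect : ∀ n₁ n₂ n₃ n₄ → + 4 * n₁ * (+ 4 * n₃) * (+ 4 * n₂ * (+ 4 * n₄)) ≡ + 256 * (n₁ * n₃ * (n₂ * n₄))
    collect = solve-∀
    N≡ : N ≡ + 256 * norm (mulP T T′ V V′) (mulQ T T′ V V′)
    N≡ = trans (cong₂ _*_ (cong₂ _*_ (quadruple P₁≡ Q₁≡) (quadruple P₃≡ Q₃≡))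
        (cong₂ _*_ (quadruple P₂≡ Q₂≡) (quadruple P₄≡ Q₄≡)))
      (trans (collect (norm a₁ b₁) (norm a₂ b₂) (norm a₃ b₃) (norm a₄ b₄))
        (cong (λ z → + 256 * z) (trans (cong₂ _*_ (norm-mul a₁ b₁ a₃ b₃) (norm-mul a₂ b₂ a₄ b₄)) (norm-mul T T′ V V′))))

  eisensteinPart : EisensteinPart D N
  eisensteinPart = by-parity (byResidues 4 (con 2 :* x₀ ≈ 0 & con 2 :* x₁ ≈ 0 ∥ con 2 :* x₀ ≈ 2 ∥ con 2 :* x₁ ≈ 2)
      (vec₂ P₁ Q₁))
    where
    by-parity : _ → EisensteinPart D N
    by-parity (inj₁ (P≡0 , Q≡0)) = when-even (scaled-multiple 2 2 P₁ P≡0) (scaled-multiple 2 2 Q₁ Q≡0)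
    by-parity (inj₂ parity) = when-odd parity

-- Realisation of the listed values

assemble : (a b c : Quad) → Fin 6 → Fin 2 → ℤ
assemble (quad a₁ a₂ a₃ a₄) (quad b₁ b₂ b₃ b₄) (quad c₁ c₂ c₃ c₄) = entry
  where
  entry : Fin 6 → Fin 2 → ℤ
  entry fzero fzero = a₁
  entry (fsuc fzero) fzero = b₂
  entry (fsuc (fsuc fzero)) fzero = c₁
  entry (fsuc (fsuc (fsuc fzero))) fzero = a₂
  entry (fsuc (fsuc (fsuc (fsuc fzero)))) fzero = b₁
  entry (fsuc (fsuc (fsuc (fsuc (fsuc fzero))))) fzero = c₂
  entry fzero (fsuc fzero) = a₃
  entry (fsuc fzero) (fsuc fzero) = b₄
  entry (fsuc (fsuc fzero)) (fsuc fzero) = c₃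
  entry (fsuc (fsuc (fsuc fzero))) (fsuc fzero) = a₄
  entry (fsuc (fsuc (fsuc (fsuc fzero)))) (fsuc fzero) = b₃
  entry (fsuc (fsuc (fsuc (fsuc (fsuc fzero))))) (fsuc fzero) = c₄

infixl 6 _⊕_
_⊕_ : Quad → Quad → Quad
quad a b c d ⊕ quad a′ b′ c′ d′ = quad (a + a′) (b + b′) (c + c′) (d + d′)

constant : ℤ → Quad
constant x = quad x x x x

zero₄ : Quad
zero₄ = constant (+ 0)

-- The factor of the group determinant at a character, in terms of the Eisenstein integer P + Qω and C = (n - P - Q)/3.
factor : ℤ → ℤ → ℤ → ℤ
factor P Q C = (P + Q + + 3 * C) * norm P Q

D₃-factor : ∀ {a b c} P Q C → a ≡ P + C → b ≡ Q + C → c ≡ C → D₃ a b c ≡ factor P Q C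
D₃-factor P Q C refl refl refl = cong₂ _*_ (n≡ P Q C) (cong₂ norm (cancel P C) (cancel Q C))
  where
  n≡ : ∀ P Q C → P + C + (Q + C) + C ≡ P + Q + + 3 * C
  n≡ = solve-∀
  cancel : ∀ P C → P + C - C ≡ P
  cancel = solve-∀

h₁-⊕ : ∀ x y → h₁ (x ⊕ y) ≡ h₁ x + h₁ y
h₁-⊕ (quad a b c d) (quad a′ b′ c′ d′) = identity a b c d a′ b′ c′ d′
  where
  identity : ∀ a b c d a′ b′ c′ d′ → (a + a′) + (b + b′) + (c + c′) + (d + d′) ≡ (a + b + c + d) + (a′ + b′ + c′ + d′)
  identity = solve-∀

h₂-⊕ : ∀ x y → h₂ (x ⊕ y) ≡ h₂ x + h₂ y
h₂-⊕ (quad a b c d) (quad a′ b′ c′ d′) = identity a b c d a′ b′ c′ d′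
  where
  identity : ∀ a b c d a′ b′ c′ d′ → (a + a′) + (b + b′) - (c + c′) - (d + d′) ≡ (a + b - c - d) + (a′ + b′ - c′ - d′)
  identity = solve-∀

h₃-⊕ : ∀ x y → h₃ (x ⊕ y) ≡ h₃ x + h₃ y
h₃-⊕ (quad a b c d) (quad a′ b′ c′ d′) = identity a b c d a′ b′ c′ d′
  where
  identity : ∀ a b c d a′ b′ c′ d′ → (a + a′) - (b + b′) + (c + c′) - (d + d′) ≡ (a - b + c - d) + (a′ - b′ + c′ - d′)
  identity = solve-∀

h₄-⊕ : ∀ x y → h₄ (x ⊕ y) ≡ h₄ x + h₄ y
h₄-⊕ (quad a b c d) (quad a′ b′ c′ d′) = identity a b c d a′ b′ c′ d′
  where
  identity : ∀ a b c d a′ b′ c′ d′ → (a + a′) - (b + b′) - (c + c′) + (d + d′) ≡ (a - b - c + d) + (a′ - b′ - c′ + d′)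
  identity = solve-∀

h₁-shift : ∀ x k → h₁ (constant x ⊕ k) ≡ + 4 * x + h₁ k
h₁-shift x k = trans (h₁-⊕ (constant x) k) (cong (_+ h₁ k) (four x))
  where
  four : ∀ x → x + x + x + x ≡ + 4 * x
  four = solve-∀

h₂-shift : ∀ x k → h₂ (constant x ⊕ k) ≡ h₂ k
h₂-shift x k = trans (h₂-⊕ (constant x) k) (trans (cong (_+ h₂ k) (zero-sum x)) (ℤₚ.+-identityˡ (h₂ k)))
  where
  zero-sum : ∀ x → x + x - x - x ≡ + 0
  zero-sum = solve-∀

h₃-shift : ∀ x k → h₃ (constant x ⊕ k) ≡ h₃ k
h₃-shift x k = trans (h₃-⊕ (constant x) k) (trans (cong (_+ h₃ k) (zero-sum x)) (ℤₚ.+-identityˡ (h₃ k)))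
  where
  zero-sum : ∀ x → x - x + x - x ≡ + 0
  zero-sum = solve-∀

h₄-shift : ∀ x k → h₄ (constant x ⊕ k) ≡ h₄ k
h₄-shift x k = trans (h₄-⊕ (constant x) k) (trans (cong (_+ h₄ k) (zero-sum x)) (ℤₚ.+-identityˡ (h₄ k)))
  where
  zero-sum : ∀ x → x - x - x + x ≡ + 0
  zero-sum = solve-∀

D₃-conjugate : ∀ (h : Quad → ℤ) (h-⊕ : ∀ x y → h (x ⊕ y) ≡ h x + h y) p q c → D₃ (h (p ⊕ c)) (h (q ⊕ c)) (h c) ≡
    factor (h p) (h q) (h c)
D₃-conjugate h h-⊕ p q c = D₃-factor (h p) (h q) (h c) (h-⊕ p c) (h-⊕ q c) refl

-- Adding a constant to a quadruple changes h₁ only: in the families below the factors at h₂, h₃, h₄ are fixed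
-- numbers and the parameters enter through the factor at h₁.
realise : ∀ x y z p q c {n} →
  factor (+ 4 * x + h₁ p) (+ 4 * y + h₁ q) (+ 4 * z + h₁ c) * factor (h₃ p) (h₃ q) (h₃ c) *
  (factor (h₂ p) (h₂ q) (h₂ c) * factor (h₄ p) (h₄ q) (h₄ c)) ≡ n → InS n
realise x y z p q c {n} e = assemble (P ⊕ C) (Q ⊕ C) C , trans (groupDet-factors (assemble (P ⊕ C) (Q ⊕ C) C)) (trans
    (cong₂ _*_
      (cong₂ _*_ (trans (D₃-conjugate h₁ h₁-⊕ P Q C) (cong-factor (h₁-shift x p) (h₁-shift y q) (h₁-shift z c)))
                 (trans (D₃-conjugate h₃ h₃-⊕ P Q C) (cong-factor (h₃-shift x p) (h₃-shift y q) (h₃-shift z c))))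
      (cong₂ _*_ (trans (D₃-conjugate h₂ h₂-⊕ P Q C) (cong-factor (h₂-shift x p) (h₂-shift y q) (h₂-shift z c)))
                 (trans (D₃-conjugate h₄ h₄-⊕ P Q C) (cong-factor (h₄-shift x p) (h₄-shift y q) (h₄-shift z c))))) e)
  where
  P Q C : Quad
  P = constant x ⊕ p
  Q = constant y ⊕ q
  C = constant z ⊕ c
  cong-factor : ∀ {P P′ Q Q′ C C′} → P ≡ P′ → Q ≡ Q′ → C ≡ C′ → factor P Q C ≡ factor P′ Q′ C′
  cong-factor refl refl refl = refl

form₇ : ℤ → ℤ → ℤ
form₇ a v = + 4 * a * a + + 3 * v * v

-- E is -3 at `h₁` and 1 elsewhere. The last quadruple governs the power of 2 in the families with
-- odd E: the integers at `h₂`, `h₃`, `h₄` are 1, 1, 1 for odd values, -2, -2, -2 for 2⁴, and 4, -2,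
-- -2 for 2⁶.
realise-a1 : ∀ m → InS (+ 27 * (+ 4 * m - + 1))
realise-a1 m = realise (+ 0) (+ 0) m
  (quad (+ 0) (- + 1) (- + 1) (- + 1)) zero₄ zero₄
  (identity m)
  where
  identity : ∀ m →
    ((- + 3) + + 0 + + 3 * (+ 4 * m + + 0)) *
    ((- + 3) * (- + 3) - (- + 3) * + 0 + + 0 * + 0) *
    + 1 * (+ 1 * + 1) ≡ + 27 * (+ 4 * m - + 1)
  identity = solve-∀

realise-a2 : ∀ m → InS (+ 16 * + 27 * (+ 2 * m - + 1))
realise-a2 m = realise (+ 0) (+ 0) (- m)
  (quad (+ 0) (- + 1) (- + 1) (- + 1)) zero₄ (quad (+ 0) (+ 1) (+ 1) (+ 1))
  (identity m)
  where
  identity : ∀ m →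
    ((- + 3) + + 0 + + 3 * (+ 4 * (- m) + + 3)) *
    ((- + 3) * (- + 3) - (- + 3) * + 0 + + 0 * + 0) *
    (- + 2) * ((- + 2) * (- + 2)) ≡ + 16 * + 27 * (+ 2 * m - + 1)
  identity = solve-∀

realise-a3 : ∀ m → InS (+ 64 * + 27 * m)
realise-a3 m = realise (+ 0) (+ 0) m
  (quad (+ 0) (- + 1) (- + 1) (- + 1)) zero₄ (quad (+ 0) (+ 1) (+ 0) (+ 0))
  (identity m)
  where
  identity : ∀ m →
    ((- + 3) + + 0 + + 3 * (+ 4 * m + + 1)) *
    ((- + 3) * (- + 3) - (- + 3) * + 0 + + 0 * + 0) *
    (- + 2) * (+ 4 * (- + 2)) ≡ + 64 * + 27 * m
  identity = solve-∀

-- E at `h₁` is √-3(2a + v√-3) = (2a - 3v) + 4aω; being 1 mod 4 forces v = 4r - 2a + 1. The third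
-- parameter is chosen such that the integer factor becomes 3(4m - 1), free of r and a.
realise-b1 : ∀ m r a → InS (+ 9 * (+ 4 * m - + 1) * form₇ a (+ 4 * r - + 2 * a + + 1))
realise-b1 m r a = realise (+ 2 * a - + 3 * r) a (- a + m + r)
  (quad (+ 0) (- + 1) (- + 1) (- + 1)) zero₄ zero₄
  (identity m r a)
  where
  identity : ∀ m r a →
    ((+ 4 * (+ 2 * a - + 3 * r) + - + 3) + (+ 4 * a + + 0) + + 3 * (+ 4 * (- a + m + r) + + 0)) *
    ((+ 4 * (+ 2 * a - + 3 * r) + - + 3) * (+ 4 * (+ 2 * a - + 3 * r) + - + 3) - (+ 4 * (+ 2 * a - + 3 * r) + - + 3)
        * (+ 4 * a + + 0) + (+ 4 * a + + 0) * (+ 4 * a + + 0)) *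
    + 1 * (+ 1 * + 1) ≡ + 9 * (+ 4 * m - + 1)
        * (+ 4 * a * a + + 3 * (+ 4 * r - + 2 * a + + 1) * (+ 4 * r - + 2 * a + + 1))
  identity = solve-∀

realise-b2 : ∀ m r a → InS (+ 16 * + 9 * (+ 2 * m - + 1) * form₇ a (+ 4 * r - + 2 * a + + 1))
realise-b2 m r a = realise (+ 2 * a - + 3 * r) a (- a - m + r)
  (quad (+ 0) (- + 1) (- + 1) (- + 1)) zero₄ (quad (+ 0) (+ 1) (+ 1) (+ 1))
  (identity m r a)
  where
  identity : ∀ m r a →
    ((+ 4 * (+ 2 * a - + 3 * r) + - + 3) + (+ 4 * a + + 0) + + 3 * (+ 4 * (- a - m + r) + + 3)) *
    ((+ 4 * (+ 2 * a - + 3 * r) + - + 3) * (+ 4 * (+ 2 * a - + 3 * r) + - + 3) - (+ 4 * (+ 2 * a - + 3 * r) + - + 3)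
        * (+ 4 * a + + 0) + (+ 4 * a + + 0) * (+ 4 * a + + 0)) *
    (- + 2) * ((- + 2) * (- + 2)) ≡
        + 16 * + 9 * (+ 2 * m - + 1) * (+ 4 * a * a + + 3 * (+ 4 * r - + 2 * a + + 1) * (+ 4 * r - + 2 * a + + 1))
  identity = solve-∀

realise-b3 : ∀ m r a → InS (+ 64 * + 9 * m * form₇ a (+ 4 * r - + 2 * a + + 1))
realise-b3 m r a = realise (+ 2 * a - + 3 * r) a (- a + m + r)
  (quad (+ 0) (- + 1) (- + 1) (- + 1)) zero₄ (quad (+ 0) (+ 1) (+ 0) (+ 0))
  (identity m r a)
  where
  identity : ∀ m r a →
    ((+ 4 * (+ 2 * a - + 3 * r) + - + 3) + (+ 4 * a + + 0) + + 3 * (+ 4 * (- a + m + r) + + 1)) *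
    ((+ 4 * (+ 2 * a - + 3 * r) + - + 3) * (+ 4 * (+ 2 * a - + 3 * r) + - + 3) - (+ 4 * (+ 2 * a - + 3 * r) + - + 3)
        * (+ 4 * a + + 0) + (+ 4 * a + + 0) * (+ 4 * a + + 0)) *
    (- + 2) * (+ 4 * (- + 2)) ≡ + 64 * + 9 * m
        * (+ 4 * a * a + + 3 * (+ 4 * r - + 2 * a + + 1) * (+ 4 * r - + 2 * a + + 1))
  identity = solve-∀

realise-b4 : ∀ m → InS (+ 256 * + 9 * (+ 4 * m - + 1))
realise-b4 m = realise (+ 0) (+ 0) m
  (quad (- + 1) (+ 1) (+ 1) (+ 1)) (quad (+ 1) (+ 1) (+ 1) (+ 1)) (quad (+ 0) (- + 1) (- + 1) (- + 1))
  (identity m)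
  where
  identity : ∀ m →
    (+ 2 + + 4 + + 3 * (+ 4 * m + - + 3)) *
    (+ 2 * + 2 - + 2 * + 4 + + 4 * + 4) *
    + 4 * (+ 4 * + 4) ≡ + 256 * + 9 * (+ 4 * m - + 1)
  identity = solve-∀

-- The values of E at the four characters must sum to 0 mod 4. At `h₁` it is 4√-3, so the others
-- have to cancel among themselves: they are -2, -2ω, -2ω². The families with 2⁸, where E at `h₁` is
-- 2 mod 4, use -2 three times instead.
realise-b5 : ∀ m → InS (+ 1024 * + 9 * (+ 4 * m - + 1))
realise-b5 m = realise (+ 0) (+ 0) m
  (quad (+ 1) (+ 0) (+ 1) (+ 2)) (quad (+ 2) (+ 2) (+ 1) (+ 3)) (quad (- + 1) (- + 1) (- + 1) (- + 2))
  (identity m)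
  where
  identity : ∀ m →
    (+ 4 + + 8 + + 3 * (+ 4 * m + - + 5)) *
    (+ 4 * + 4 - + 4 * + 8 + + 8 * + 8) *
    + 4 * (+ 4 * + 4) ≡ + 1024 * + 9 * (+ 4 * m - + 1)
  identity = solve-∀

realise-b6 : ∀ m → InS (+ 4096 * + 9 * (+ 2 * m - + 1))
realise-b6 m = realise (+ 0) (+ 0) (- m)
  (quad (- + 1) (+ 1) (+ 1) (+ 1)) (quad (+ 1) (+ 1) (+ 1) (+ 1)) zero₄
  (identity m)
  where
  identity : ∀ m →
    (+ 2 + + 4 + + 3 * (+ 4 * (- m) + + 0)) *
    (+ 2 * + 2 - + 2 * + 4 + + 4 * + 4) *
    (- + 8) * ((- + 8) * (- + 8)) ≡ + 4096 * + 9 * (+ 2 * m - + 1)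
  identity = solve-∀

realise-b7 : ∀ m → InS (+ 16384 * + 9 * m)
realise-b7 m = realise (+ 0) (+ 0) m
  (quad (- + 1) (+ 1) (+ 1) (+ 1)) (quad (+ 1) (+ 1) (+ 1) (+ 1)) (quad (+ 0) (+ 0) (- + 1) (- + 1))
  (identity m)
  where
  identity : ∀ m →
    (+ 2 + + 4 + + 3 * (+ 4 * m + - + 2)) *
    (+ 2 * + 2 - + 2 * + 4 + + 4 * + 4) *
    (- + 8) * (+ 16 * (- + 8)) ≡ + 16384 * + 9 * m
  identity = solve-∀

realise-c1 : ∀ m → InS (+ 12 * m + + 1)
realise-c1 m = realise (+ 0) (+ 0) m
  (quad (+ 1) (+ 0) (+ 0) (+ 0)) zero₄ zero₄
  (identity m)
  where
  identity : ∀ m →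
    (+ 1 + + 0 + + 3 * (+ 4 * m + + 0)) *
    (+ 1 * + 1 - + 1 * + 0 + + 0 * + 0) *
    + 1 * (+ 1 * + 1) ≡ + 12 * m + + 1
  identity = solve-∀

realise-c2 : ∀ m → InS (+ 16 * (+ 6 * m + + 1))
realise-c2 m = realise (+ 0) (+ 0) (- m)
  (quad (+ 1) (+ 0) (+ 0) (+ 0)) zero₄ (quad (- + 1) (+ 0) (+ 0) (+ 0))
  (identity m)
  where
  identity : ∀ m →
    (+ 1 + + 0 + + 3 * (+ 4 * (- m) + - + 1)) *
    (+ 1 * + 1 - + 1 * + 0 + + 0 * + 0) *
    (- + 2) * ((- + 2) * (- + 2)) ≡ + 16 * (+ 6 * m + + 1)
  identity = solve-∀

realise-c3 : ∀ m → InS (+ 64 * (+ 3 * m + + 1))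
realise-c3 m = realise (+ 0) (+ 0) m
  (quad (+ 1) (+ 0) (+ 0) (+ 0)) zero₄ (quad (+ 0) (+ 1) (+ 0) (+ 0))
  (identity m)
  where
  identity : ∀ m →
    (+ 1 + + 0 + + 3 * (+ 4 * m + + 1)) *
    (+ 1 * + 1 - + 1 * + 0 + + 0 * + 0) *
    (- + 2) * (+ 4 * (- + 2)) ≡ + 64 * (+ 3 * m + + 1)
  identity = solve-∀

-- E at `h₁` is P + Qω with Q = 4e and P + Q = 12j + 5, that is, u + 2e√-3 with u + 6e = 12j + 5;
-- the third parameter m - j removes j from the integer factor.
realise-c4 : ∀ m j e → InS ((+ 12 * m + + 5) * N₁₂ (+ 12 * j + + 5 - + 6 * e) e)
realise-c4 m j e = realise (- e + + 3 * j) e (- j + m)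
  (quad (+ 2) (+ 1) (+ 1) (+ 1)) zero₄ zero₄
  (identity m j e)
  where
  identity : ∀ m j e →
    ((+ 4 * (- e + + 3 * j) + + 5) + (+ 4 * e + + 0) + + 3 * (+ 4 * (- j + m) + + 0)) *
    ((+ 4 * (- e + + 3 * j) + + 5) * (+ 4 * (- e + + 3 * j) + + 5) - (+ 4 * (- e + + 3 * j) + + 5) * (+ 4 * e + + 0)
        + (+ 4 * e + + 0) * (+ 4 * e + + 0)) *
    + 1 * (+ 1 * + 1) ≡ (+ 12 * m + + 5) * ((+ 12 * j + + 5 - + 6 * e) * (+ 12 * j + + 5 - + 6 * e) + + 12 * e * e)
  identity = solve-∀

realise-c5 : ∀ m j e → InS (- + 16 * (+ 6 * m + + 1) * N₁₂ (+ 12 * j + + 5 - + 6 * e) e)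
realise-c5 m j e = realise (- e + + 3 * j) e (- j + m)
  (quad (+ 2) (+ 1) (+ 1) (+ 1)) zero₄ (quad (- + 1) (+ 0) (+ 0) (+ 0))
  (identity m j e)
  where
  identity : ∀ m j e →
    ((+ 4 * (- e + + 3 * j) + + 5) + (+ 4 * e + + 0) + + 3 * (+ 4 * (- j + m) + - + 1)) *
    ((+ 4 * (- e + + 3 * j) + + 5) * (+ 4 * (- e + + 3 * j) + + 5) - (+ 4 * (- e + + 3 * j) + + 5) * (+ 4 * e + + 0)
        + (+ 4 * e + + 0) * (+ 4 * e + + 0)) *
    (- + 2) * ((- + 2) * (- + 2)) ≡
        - + 16 * (+ 6 * m + + 1) * ((+ 12 * j + + 5 - + 6 * e) * (+ 12 * j + + 5 - + 6 * e) + + 12 * e * e)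
  identity = solve-∀

realise-c6 : ∀ m j e → InS (- + 64 * (+ 3 * m + + 1) * N₁₂ (+ 12 * j + + 5 - + 6 * e) e)
realise-c6 m j e = realise (- e + + 3 * j) e (- j - m)
  (quad (+ 2) (+ 1) (+ 1) (+ 1)) zero₄ (quad (- + 1) (+ 0) (- + 1) (- + 1))
  (identity m j e)
  where
  identity : ∀ m j e →
    ((+ 4 * (- e + + 3 * j) + + 5) + (+ 4 * e + + 0) + + 3 * (+ 4 * (- j - m) + - + 3)) *
    ((+ 4 * (- e + + 3 * j) + + 5) * (+ 4 * (- e + + 3 * j) + + 5) - (+ 4 * (- e + + 3 * j) + + 5) * (+ 4 * e + + 0)
        + (+ 4 * e + + 0) * (+ 4 * e + + 0)) *
    (- + 2) * (+ 4 * (- + 2)) ≡ - + 64 * (+ 3 * m + + 1) * ((+ 12 * j + + 5 - + 6 * e) * (+ 12 * j + + 5 - + 6 * e)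
        + + 12 * e * e)
  identity = solve-∀

realise-c7 : ∀ m → InS (+ 256 * (+ 12 * m + + 5))
realise-c7 m = realise (+ 0) (+ 0) m
  (quad (- + 1) (+ 1) (+ 1) (+ 1)) zero₄ (quad (+ 1) (+ 0) (+ 0) (+ 0))
  (identity m)
  where
  identity : ∀ m →
    (+ 2 + + 0 + + 3 * (+ 4 * m + + 1)) *
    (+ 2 * + 2 - + 2 * + 0 + + 0 * + 0) *
    + 4 * (+ 4 * + 4) ≡ + 256 * (+ 12 * m + + 5)
  identity = solve-∀

-- E at `h₁` is 2(2a + v√-3), with residue 4a ≡ a mod √-3. It has to match the integer 12m + 5,
-- whence a = 3s + 2.
realise-c8 : ∀ m s b → InS (+ 256 * (+ 12 * m + + 5) * form₇ (+ 3 * s + + 2) (+ 2 * b + + 1))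
realise-c8 m s b = realise (b + + 3 * s) (+ 2 * b) (- b + m - s)
  (quad (+ 1) (+ 3) (+ 3) (+ 3)) (quad (+ 1) (+ 1) (+ 1) (+ 1)) (quad (+ 0) (- + 1) (- + 1) (- + 1))
  (identity m s b)
  where
  identity : ∀ m s b →
    ((+ 4 * (b + + 3 * s) + + 10) + (+ 4 * (+ 2 * b) + + 4) + + 3 * (+ 4 * (- b + m - s) + - + 3)) *
    ((+ 4 * (b + + 3 * s) + + 10) * (+ 4 * (b + + 3 * s) + + 10)
        - (+ 4 * (b + + 3 * s) + + 10) * (+ 4 * (+ 2 * b) + + 4) + (+ 4 * (+ 2 * b) + + 4) * (+ 4 * (+ 2 * b) + + 4)) *
    + 4 * (+ 4 * + 4) ≡ + 256 * (+ 12 * m + + 5)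
        * (+ 4 * (+ 3 * s + + 2) * (+ 3 * s + + 2) + + 3 * (+ 2 * b + + 1) * (+ 2 * b + + 1))
  identity = solve-∀

realise-c9 : ∀ m → InS (+ 1024 * (+ 12 * m + + 5))
realise-c9 m = realise (+ 0) (+ 0) m
  (quad (- + 1) (- + 2) (- + 1) (+ 0)) (quad (+ 0) (+ 0) (- + 1) (+ 1)) (quad (+ 1) (+ 1) (+ 1) (+ 0))
  (identity m)
  where
  identity : ∀ m →
    ((- + 4) + + 0 + + 3 * (+ 4 * m + + 3)) *
    ((- + 4) * (- + 4) - (- + 4) * + 0 + + 0 * + 0) *
    + 4 * (+ 4 * + 4) ≡ + 1024 * (+ 12 * m + + 5)
  identity = solve-∀

realise-c10 : ∀ m s b → InS (+ 1024 * (+ 12 * m + + 5) * form₇ (+ 3 * s + + 2) (+ 2 * b + + 1))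
realise-c10 m s b = realise (- + 2 * b - + 6 * s) (- + 4 * b) (+ 2 * b + m + + 2 * s)
  (quad (- + 5) (- + 6) (- + 5) (- + 4)) (quad (- + 2) (- + 2) (- + 3) (- + 1)) (quad (+ 3) (+ 3) (+ 3) (+ 2))
  (identity m s b)
  where
  identity : ∀ m s b →
    ((+ 4 * (- + 2 * b - + 6 * s) + - + 20) + (+ 4 * (- + 4 * b) + - + 8)
        + + 3 * (+ 4 * (+ 2 * b + m + + 2 * s) + + 11)) *
    ((+ 4 * (- + 2 * b - + 6 * s) + - + 20) * (+ 4 * (- + 2 * b - + 6 * s) + - + 20)
        - (+ 4 * (- + 2 * b - + 6 * s) + - + 20) * (+ 4 * (- + 4 * b) + - + 8)
            + (+ 4 * (- + 4 * b) + - + 8) * (+ 4 * (- + 4 * b) + - + 8)) *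
    + 4 * (+ 4 * + 4) ≡ + 1024 * (+ 12 * m + + 5)
        * (+ 4 * (+ 3 * s + + 2) * (+ 3 * s + + 2) + + 3 * (+ 2 * b + + 1) * (+ 2 * b + + 1))
  identity = solve-∀

realise-c11 : ∀ m → InS (- + 4096 * (+ 6 * m + + 1))
realise-c11 m = realise (+ 0) (+ 0) m
  (quad (- + 1) (+ 1) (+ 1) (+ 1)) zero₄ zero₄
  (identity m)
  where
  identity : ∀ m →
    (+ 2 + + 0 + + 3 * (+ 4 * m + + 0)) *
    (+ 2 * + 2 - + 2 * + 0 + + 0 * + 0) *
    (- + 8) * ((- + 8) * (- + 8)) ≡ - + 4096 * (+ 6 * m + + 1)
  identity = solve-∀

realise-c12 : ∀ m → InS (- + 16384 * (+ 3 * m + + 1))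
realise-c12 m = realise (+ 0) (+ 0) (- m)
  (quad (- + 1) (+ 1) (+ 1) (+ 1)) zero₄ (quad (+ 0) (+ 0) (- + 1) (- + 1))
  (identity m)
  where
  identity : ∀ m →
    (+ 2 + + 0 + + 3 * (+ 4 * (- m) + - + 2)) *
    (+ 2 * + 2 - + 2 * + 0 + + 0 * + 0) *
    (- + 8) * (+ 16 * (- + 8)) ≡ - + 16384 * (+ 3 * m + + 1)
  identity = solve-∀


-- Representations normalised for the families

class-5-form : ∀ {k} → (∃[ u ] ∃[ e ] k ≡ N₁₂ u e × (u + + 6 * e) %ℕ 12 ≡ 5) →
  ∃[ j ] ∃[ e ] k ≡ N₁₂ (+ 12 * j + + 5 - + 6 * e) e
class-5-form {k} (u , e , k≡ , ≡5) =
    j , e , trans k≡ (cong (λ z → N₁₂ z e) (l u e (+ 12 * j + + 5) (quotient-form 12 (u + + 6 * e) 5 ≡5)))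
  where
  j = (u + + 6 * e) /ℕ 12
  l : ∀ u e w → u + + 6 * e ≡ w → u ≡ w - + 6 * e
  l u e w f = by₁ (+ 1) f (solve (u ∷ e ∷ w ∷ []))

prime7-odd : ∀ p → Prime7 p → ∃[ a ] ∃[ b ] + p ≡ form₇ a (+ 2 * b + + 1)
prime7-odd p p7 = from (prime7-norm p p7)
  where
  from : (∃[ a ] ∃[ v ] + p ≡ form₇ a v) → ∃[ a ] ∃[ b ] + p ≡ form₇ a (+ 2 * b + + 1)
  from (a , v , p≡) = halve (scaled-residue 6 2 1 v 6v≡6)
    where
    6v≡6 : (+ 6 * v) %ℕ 12 ≡ 6
    6v≡6 = byResidues 12 (con 4 :* x₀ :* x₀ :+ con 3 :* x₁ :* x₁ ≈ 7 ⇒ con 6 :* x₁ ≈ 6) (vec₂ a v)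
        (subst (λ z → z %ℕ 12 ≡ 7) p≡ (proj₂ p7))
    halve : (∃[ b ] v ≡ + 2 * b + + 1) → ∃[ a ] ∃[ b ] + p ≡ form₇ a (+ 2 * b + + 1)
    halve (b , v≡) = a , b , trans p≡ (cong (form₇ a) v≡)

-- p ≡ 1 mod 3 makes a ≡ ±1 mod 3, and the sign of a is free.
prime7-mod3 : ∀ p → Prime7 p → ∃[ s ] ∃[ b ] + p ≡ form₇ (+ 3 * s + + 2) (+ 2 * b + + 1)
prime7-mod3 p p7 = from (prime7-odd p p7)
  where
  from : (∃[ a ] ∃[ b ] + p ≡ form₇ a (+ 2 * b + + 1)) → ∃[ s ] ∃[ b ] + p ≡ form₇ (+ 3 * s + + 2) (+ 2 * b + + 1)
  from (a , b , p≡) = sign (byResidues 12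
      (con 4 :* x₀ :* x₀ :+ con 3 :* (con 2 :* x₁ :+ con 1) :* (con 2 :* x₁ :+ con 1) ≈ 7 ⇒
          con 4 :* x₀ ≈ 8 ∥ con 4 :* :- x₀ ≈ 8)
      (vec₂ a b) (subst (λ z → z %ℕ 12 ≡ 7) p≡ (proj₂ p7)))
    where
    v = + 2 * b + + 1
    neg : ∀ a v → + 4 * a * a + + 3 * v * v ≡ + 4 * - a * - a + + 3 * v * v
    neg = solve-∀
    third : ∀ a → + p ≡ form₇ a v → (∃[ s ] a ≡ + 3 * s + + 2) → ∃[ s ] ∃[ b ] + p ≡ form₇ (+ 3 * s + + 2)
        (+ 2 * b + + 1)
    third a p≡ (s , a≡) = s , b , trans p≡ (cong (λ z → form₇ z v) a≡)
    sign : _ → ∃[ s ] ∃[ b ] + p ≡ form₇ (+ 3 * s + + 2) (+ 2 * b + + 1)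
    sign (inj₁ ≡8) = third a p≡ (scaled-residue 4 3 2 a ≡8)
    sign (inj₂ ≡8) = third (- a) (trans p≡ (neg a v)) (scaled-residue 4 3 2 (- a) ≡8)

-- v is odd, so one of ±v is congruent to 1 - 2a mod 4.
prime7-mod4 : ∀ p → Prime7 p → ∃[ r ] ∃[ a ] + p ≡ form₇ a (+ 4 * r - + 2 * a + + 1)
prime7-mod4 p p7 = from (prime7-odd p p7)
  where
  from : (∃[ a ] ∃[ b ] + p ≡ form₇ a (+ 2 * b + + 1)) → ∃[ r ] ∃[ a ] + p ≡ form₇ a (+ 4 * r - + 2 * a + + 1)
  from (a , b , p≡) = parity (byResidues 2 (x₀ :+ x₁ ≈ 0 ∥ x₀ :+ x₁ ≈ 1) (vec₂ a b))
    where
    r = (a + b) /ℕ 2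
    v-even : ∀ a b r → a + b ≡ + 2 * r + + 0 → + 2 * b + + 1 ≡ + 4 * r - + 2 * a + + 1
    v-even a b r e = by₁ (+ 2) e (solve (a ∷ b ∷ r ∷ []))
    v-odd : ∀ a b r → a + b ≡ + 2 * r + + 1 → - (+ 2 * b + + 1) ≡ + 4 * (a - r - + 1) - + 2 * a + + 1
    v-odd a b r e = by₁ (- + 2) e (solve (a ∷ b ∷ r ∷ []))
    neg : ∀ a v → + 4 * a * a + + 3 * v * v ≡ + 4 * a * a + + 3 * - v * - v
    neg = solve-∀
    parity : _ → ∃[ r ] ∃[ a ] + p ≡ form₇ a (+ 4 * r - + 2 * a + + 1)
    parity (inj₁ ≡0) = r , a , trans p≡ (cong (form₇ a) (v-even a b r (quotient-form 2 (a + b) 0 ≡0)))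
    parity (inj₂ ≡1) = a - r - + 1 , a , trans p≡ (trans (neg a (+ 2 * b + + 1))
      (cong (form₇ a) (v-odd a b r (quotient-form 2 (a + b) 1 ≡1))))

at-mod4 : ∀ {p} → Prime7 p → (f : ℤ → ℤ) → (∀ r a → InS (f (form₇ a (+ 4 * r - + 2 * a + + 1)))) → InS (f (+ p))
at-mod4 {p} p7 f g = from (prime7-mod4 p p7)
  where
  from : (∃[ r ] ∃[ a ] + p ≡ form₇ a (+ 4 * r - + 2 * a + + 1)) → InS (f (+ p))
  from (r , a , p≡) = subst (λ z → InS (f z)) (sym p≡) (g r a)

at-mod3 : ∀ {p} → Prime7 p → (f : ℤ → ℤ) → (∀ s b → InS (f (form₇ (+ 3 * s + + 2) (+ 2 * b + + 1)))) → InS (f (+ p))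
at-mod3 {p} p7 f g = from (prime7-mod3 p p7)
  where
  from : (∃[ s ] ∃[ b ] + p ≡ form₇ (+ 3 * s + + 2) (+ 2 * b + + 1)) → InS (f (+ p))
  from (s , b , p≡) = subst (λ z → InS (f z)) (sym p≡) (g s b)

at-kval : ∀ {k} → KVal k → (f : ℤ → ℤ) → (∀ j e → InS (f (N₁₂ (+ 12 * j + + 5 - + 6 * e) e))) → InS (f k)
at-kval {k} kv f g = from (class-5-form (kval-norm kv))
  where
  from : (∃[ j ] ∃[ e ] k ≡ N₁₂ (+ 12 * j + + 5 - + 6 * e) e) → InS (f k)
  from (j , e , k≡) = subst (λ z → InS (f z)) (sym k≡) (g j e)

union⊆S : ∀ {n} → Union n → InS n
union⊆S (a1 m) = realise-a1 m
union⊆S (a2 m) = realise-a2 m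
union⊆S (a3 m) = realise-a3 m
union⊆S (b1 m p p7) = at-mod4 p7 (λ z → three ^ 2 * (+ 4 * m - + 1) * z) (realise-b1 m)
union⊆S (b2 m p p7) = at-mod4 p7 (λ z → two ^ 4 * three ^ 2 * (+ 2 * m - + 1) * z) (realise-b2 m)
union⊆S (b3 m p p7) = at-mod4 p7 (λ z → two ^ 6 * three ^ 2 * m * z) (realise-b3 m)
union⊆S (b4 m) = realise-b4 m
union⊆S (b5 m) = realise-b5 m
union⊆S (b6 m) = realise-b6 m
union⊆S (b7 m) = realise-b7 m
union⊆S (c1 m) = realise-c1 m
union⊆S (c2 m) = realise-c2 m
union⊆S (c3 m) = realise-c3 m
union⊆S (c4 m k kv) = at-kval kv (λ z → (+ 12 * m + + 5) * z) (realise-c4 m)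
union⊆S (c5 m k kv) = at-kval kv (λ z → - (two ^ 4) * (+ 6 * m + + 1) * z) (realise-c5 m)
union⊆S (c6 m k kv) = at-kval kv (λ z → - (two ^ 6) * (+ 3 * m + + 1) * z) (realise-c6 m)
union⊆S (c7 m) = realise-c7 m
union⊆S (c8 m p p7) = at-mod3 p7 (λ z → two ^ 8 * (+ 12 * m + + 5) * z) (realise-c8 m)
union⊆S (c9 m) = realise-c9 m
union⊆S (c10 m p p7) = at-mod3 p7 (λ z → two ^ 10 * (+ 12 * m + + 5) * z) (realise-c10 m)
union⊆S (c11 m) = realise-c11 m
union⊆S (c12 m) = realise-c12 m

-- Congruences are all expressed modulo 12: 3y ≡ 9 means y ≡ 3 (mod 4), 6y ≡ 6 means that y is odd,
-- 2y ≡ 2 means y ≡ 1 (mod 6), and 4y ≡ 4 means y ≡ 1 (mod 3).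

≡3mod4 : ∀ y → (+ 3 * y) %ℕ 12 ≡ 9 → ∃[ m ] y ≡ + 4 * m - + 1
≡3mod4 y e with scaled-residue 3 4 3 y e
... | k , y≡ = k + + 1 , trans y≡ (shifted k)
  where
  shifted : ∀ k → + 4 * k + + 3 ≡ + 4 * (k + + 1) - + 1
  shifted = solve-∀

≡1mod2 : ∀ y → (+ 6 * y) %ℕ 12 ≡ 6 → ∃[ m ] y ≡ + 2 * m - + 1
≡1mod2 y e with scaled-residue 6 2 1 y e
... | k , y≡ = k + + 1 , trans y≡ (shifted k)
  where
  shifted : ∀ k → + 2 * k + + 1 ≡ + 2 * (k + + 1) - + 1
  shifted = solve-∀

≡5mod12 : ∀ y → y %ℕ 12 ≡ 5 → ∃[ m ] y ≡ + 12 * m + + 5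
≡5mod12 y e = y /ℕ 12 , quotient-form 12 y 5 e

restate : ∀ {n y} (f g : ℤ → ℤ) → (∀ m → Union (f (g m))) → (∃[ m ] y ≡ g m) → n ≡ f y → Union n
restate f g u (m , y≡) n≡ = subst Union (sym (trans n≡ (cong f y≡))) (u m)

module _ {n : ℤ} where

  union-a1 : ∀ y → (+ 3 * y) %ℕ 12 ≡ 9 → n ≡ + 27 * y → Union n
  union-a1 y r = restate (λ z → + 27 * z) (λ m → + 4 * m - + 1) a1 (≡3mod4 y r)

  union-a2 : ∀ y → (+ 6 * y) %ℕ 12 ≡ 6 → n ≡ + 432 * y → Union n
  union-a2 y r = restate (λ z → + 432 * z) (λ m → + 2 * m - + 1) a2 (≡1mod2 y r)

  union-a3 : ∀ y → n ≡ + 1728 * y → Union n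
  union-a3 y n≡ = subst Union (sym n≡) (a3 y)

  union-b1 : ∀ y p → Prime7 p → (+ 3 * y) %ℕ 12 ≡ 9 → n ≡ + 9 * y * + p → Union n
  union-b1 y p p7 r = restate (λ z → + 9 * z * + p) (λ m → + 4 * m - + 1) (λ m → b1 m p p7) (≡3mod4 y r)

  union-b2 : ∀ y p → Prime7 p → (+ 6 * y) %ℕ 12 ≡ 6 → n ≡ + 144 * y * + p → Union n
  union-b2 y p p7 r = restate (λ z → + 144 * z * + p) (λ m → + 2 * m - + 1) (λ m → b2 m p p7) (≡1mod2 y r)

  union-b3 : ∀ y p → Prime7 p → n ≡ + 576 * y * + p → Union n
  union-b3 y p p7 n≡ = subst Union (sym n≡) (b3 y p p7)

  union-b4 : ∀ y → (+ 3 * y) %ℕ 12 ≡ 9 → n ≡ + 2304 * y → Union n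
  union-b4 y r = restate (λ z → + 2304 * z) (λ m → + 4 * m - + 1) b4 (≡3mod4 y r)

  union-b5 : ∀ y → (+ 3 * y) %ℕ 12 ≡ 9 → n ≡ + 9216 * y → Union n
  union-b5 y r = restate (λ z → + 9216 * z) (λ m → + 4 * m - + 1) b5 (≡3mod4 y r)

  union-b6 : ∀ y → (+ 6 * y) %ℕ 12 ≡ 6 → n ≡ + 36864 * y → Union n
  union-b6 y r = restate (λ z → + 36864 * z) (λ m → + 2 * m - + 1) b6 (≡1mod2 y r)

  union-b7 : ∀ y → n ≡ + 147456 * y → Union n
  union-b7 y n≡ = subst Union (sym n≡) (b7 y)

  union-c1 : n %ℕ 12 ≡ 1 → Union n
  union-c1 r = subst Union (sym (quotient-form 12 n 1 r)) (c1 (n /ℕ 12))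

  union-c2 : ∀ y → (+ 2 * y) %ℕ 12 ≡ 2 → n ≡ + 16 * y → Union n
  union-c2 y r = restate (λ z → + 16 * z) (λ m → + 6 * m + + 1) c2 (scaled-residue 2 6 1 y r)

  union-c3 : ∀ y → (+ 4 * y) %ℕ 12 ≡ 4 → n ≡ + 64 * y → Union n
  union-c3 y r = restate (λ z → + 64 * z) (λ m → + 3 * m + + 1) c3 (scaled-residue 4 3 1 y r)

  union-c4 : ∀ y k → KVal k → y %ℕ 12 ≡ 5 → n ≡ y * k → Union n
  union-c4 y k kv r = restate (λ z → z * k) (λ m → + 12 * m + + 5) (λ m → c4 m k kv) (≡5mod12 y r)

  union-c5 : ∀ y k → KVal k → (+ 2 * y) %ℕ 12 ≡ 2 → n ≡ - + 16 * y * k → Union n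
  union-c5 y k kv r = restate (λ z → - + 16 * z * k) (λ m → + 6 * m + + 1) (λ m → c5 m k kv) (scaled-residue 2 6 1 y r)

  union-c6 : ∀ y k → KVal k → (+ 4 * y) %ℕ 12 ≡ 4 → n ≡ - + 64 * y * k → Union n
  union-c6 y k kv r = restate (λ z → - + 64 * z * k) (λ m → + 3 * m + + 1) (λ m → c6 m k kv) (scaled-residue 4 3 1 y r)

  union-c7 : ∀ y → y %ℕ 12 ≡ 5 → n ≡ + 256 * y → Union n
  union-c7 y r = restate (λ z → + 256 * z) (λ m → + 12 * m + + 5) c7 (≡5mod12 y r)

  union-c8 : ∀ y p → Prime7 p → y %ℕ 12 ≡ 5 → n ≡ + 256 * y * + p → Union n
  union-c8 y p p7 r = restate (λ z → + 256 * z * + p) (λ m → + 12 * m + + 5) (λ m → c8 m p p7) (≡5mod12 y r)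

  union-c9 : ∀ y → y %ℕ 12 ≡ 5 → n ≡ + 1024 * y → Union n
  union-c9 y r = restate (λ z → + 1024 * z) (λ m → + 12 * m + + 5) c9 (≡5mod12 y r)

  union-c10 : ∀ y p → Prime7 p → y %ℕ 12 ≡ 5 → n ≡ + 1024 * y * + p → Union n
  union-c10 y p p7 r = restate (λ z → + 1024 * z * + p) (λ m → + 12 * m + + 5) (λ m → c10 m p p7) (≡5mod12 y r)

  union-c11 : ∀ y → (+ 2 * y) %ℕ 12 ≡ 2 → n ≡ - + 4096 * y → Union n
  union-c11 y r = restate (λ z → - + 4096 * z) (λ m → + 6 * m + + 1) c11 (scaled-residue 2 6 1 y r)

  union-c12 : ∀ y → (+ 4 * y) %ℕ 12 ≡ 4 → n ≡ - + 16384 * y → Union n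
  union-c12 y r = restate (λ z → - + 16384 * z) (λ m → + 3 * m + + 1) c12 (scaled-residue 4 3 1 y r)

-- Norms

NormForm : ℤ → Set
NormForm N = ∃[ u ] ∃[ v ] N ≡ N₃ u v

-- 2 is inert in ℤ[ω], so norms contain exact powers of 4. From 4³ on the list makes no further
-- distinction and nothing is recorded about the cofactor.
data TwoAdic (N : ℤ) : Set where
  4⁰ : NormForm N → (+ 6 * N) %ℕ 12 ≡ 6 → TwoAdic N
  4¹ : ∀ M → NormForm M → (+ 6 * M) %ℕ 12 ≡ 6 → N ≡ + 4 * M → TwoAdic N
  4² : ∀ M → NormForm M → (+ 6 * M) %ℕ 12 ≡ 6 → N ≡ + 16 * M → TwoAdic N
  4³ : ∀ M → N ≡ + 64 * M → TwoAdic N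

-- If P and Q are not both even, one of P, Q, P - Q is even, and then some associate or conjugate of
-- P + Qω lies in ℤ[√-3], which gives the shape u² + 3v².
norm-odd-or-even : ∀ P Q → (NormForm (norm P Q) × (+ 6 * norm P Q) %ℕ 12 ≡ 6) ⊎
    (∃[ P′ ] ∃[ Q′ ] norm P Q ≡ + 4 * norm P′ Q′)
norm-odd-or-even P Q = by-parity (byResidues 12
    ((con 6 :* x₀ ≈ 0 & con 6 :* x₁ ≈ 0) ∥
     (con 6 :* (x₀ :* x₀ :- x₀ :* x₁ :+ x₁ :* x₁) ≈ 6 &
         (con 6 :* x₁ ≈ 0 ∥ con 6 :* x₀ ≈ 0 ∥ con 6 :* (x₀ :- x₁) ≈ 0))) (vec₂ P Q))
  where
  identity₀ : ∀ P′ Q′ → + 2 * P′ * (+ 2 * P′) - + 2 * P′ * (+ 2 * Q′) + + 2 * Q′ * (+ 2 * Q′) ≡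
      + 4 * (P′ * P′ - P′ * Q′ + Q′ * Q′)
  identity₀ = solve-∀
  identity₁ : ∀ P v → P * P - P * (+ 2 * v) + + 2 * v * (+ 2 * v) ≡ (P - v) * (P - v) + + 3 * v * v
  identity₁ = solve-∀
  identity₂ : ∀ v Q → + 2 * v * (+ 2 * v) - + 2 * v * Q + Q * Q ≡ (Q - v) * (Q - v) + + 3 * v * v
  identity₂ = solve-∀
  identity₃ : ∀ P Q v → P - Q ≡ + 2 * v → P * P - P * Q + Q * Q ≡ (Q + v) * (Q + v) + + 3 * v * v
  identity₃ P Q v e = by₁ (P + + 2 * v) e (solve (P ∷ Q ∷ v ∷ []))
  both-even : (∃[ t ] P ≡ + 2 * t) → (∃[ t ] Q ≡ + 2 * t) → ∃[ P′ ] ∃[ Q′ ] norm P Q ≡ + 4 * norm P′ Q′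
  both-even (P′ , e) (Q′ , f) = P′ , Q′ , trans (cong₂ norm e f) (identity₀ P′ Q′)
  Q-even : (∃[ t ] Q ≡ + 2 * t) → NormForm (norm P Q)
  Q-even (v , e) = P - v , v , trans (cong (norm P) e) (identity₁ P v)
  P-even : (∃[ t ] P ≡ + 2 * t) → NormForm (norm P Q)
  P-even (v , e) = Q - v , v , trans (cong (λ z → norm z Q) e) (identity₂ v Q)
  equal-parity : (∃[ t ] P - Q ≡ + 2 * t) → NormForm (norm P Q)
  equal-parity (v , e) = Q + v , v , identity₃ P Q v e
  by-parity : _ → (NormForm (norm P Q) × (+ 6 * norm P Q) %ℕ 12 ≡ 6) ⊎ (∃[ P′ ] ∃[ Q′ ] norm P Q ≡ + 4 * norm P′ Q′)
  by-parity (inj₁ (p , q)) = inj₂ (both-even (scaled-multiple 6 2 P p) (scaled-multiple 6 2 Q q))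
  by-parity (inj₂ (o , inj₁ q)) = inj₁ (Q-even (scaled-multiple 6 2 Q q) , o)
  by-parity (inj₂ (o , inj₂ (inj₁ p))) = inj₁ (P-even (scaled-multiple 6 2 P p) , o)
  by-parity (inj₂ (o , inj₂ (inj₂ d))) = inj₁ (equal-parity (scaled-multiple 6 2 (P - Q) d) , o)

two-adic : ∀ P Q → TwoAdic (norm P Q)
two-adic P Q = first (norm-odd-or-even P Q)
  where
  4·4 : ∀ m → + 4 * (+ 4 * m) ≡ + 16 * m
  4·4 = solve-∀
  16·4 : ∀ m → + 16 * (+ 4 * m) ≡ + 64 * m
  16·4 = solve-∀
  Step : ℤ → Set
  Step N = (NormForm N × (+ 6 * N) %ℕ 12 ≡ 6) ⊎ (∃[ P′ ] ∃[ Q′ ] N ≡ + 4 * norm P′ Q′)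
  third : ∀ P″ Q″ → norm P Q ≡ + 16 * norm P″ Q″ → Step (norm P″ Q″) → TwoAdic (norm P Q)
  third P″ Q″ e (inj₁ (f , o)) = 4² (norm P″ Q″) f o e
  third P″ Q″ e (inj₂ (P‴ , Q‴ , g)) = 4³ (norm P‴ Q‴) (trans e (trans (cong (λ z → + 16 * z) g) (16·4 (norm P‴ Q‴))))
  second : ∀ P′ Q′ → norm P Q ≡ + 4 * norm P′ Q′ → Step (norm P′ Q′) → TwoAdic (norm P Q)
  second P′ Q′ e (inj₁ (f , o)) = 4¹ (norm P′ Q′) f o e
  second P′ Q′ e (inj₂ (P″ , Q″ , g)) = third P″ Q″ (trans e (trans (cong (λ z → + 4 * z) g) (4·4 (norm P″ Q″))))
      (norm-odd-or-even P″ Q″)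
  first : Step (norm P Q) → TwoAdic (norm P Q)
  first (inj₁ (f , o)) = 4⁰ f o
  first (inj₂ (P′ , Q′ , g)) = second P′ Q′ g (norm-odd-or-even P′ Q′)

-- l ≡ 1 (mod 12) because N and p are both 7 modulo 12.
CofactorOfPrime7 : ℤ → Set
CofactorOfPrime7 N = ∃[ l ] ∃[ p ] Prime7 p × l %ℕ 12 ≡ 1 × N ≡ l * + p

normForm7-cofactor : ∀ N → NormForm N → N %ℕ 12 ≡ 7 → CofactorOfPrime7 N
normForm7-cofactor N (u , v , e) ≡7 = from (norm7-has-prime7 u v (subst (λ z → z %ℕ 12 ≡ 7) e ≡7))
  where
  from : Seven (N₃ u v) → CofactorOfPrime7 N
  from (p , p7 , divides l f) = l , p , p7 ,
    byResidues 12 (x₀ :* x₁ ≈ 7 ⇒ x₁ ≈ 7 ⇒ x₀ ≈ 1) (vec₂ l (+ p)) (subst (λ z → z %ℕ 12 ≡ 7) (trans e f) ≡7)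
        (proj₂ p7) , trans e f

odd-norm-1-or-7 : ∀ N → NormForm N → (+ 6 * N) %ℕ 12 ≡ 6 → (+ 4 * N) %ℕ 12 ≡ 4 → N %ℕ 12 ≡ 1 ⊎ CofactorOfPrime7 N
odd-norm-1-or-7 N (u , v , refl) o r =
    from (byResidues 12 (con 6 :* n₃ x₀ x₁ ≈ 6 ⇒ con 4 :* n₃ x₀ x₁ ≈ 4 ⇒ n₃ x₀ x₁ ≈ 1 ∥ n₃ x₀ x₁ ≈ 7) (vec₂ u v) o r)
  where
  from : _ → N₃ u v %ℕ 12 ≡ 1 ⊎ CofactorOfPrime7 (N₃ u v)
  from (inj₁ ≡1) = inj₁ ≡1
  from (inj₂ ≡7) = inj₂ (normForm7-cofactor (N₃ u v) (u , v , refl) ≡7)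

kval≡1 : ∀ {k} → KVal k → k %ℕ 12 ≡ 1
kval≡1 {k} kv = from (kval-norm kv)
  where
  from : (∃[ u ] ∃[ e ] k ≡ N₁₂ u e × (u + + 6 * e) %ℕ 12 ≡ 5) → k %ℕ 12 ≡ 1
  from (u , e , k≡ , r) = subst (λ z → z %ℕ 12 ≡ 1) (sym k≡) (N₁₂≡1 u e (inj₁ r))

-- Odd Eisenstein part

odd-class-1 : ∀ {n D N} → n ≡ D * N → IntegerPart D → N %ℕ 12 ≡ 1 → (+ 4 * D) %ℕ 12 ≡ 4 → Union n
odd-class-1 {n} {D} {N} n≡ (odd r) N≡1 D≡1 = union-c1 (subst (λ z → z %ℕ 12 ≡ 1) (sym n≡)
  (byResidues 12 (con 3 :* x₀ ≈ 3 ⇒ x₁ ≈ 1 ⇒ con 4 :* x₀ ≈ 4 ⇒ x₀ :* x₁ ≈ 1) (vec₂ D N) r N≡1 D≡1))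
odd-class-1 {n} {D} {N} n≡ (two⁴ y refl o) N≡1 D≡1 = union-c2 (y * N)
  (byResidues 12 (con 6 :* x₀ ≈ 6 ⇒ x₁ ≈ 1 ⇒ con 4 :* (con 16 :* x₀) ≈ 4 ⇒ con 2 :* (x₀ :* x₁) ≈ 2) (vec₂ y N) o N≡1
      D≡1)
  (trans n≡ (ℤₚ.*-assoc (+ 16) y N))
odd-class-1 {n} {D} {N} n≡ (two⁶ y refl) N≡1 D≡1 = union-c3 (y * N)
  (byResidues 12 (x₁ ≈ 1 ⇒ con 4 :* (con 64 :* x₀) ≈ 4 ⇒ con 4 :* (x₀ :* x₁) ≈ 4) (vec₂ y N) N≡1 D≡1)
  (trans n≡ (ℤₚ.*-assoc (+ 64) y N))

-- The cofactor l is absorbed into D. For even D the sign is moved as well, since the remaining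
-- factor is -1 mod 3.
odd-class-2 : ∀ {n D N} k l → n ≡ D * N → IntegerPart D → KVal k → N ≡ l * k → l %ℕ 12 ≡ 1 → (+ 4 * D) %ℕ 12 ≡ 8 →
    Union n
odd-class-2 {n} {D} {N} k l n≡ (odd r) kv N≡ l≡1 D≡2 = union-c4 (D * l) k kv
  (byResidues 12 (con 3 :* x₀ ≈ 3 ⇒ x₁ ≈ 1 ⇒ con 4 :* x₀ ≈ 8 ⇒ x₀ :* x₁ ≈ 5) (vec₂ D l) r l≡1 D≡2)
  (trans n≡ (trans (cong (λ z → D * z) N≡) (sym (ℤₚ.*-assoc D l k))))
odd-class-2 {n} {D} {N} k l n≡ (two⁴ y refl o) kv N≡ l≡1 D≡2 = union-c5 (- (y * l)) k kv
  (byResidues 12 (con 6 :* x₀ ≈ 6 ⇒ x₁ ≈ 1 ⇒ con 4 :* (con 16 :* x₀) ≈ 8 ⇒ con 2 :* (:- (x₀ :* x₁)) ≈ 2) (vec₂ y l) o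
      l≡1 D≡2)
  (trans n≡ (trans (cong (λ z → + 16 * y * z) N≡) (i y l k)))
  where
  i : ∀ y l k → + 16 * y * (l * k) ≡ - + 16 * - (y * l) * k
  i = solve-∀
odd-class-2 {n} {D} {N} k l n≡ (two⁶ y refl) kv N≡ l≡1 D≡2 = union-c6 (- (y * l)) k kv
  (byResidues 12 (x₁ ≈ 1 ⇒ con 4 :* (con 64 :* x₀) ≈ 8 ⇒ con 4 :* (:- (x₀ :* x₁)) ≈ 4) (vec₂ y l) l≡1 D≡2)
  (trans n≡ (trans (cong (λ z → + 64 * y * z) N≡) (i y l k)))
  where
  i : ∀ y l k → + 64 * y * (l * k) ≡ - + 64 * - (y * l) * k
  i = solve-∀

data TripleIntegerPart (D : ℤ) : Set where
  odd  : ∀ d → D ≡ + 3 * d → (+ 3 * d) %ℕ 12 ≡ 9 → TripleIntegerPart D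
  two⁴ : ∀ y → D ≡ + 48 * y → (+ 6 * y) %ℕ 12 ≡ 6 → TripleIntegerPart D
  two⁶ : ∀ y → D ≡ + 192 * y → TripleIntegerPart D

tripleIntegerPart : ∀ {D} → IntegerPart D → (+ 4 * D) %ℕ 12 ≡ 0 → TripleIntegerPart D
tripleIntegerPart {D} (odd r) D≡0 = from (scaled-multiple 4 3 D D≡0)
  where
  from : (∃[ d ] D ≡ + 3 * d) → TripleIntegerPart D
  from (d , e) = odd d e (byResidues 12 (con 3 :* (con 3 :* x₀) ≈ 3 ⇒ con 3 :* x₀ ≈ 9) (vec₁ d)
      (subst (λ z → (+ 3 * z) %ℕ 12 ≡ 3) e r))
tripleIntegerPart {D} (two⁴ y e o) D≡0 =
    from (scaled-multiple 4 3 y (byResidues 12 (con 4 :* (con 16 :* x₀) ≈ 0 ⇒ con 4 :* x₀ ≈ 0) (vec₁ y)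
        (subst (λ z → (+ 4 * z) %ℕ 12 ≡ 0) e D≡0)))
  where
  i : ∀ z → + 16 * (+ 3 * z) ≡ + 48 * z
  i = solve-∀
  from : (∃[ z ] y ≡ + 3 * z) → TripleIntegerPart D
  from (z , f) = two⁴ z (trans e (trans (cong (λ y → + 16 * y) f) (i z)))
    (byResidues 12 (con 6 :* (con 3 :* x₀) ≈ 6 ⇒ con 6 :* x₀ ≈ 6) (vec₁ z) (subst (λ z → (+ 6 * z) %ℕ 12 ≡ 6) f o))
tripleIntegerPart {D} (two⁶ y e) D≡0 =
    from (scaled-multiple 4 3 y (byResidues 12 (con 4 :* (con 64 :* x₀) ≈ 0 ⇒ con 4 :* x₀ ≈ 0) (vec₁ y)
        (subst (λ z → (+ 4 * z) %ℕ 12 ≡ 0) e D≡0)))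
  where
  i : ∀ z → + 64 * (+ 3 * z) ≡ + 192 * z
  i = solve-∀
  from : (∃[ z ] y ≡ + 3 * z) → TripleIntegerPart D
  from (z , f) = two⁶ z (trans e (trans (cong (λ y → + 64 * y) f) (i z)))

odd-27 : ∀ {n D} M → n ≡ D * (+ 3 * (+ 3 * M)) → TripleIntegerPart D → (+ 3 * (+ 3 * M)) %ℕ 12 ≡ 9 → Union n
odd-27 M n≡ (odd d refl r) M≡ =
    union-a1 (d * M) (byResidues 12 (con 3 :* x₀ ≈ 9 ⇒ con 3 :* (con 3 :* x₁) ≈ 9 ⇒ con 3 :* (x₀ :* x₁) ≈ 9)
        (vec₂ d M) r M≡) (trans n≡ (i d M))
  where
  i : ∀ d M → + 3 * d * (+ 3 * (+ 3 * M)) ≡ + 27 * (d * M)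
  i = solve-∀
odd-27 M n≡ (two⁴ y refl o) M≡ =
    union-a2 (y * M) (byResidues 12 (con 6 :* x₀ ≈ 6 ⇒ con 3 :* (con 3 :* x₁) ≈ 9 ⇒ con 6 :* (x₀ :* x₁) ≈ 6)
        (vec₂ y M) o M≡) (trans n≡ (i y M))
  where
  i : ∀ y M → + 48 * y * (+ 3 * (+ 3 * M)) ≡ + 432 * (y * M)
  i = solve-∀
odd-27 M n≡ (two⁶ y refl) M≡ = union-a3 (y * M) (trans n≡ (i y M))
  where
  i : ∀ y M → + 192 * y * (+ 3 * (+ 3 * M)) ≡ + 1728 * (y * M)
  i = solve-∀

odd-9 : ∀ {n D} l p → Prime7 p → l %ℕ 12 ≡ 1 → n ≡ D * (+ 3 * (l * + p)) → TripleIntegerPart D → Union n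
odd-9 l p p7 l≡1 n≡ (odd d refl r) =
    union-b1 (d * l) p p7 (byResidues 12 (con 3 :* x₀ ≈ 9 ⇒ x₁ ≈ 1 ⇒ con 3 :* (x₀ :* x₁) ≈ 9) (vec₂ d l) r l≡1)
        (trans n≡ (i d l (+ p)))
  where
  i : ∀ d l p → + 3 * d * (+ 3 * (l * p)) ≡ + 9 * (d * l) * p
  i = solve-∀
odd-9 l p p7 l≡1 n≡ (two⁴ y refl o) =
    union-b2 (y * l) p p7 (byResidues 12 (con 6 :* x₀ ≈ 6 ⇒ x₁ ≈ 1 ⇒ con 6 :* (x₀ :* x₁) ≈ 6) (vec₂ y l) o l≡1)
        (trans n≡ (i y l (+ p)))
  where
  i : ∀ y l p → + 48 * y * (+ 3 * (l * p)) ≡ + 144 * (y * l) * p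
  i = solve-∀
odd-9 l p p7 l≡1 n≡ (two⁶ y refl) = union-b3 (y * l) p p7 (trans n≡ (i y l (+ p)))
  where
  i : ∀ y l p → + 192 * y * (+ 3 * (l * p)) ≡ + 576 * (y * l) * p
  i = solve-∀

-- The norm of E/√-3 is 3 mod 4. Either 3 divides it, giving 27 together with the 3 in D, or it is 7
-- mod 12 and has a prime factor 7 mod 12.
odd-class-0 : ∀ {n D} u v → n ≡ D * (+ 3 * N₃ u v) → TripleIntegerPart D → (+ 3 * N₃ u v) %ℕ 12 ≡ 9 → Union n
odd-class-0 {n} {D} u v n≡ D₃ N≡ = by-residue (byResidues 12
    (con 3 :* n₃ x₀ x₁ ≈ 9 ⇒ con 4 :* n₃ x₀ x₁ ≈ 0 ∥ n₃ x₀ x₁ ≈ 7) (vec₂ u v) N≡)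
  where
  by-residue : (+ 4 * N₃ u v) %ℕ 12 ≡ 0 ⊎ N₃ u v %ℕ 12 ≡ 7 → Union n
  by-residue (inj₁ ≡0) = from (scaled-multiple 4 3 (N₃ u v) ≡0)
    where
    from : (∃[ M ] N₃ u v ≡ + 3 * M) → Union n
    from (M , e) = odd-27 M (trans n≡ (cong (λ z → D * (+ 3 * z)) e)) D₃ (subst (λ z → (+ 3 * z) %ℕ 12 ≡ 9) e N≡)
  by-residue (inj₂ ≡7) = from (normForm7-cofactor (N₃ u v) (u , v , refl) ≡7)
    where
    from : CofactorOfPrime7 (N₃ u v) → Union n
    from (l , p , p7 , l≡1 , e) = odd-9 l p p7 l≡1 (trans n≡ (cong (λ z → D * (+ 3 * z)) e)) D₃

-- Even Eisenstein part

module _ {n D M : ℤ} (α β γ c δ y m : ℤ) (n≡ : n ≡ D * (β * M)) (D≡ : D ≡ α * y) (M≡ : M ≡ γ * m)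
    (αβγ≡cδ : α * β * γ ≡ c * δ) where

  scale₊ : n ≡ c * (δ * (y * m))
  scale₊ = trans n≡ (trans (cong₂ (λ d m → d * (β * m)) D≡ M≡) (trans (gather α β γ y m)
    (trans (cong (_* (y * m)) αβγ≡cδ) (ℤₚ.*-assoc c δ (y * m)))))
    where
    gather : ∀ α β γ y m → α * y * (β * (γ * m)) ≡ α * β * γ * (y * m)
    gather = solve-∀

  scale₋ : n ≡ - c * - (δ * (y * m))
  scale₋ = trans scale₊ (two-signs c (δ * (y * m)))
    where
    two-signs : ∀ c x → c * x ≡ - c * - x
    two-signs = solve-∀

scaleₚ : ∀ {n D M} α β γ c δ y l p → n ≡ D * (β * M) → D ≡ α * y → M ≡ γ * (l * p) → α * β * γ ≡ c * δ →
  n ≡ c * (δ * (y * l)) * p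
scaleₚ α β γ c δ y l p n≡ D≡ M≡ e = trans (scale₊ α β γ c δ y (l * p) n≡ D≡ M≡ e) (regroup c δ y l p)
  where
  regroup : ∀ c δ y l p → c * (δ * (y * (l * p))) ≡ c * (δ * (y * l)) * p
  regroup = solve-∀

1* : ∀ x → x ≡ + 1 * x
1* x = sym (ℤₚ.*-identityˡ x)

-- The power of 2 is 2⁸ times the contributions of D and M. With D odd, 2⁸ and 2¹⁰ require the
-- residue of the odd part of M: 1 mod 12, or 7 mod 12 and then a prime factor. From 2¹² on only
-- parity and the residue -1 mod 3 of the value are left, whence the minus signs.
even-class-2 : ∀ {n D M} → n ≡ D * (+ 256 * M) → IntegerPart D → TwoAdic M → (+ 4 * D) %ℕ 12 ≡ 8 →
    (+ 4 * M) %ℕ 12 ≡ 4 → Union n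
even-class-2 {n} {D} {M} n≡ (odd r) (4⁰ f o) D≡2 M≡1 = by-norm (odd-norm-1-or-7 M f o M≡1)
  where
  by-norm : M %ℕ 12 ≡ 1 ⊎ CofactorOfPrime7 M → Union n
  by-norm (inj₁ ≡1) = union-c7 (+ 1 * (D * M))
      (byResidues 12 (con 3 :* x₀ ≈ 3 ⇒ con 4 :* x₀ ≈ 8 ⇒ x₁ ≈ 1 ⇒ con 1 :* (x₀ :* x₁) ≈ 5) (vec₂ D M) r D≡2 ≡1)
    (scale₊ (+ 1) (+ 256) (+ 1) (+ 256) (+ 1) D M n≡ (1* D) (1* M) refl)
  by-norm (inj₂ (l , p , p7 , l≡1 , e)) = union-c8 (+ 1 * (D * l)) p p7
      (byResidues 12 (con 3 :* x₀ ≈ 3 ⇒ con 4 :* x₀ ≈ 8 ⇒ x₁ ≈ 1 ⇒ con 1 :* (x₀ :* x₁) ≈ 5) (vec₂ D l) r D≡2 l≡1)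
    (scaleₚ (+ 1) (+ 256) (+ 1) (+ 256) (+ 1) D l (+ p) n≡ (1* D) (trans (1* M) (cong (λ z → + 1 * z) e)) refl)
even-class-2 {n} {D} n≡ (odd r) (4¹ M f o refl) D≡2 M≡1 =
    by-norm (odd-norm-1-or-7 M f o (byResidues 12 (con 4 :* (con 4 :* x₀) ≈ 4 ⇒ con 4 :* x₀ ≈ 4) (vec₁ M) M≡1))
  where
  by-norm : M %ℕ 12 ≡ 1 ⊎ CofactorOfPrime7 M → Union n
  by-norm (inj₁ ≡1) = union-c9 (+ 1 * (D * M))
      (byResidues 12 (con 3 :* x₀ ≈ 3 ⇒ con 4 :* x₀ ≈ 8 ⇒ x₁ ≈ 1 ⇒ con 1 :* (x₀ :* x₁) ≈ 5) (vec₂ D M) r D≡2 ≡1)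
    (scale₊ (+ 1) (+ 256) (+ 4) (+ 1024) (+ 1) D M n≡ (1* D) refl refl)
  by-norm (inj₂ (l , p , p7 , l≡1 , e)) = union-c10 (+ 1 * (D * l)) p p7
      (byResidues 12 (con 3 :* x₀ ≈ 3 ⇒ con 4 :* x₀ ≈ 8 ⇒ x₁ ≈ 1 ⇒ con 1 :* (x₀ :* x₁) ≈ 5) (vec₂ D l) r D≡2 l≡1)
    (scaleₚ (+ 1) (+ 256) (+ 4) (+ 1024) (+ 1) D l (+ p) n≡ (1* D) (cong (λ z → + 4 * z) e) refl)
even-class-2 {n} {D} n≡ (odd r) (4² M f o refl) D≡2 M≡1 = union-c11 (- (+ 1 * (D * M)))
  (byResidues 12 (con 3 :* x₀ ≈ 3 ⇒ con 6 :* x₁ ≈ 6 ⇒ con 4 :* x₀ ≈ 8 ⇒ con 4 :* (con 16 :* x₁) ≈ 4 ⇒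
      con 2 :* (:- (con 1 :* (x₀ :* x₁))) ≈ 2)
    (vec₂ D M) r o D≡2 M≡1) (scale₋ (+ 1) (+ 256) (+ 16) (+ 4096) (+ 1) D M n≡ (1* D) refl refl)
even-class-2 {n} {D} n≡ (odd r) (4³ M refl) D≡2 M≡1 = union-c12 (- (+ 1 * (D * M)))
  (byResidues 12 (con 4 :* x₀ ≈ 8 ⇒ con 4 :* (con 64 :* x₁) ≈ 4 ⇒ con 4 :* (:- (con 1 :* (x₀ :* x₁))) ≈ 4) (vec₂ D M)
      D≡2 M≡1)
  (scale₋ (+ 1) (+ 256) (+ 64) (+ 16384) (+ 1) D M n≡ (1* D) refl refl)
even-class-2 {n} {_} {M} n≡ (two⁴ y refl e) (4⁰ f o) D≡2 M≡1 = union-c11 (- (+ 1 * (y * M)))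
  (byResidues 12 (con 6 :* x₀ ≈ 6 ⇒ con 6 :* x₁ ≈ 6 ⇒ con 4 :* (con 16 :* x₀) ≈ 8 ⇒ con 4 :* x₁ ≈ 4 ⇒
      con 2 :* (:- (con 1 :* (x₀ :* x₁))) ≈ 2)
    (vec₂ y M) e o D≡2 M≡1) (scale₋ (+ 16) (+ 256) (+ 1) (+ 4096) (+ 1) y M n≡ refl (1* M) refl)
even-class-2 {n} n≡ (two⁴ y refl e) (4¹ M f o refl) D≡2 M≡1 = union-c12 (- (+ 1 * (y * M)))
  (byResidues 12 (con 4 :* (con 16 :* x₀) ≈ 8 ⇒ con 4 :* (con 4 :* x₁) ≈ 4 ⇒ con 4 :* (:- (con 1 :* (x₀ :* x₁))) ≈ 4)
      (vec₂ y M) D≡2 M≡1)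
  (scale₋ (+ 16) (+ 256) (+ 4) (+ 16384) (+ 1) y M n≡ refl refl refl)
even-class-2 {n} n≡ (two⁴ y refl e) (4² M f o refl) D≡2 M≡1 = union-c12 (- (+ 4 * (y * M)))
  (byResidues 12 (con 4 :* (con 16 :* x₀) ≈ 8 ⇒ con 4 :* (con 16 :* x₁) ≈ 4 ⇒ con 4 :* (:- (con 4 :* (x₀ :* x₁))) ≈ 4)
      (vec₂ y M) D≡2 M≡1)
  (scale₋ (+ 16) (+ 256) (+ 16) (+ 16384) (+ 4) y M n≡ refl refl refl)
even-class-2 {n} n≡ (two⁴ y refl e) (4³ M refl) D≡2 M≡1 = union-c12 (- (+ 16 * (y * M)))
  (byResidues 12 (con 4 :* (con 16 :* x₀) ≈ 8 ⇒ con 4 :* (con 64 :* x₁) ≈ 4 ⇒ con 4 :* (:- (con 16 :* (x₀ :* x₁))) ≈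
      4) (vec₂ y M) D≡2 M≡1)
  (scale₋ (+ 16) (+ 256) (+ 64) (+ 16384) (+ 16) y M n≡ refl refl refl)
even-class-2 {n} {_} {M} n≡ (two⁶ y refl) _ D≡2 M≡1 = union-c12 (- (+ 1 * (y * M)))
  (byResidues 12 (con 4 :* (con 64 :* x₀) ≈ 8 ⇒ con 4 :* x₁ ≈ 4 ⇒ con 4 :* (:- (con 1 :* (x₀ :* x₁))) ≈ 4) (vec₂ y M)
      D≡2 M≡1)
  (scale₋ (+ 64) (+ 256) (+ 1) (+ 16384) (+ 1) y M n≡ refl (1* M) refl)

-- Sorted by powers of 2 as in residue 2, with one factor 3 from D and one from the norm; now no
-- residue mod 3 has to be tracked in the cofactor.
even-class-0 : ∀ {n D M} → n ≡ D * (+ 768 * M) → TripleIntegerPart D → TwoAdic M → (+ 4 * M) %ℕ 12 ≡ 4 → Union n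
even-class-0 {n} {_} {M} n≡ (odd d refl r) (4⁰ f o) M≡1 = by-norm (odd-norm-1-or-7 M f o M≡1)
  where
  by-norm : M %ℕ 12 ≡ 1 ⊎ CofactorOfPrime7 M → Union n
  by-norm (inj₁ ≡1) = union-b4 (+ 1 * (d * M))
      (byResidues 12 (con 3 :* x₀ ≈ 9 ⇒ x₁ ≈ 1 ⇒ con 3 :* (con 1 :* (x₀ :* x₁)) ≈ 9) (vec₂ d M) r ≡1)
    (scale₊ (+ 3) (+ 768) (+ 1) (+ 2304) (+ 1) d M n≡ refl (1* M) refl)
  -- A multiple of p needs only 2⁶ · 3²; the surplus factor 4 goes into the free parameter.
  by-norm (inj₂ (l , p , p7 , l≡1 , e)) = union-b3 (+ 4 * (d * l)) p p7
    (scaleₚ (+ 3) (+ 768) (+ 1) (+ 576) (+ 4) d l (+ p) n≡ refl (trans (1* M) (cong (λ z → + 1 * z) e)) refl)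
even-class-0 {n} n≡ (odd d refl r) (4¹ M f o refl) M≡1 =
    by-norm (odd-norm-1-or-7 M f o (byResidues 12 (con 4 :* (con 4 :* x₀) ≈ 4 ⇒ con 4 :* x₀ ≈ 4) (vec₁ M) M≡1))
  where
  by-norm : M %ℕ 12 ≡ 1 ⊎ CofactorOfPrime7 M → Union n
  by-norm (inj₁ ≡1) = union-b5 (+ 1 * (d * M))
      (byResidues 12 (con 3 :* x₀ ≈ 9 ⇒ x₁ ≈ 1 ⇒ con 3 :* (con 1 :* (x₀ :* x₁)) ≈ 9) (vec₂ d M) r ≡1)
    (scale₊ (+ 3) (+ 768) (+ 4) (+ 9216) (+ 1) d M n≡ refl refl refl)
  by-norm (inj₂ (l , p , p7 , l≡1 , e)) = union-b3 (+ 16 * (d * l)) p p7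
    (scaleₚ (+ 3) (+ 768) (+ 4) (+ 576) (+ 16) d l (+ p) n≡ refl (cong (λ z → + 4 * z) e) refl)
even-class-0 n≡ (odd d refl r) (4² M f o refl) M≡1 = union-b6 (+ 1 * (d * M))
  (byResidues 12 (con 3 :* x₀ ≈ 9 ⇒ con 6 :* x₁ ≈ 6 ⇒ con 6 :* (con 1 :* (x₀ :* x₁)) ≈ 6) (vec₂ d M) r o)
  (scale₊ (+ 3) (+ 768) (+ 16) (+ 36864) (+ 1) d M n≡ refl refl refl)
even-class-0 n≡ (odd d refl r) (4³ M refl) M≡1 = union-b7 (+ 1 * (d * M))
    (scale₊ (+ 3) (+ 768) (+ 64) (+ 147456) (+ 1) d M n≡ refl refl refl)
even-class-0 {M = M} n≡ (two⁴ y refl e) (4⁰ f o) M≡1 = union-b6 (+ 1 * (y * M))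
  (byResidues 12 (con 6 :* x₀ ≈ 6 ⇒ con 6 :* x₁ ≈ 6 ⇒ con 6 :* (con 1 :* (x₀ :* x₁)) ≈ 6) (vec₂ y M) e o)
  (scale₊ (+ 48) (+ 768) (+ 1) (+ 36864) (+ 1) y M n≡ refl (1* M) refl)
even-class-0 n≡ (two⁴ y refl e) (4¹ M f o refl) M≡1 = union-b7 (+ 1 * (y * M))
    (scale₊ (+ 48) (+ 768) (+ 4) (+ 147456) (+ 1) y M n≡ refl refl refl)
even-class-0 n≡ (two⁴ y refl e) (4² M f o refl) M≡1 = union-b7 (+ 4 * (y * M))
    (scale₊ (+ 48) (+ 768) (+ 16) (+ 147456) (+ 4) y M n≡ refl refl refl)
even-class-0 n≡ (two⁴ y refl e) (4³ M refl) M≡1 = union-b7 (+ 16 * (y * M))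
    (scale₊ (+ 48) (+ 768) (+ 64) (+ 147456) (+ 16) y M n≡ refl refl refl)
even-class-0 {M = M} n≡ (two⁶ y refl) _ M≡1 = union-b7 (+ 1 * (y * M))
    (scale₊ (+ 192) (+ 768) (+ 1) (+ 147456) (+ 1) y M n≡ refl (1* M) refl)

even-multiple-of-3 : ∀ {n D} P Q t → n ≡ D * (+ 256 * norm P Q) → P + Q ≡ + 3 * t → IntegerPart D →
    (+ 4 * D) %ℕ 12 ≡ 0 → Union n
even-multiple-of-3 {n} {D} P Q t n≡ sum≡ D-part D≡0 =
    by-residue (byResidues 12 (con 4 :* N ≈ 0 ∥ con 4 :* N ≈ 4) (vec₂ (P - t) t))
  where
  N : Poly 2
  N = x₀ :* x₀ :- x₀ :* x₁ :+ x₁ :* x₁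
  M = norm (P - t) t
  -- P + Qω is √-3 times an associate of (P - t) + tω
  norm≡ : ∀ P Q t → P + Q ≡ + 3 * t → P * P - P * Q + Q * Q ≡ + 3 * ((P - t) * (P - t) - (P - t) * t + t * t)
  norm≡ P Q t e = by₁ (Q + + 3 * t - + 2 * P) e (solve (P ∷ Q ∷ t ∷ []))
  256·3 : ∀ m → + 256 * (+ 3 * m) ≡ + 768 * m
  256·3 m = sym (ℤₚ.*-assoc (+ 256) (+ 3) m)
  n≡′ : n ≡ D * (+ 768 * M)
  n≡′ = trans n≡ (trans (cong (λ z → D * (+ 256 * z)) (norm≡ P Q t sum≡)) (cong (λ z → D * z) (256·3 M)))
  twenty-seven : (∃[ d ] D ≡ + 3 * d) → (∃[ m ] M ≡ + 3 * m) → Union n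
  twenty-seven (d , e) (m , f) = union-a3 (+ 4 * (d * m)) (scale₊ (+ 3) (+ 768) (+ 3) (+ 1728) (+ 4) d m n≡′ e f refl)
  by-residue : (+ 4 * M) %ℕ 12 ≡ 0 ⊎ (+ 4 * M) %ℕ 12 ≡ 4 → Union n
  by-residue (inj₁ M≡0) = twenty-seven (scaled-multiple 4 3 D D≡0) (scaled-multiple 4 3 M M≡0)
  by-residue (inj₂ M≡1) = even-class-0 n≡′ (tripleIntegerPart D-part D≡0) (two-adic (P - t) t) M≡1

-- D and E share their residue mod √-3. If it is 1, the value is 64 times a number 1 mod 3 and
-- nothing finer is needed; residues 0 and 2 require the exact powers of 2.
even-part : ∀ {n D} P Q k → n ≡ D * (+ 256 * norm P Q) → D ≡ P + Q + + 3 * k → IntegerPart D → Union n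
even-part {n} {D} P Q k n≡ D≡ D-part = by-residue (byResidues 12
    (con 4 :* S ≈ 0 & con 4 :* (x₀ :+ x₁) ≈ 0 ∥ con 4 :* N ≈ 4 & (con 4 :* S ≈ 4 ∥ con 4 :* S ≈ 8)) (vec₃ P Q k))
  where
  S N : Poly 3
  S = x₀ :+ x₁ :+ con 3 :* x₂
  N = x₀ :* x₀ :- x₀ :* x₁ :+ x₁ :* x₁
  transport : ∀ {r} → (+ 4 * (P + Q + + 3 * k)) %ℕ 12 ≡ r → (+ 4 * D) %ℕ 12 ≡ r
  transport {r} = subst (λ z → (+ 4 * z) %ℕ 12 ≡ r) (sym D≡)
  identity : ∀ D M → D * (+ 256 * M) ≡ + 64 * (+ 4 * (D * M))
  identity = solve-∀
  by-residue : _ → Union n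
  by-residue (inj₁ (S≡0 , sum≡0)) = from (scaled-multiple 4 3 (P + Q) sum≡0)
    where
    from : (∃[ t ] P + Q ≡ + 3 * t) → Union n
    from (t , e) = even-multiple-of-3 P Q t n≡ e D-part (transport S≡0)
  by-residue (inj₂ (N≡1 , inj₁ S≡1)) = union-c3 (+ 4 * (D * norm P Q))
    (byResidues 12 (con 4 :* x₀ ≈ 4 ⇒ con 4 :* x₁ ≈ 4 ⇒ con 4 :* (con 4 :* (x₀ :* x₁)) ≈ 4) (vec₂ D (norm P Q))
        (transport S≡1) N≡1)
    (trans n≡ (identity D (norm P Q)))
  by-residue (inj₂ (N≡1 , inj₂ S≡2)) = even-class-2 n≡ D-part (two-adic P Q) (transport S≡2) N≡1

-- w ≡ 1 mod 4 leaves w ≡ 1, 5, 9 mod 12, according to D mod 3; only 5 calls for the divisor k.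
odd-part : ∀ {n D} w e k → n ≡ D * N₁₂ (w - + 6 * e) e → w %ℕ 4 ≡ 1 → D ≡ w + + 3 * k → IntegerPart D → Union n
odd-part {n} {D} w e k n≡ w≡1 D≡ D-part =
    by-residue (byResidues 12 (con 3 :* x₀ ≈ 3 ⇒ x₀ ≈ 1 ∥ x₀ ≈ 5 ∥ x₀ ≈ 9) (vec₁ w) 3w≡3)
  where
  3w≡3 : (+ 3 * w) %ℕ 12 ≡ 3
  3w≡3 = subst (λ z → (+ 3 * z) %ℕ 12 ≡ 3) (sym (quotient-form 4 w 1 w≡1))
      (byResidues 12 (con 3 :* (con 4 :* x₀ :+ con 1) ≈ 3) (vec₁ (w /ℕ 4)))
  transport : ∀ {r} → (+ 4 * (w + + 3 * k)) %ℕ 12 ≡ r → (+ 4 * D) %ℕ 12 ≡ r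
  transport {r} = subst (λ z → (+ 4 * z) %ℕ 12 ≡ r) (sym D≡)
  N : ℤ
  N = N₁₂ (w - + 6 * e) e
  n₁₂ : Poly 2
  n₁₂ = (x₀ :- con 6 :* x₁) :* (x₀ :- con 6 :* x₁) :+ con 12 :* x₁ :* x₁
  class : ∀ w e → w - + 6 * e + + 6 * e ≡ w
  class = solve-∀
  by-residue : w %ℕ 12 ≡ 1 ⊎ w %ℕ 12 ≡ 5 ⊎ w %ℕ 12 ≡ 9 → Union n
  by-residue (inj₁ ≡1) = odd-class-1 n≡ D-part (byResidues 12 (x₀ ≈ 1 ⇒ n₁₂ ≈ 1) (vec₂ w e) ≡1)
    (transport (byResidues 12 (x₀ ≈ 1 ⇒ con 4 :* (x₀ :+ con 3 :* x₁) ≈ 4) (vec₂ w k) ≡1))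
  by-residue (inj₂ (inj₁ ≡5)) = from
      (class-has-kval (w - + 6 * e) e (inj₁ (subst (λ z → z %ℕ 12 ≡ 5) (sym (class w e)) ≡5)))
    where
    from : HasKVal N → Union n
    from (K , kv , divides l f) = odd-class-2 K l n≡ D-part kv f
      (byResidues 12 (x₀ :* x₁ ≈ 1 ⇒ x₁ ≈ 1 ⇒ x₀ ≈ 1) (vec₂ l K)
        (subst (λ z → z %ℕ 12 ≡ 1) f (byResidues 12 (x₀ ≈ 5 ⇒ n₁₂ ≈ 1) (vec₂ w e) ≡5)) (kval≡1 kv))
      (transport (byResidues 12 (x₀ ≈ 5 ⇒ con 4 :* (x₀ :+ con 3 :* x₁) ≈ 8) (vec₂ w k) ≡5))
  by-residue (inj₂ (inj₂ ≡9)) = from (scaled-multiple 4 3 w (byResidues 12 (x₀ ≈ 9 ⇒ con 4 :* x₀ ≈ 0) (vec₁ w) ≡9))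
    where
    -- With w = 3t, E = 3(t - 2e) + 2e√-3 is √-3 times 2e - (t - 2e)√-3.
    norm≡ : ∀ w e t → w ≡ + 3 * t → N₁₂ (w - + 6 * e) e ≡ + 3 * N₃ (+ 2 * e) (t - + 2 * e)
    norm≡ _ e t refl = identity e t
      where
      identity : ∀ e t → (+ 3 * t - + 6 * e) * (+ 3 * t - + 6 * e) + + 12 * e * e ≡
        + 3 * (+ 2 * e * (+ 2 * e) + + 3 * (t - + 2 * e) * (t - + 2 * e))
      identity = solve-∀
    from : (∃[ t ] w ≡ + 3 * t) → Union n
    from (t , f) = odd-class-0 (+ 2 * e) (t - + 2 * e) (trans n≡ (cong (λ z → D * z) (norm≡ w e t f)))
      (tripleIntegerPart D-part (transport (byResidues 12 (x₀ ≈ 9 ⇒ con 4 :* (x₀ :+ con 3 :* x₁) ≈ 0) (vec₂ w k) ≡9)))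
      (subst (λ z → z %ℕ 12 ≡ 9) (norm≡ w e t f) (byResidues 12 (x₀ ≈ 9 ⇒ n₁₂ ≈ 9) (vec₂ w e) ≡9))

-- From the group determinant to the list

_⊖₄_ : Quad → Quad → Quad
quad a b c d ⊖₄ quad a′ b′ c′ d′ = quad (a - a′) (b - b′) (c - c′) (d - d′)

parts⇒union : ∀ {n D N} → n ≡ D * N → IntegerPart D → EisensteinPart D N → Union n
parts⇒union n≡ D-part (odd w e k refl w≡1 D≡) = odd-part w e k n≡ w≡1 D≡ D-part
parts⇒union n≡ D-part (even P Q k refl D≡) = even-part P Q k n≡ D≡ D-part

cancel-⊕ : ∀ a c → (a ⊖₄ c) ⊕ c ≡ a
cancel-⊕ (quad a b c d) (quad a′ b′ c′ d′) =
    trans (cong₂ (λ x y → quad x y (c - c′ + c′) (d - d′ + d′)) (cancel a a′) (cancel b b′))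
  (cong₂ (quad a b) (cancel c c′) (cancel d d′))
  where
  cancel : ∀ x y → x - y + y ≡ x
  cancel = solve-∀

total : ∀ (h : Quad → ℤ) (h-⊕ : ∀ x y → h (x ⊕ y) ≡ h x + h y) p q c → h ((p ⊕ c) ⊕ (q ⊕ c) ⊕ c) ≡ h p + h q + + 3 * h c
total h h-⊕ p q c = trans (trans (h-⊕ ((p ⊕ c) ⊕ (q ⊕ c)) c)
    (cong (_+ h c) (trans (h-⊕ (p ⊕ c) (q ⊕ c)) (cong₂ _+_ (h-⊕ p c) (h-⊕ q c)))))
  (collect (h p) (h q) (h c))
  where
  collect : ∀ x y z → x + z + (y + z) + z ≡ x + y + + 3 * z
  collect = solve-∀

-- The integer factors are the four characters evaluated at the sum of the three coordinates over
-- ℤ₃, so their product is a group determinant of ℤ₂²; the Eisenstein factors are the characters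
-- evaluated at p + qω.
factors⇒union : ∀ {n} p q c → n ≡ factor (h₁ p) (h₁ q) (h₁ c) * factor (h₃ p) (h₃ q) (h₃ c) *
  (factor (h₂ p) (h₂ q) (h₂ c) * factor (h₄ p) (h₄ q) (h₄ c)) → Union n
factors⇒union p@(quad p₁ p₂ p₃ p₄) q@(quad q₁ q₂ q₃ q₄) c@(quad _ _ _ _) n≡ = parts⇒union
    (trans n≡ (separate (h₁ p + h₁ q + + 3 * h₁ c) (h₂ p + h₂ q + + 3 * h₂ c) (h₃ p + h₃ q + + 3 * h₃ c)
        (h₄ p + h₄ q + + 3 * h₄ c)
      (norm (h₁ p) (h₁ q)) (norm (h₂ p) (h₂ q)) (norm (h₃ p) (h₃ q)) (norm (h₄ p) (h₄ q))))
    (subst IntegerPart (cong₂ _*_ (cong₂ _*_ (total h₁ h₁-⊕ p q c) (total h₃ h₃-⊕ p q c))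
        (cong₂ _*_ (total h₂ h₂-⊕ p q c) (total h₄ h₄-⊕ p q c)))
      (integerPart q₁′ q₂′ q₃′ q₄′))
    (FourConjugates.eisensteinPart p₁ p₂ p₃ p₄ q₁ q₂ q₃ q₄ (h₁ c) (h₂ c) (h₃ c) (h₄ c))
  where
  open Quad ((p ⊕ c) ⊕ (q ⊕ c) ⊕ c) using () renaming (q₁ to q₁′; q₂ to q₂′; q₃ to q₃′; q₄ to q₄′)
  separate : ∀ n₁ n₂ n₃ n₄ N₁ N₂ N₃ N₄ → n₁ * N₁ * (n₃ * N₃) * (n₂ * N₂ * (n₄ * N₄)) ≡
      n₁ * n₃ * (n₂ * n₄) * (N₁ * N₃ * (N₂ * N₄))
  separate = solve-∀

S⊆union : ∀ {n} → InS n → Union n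
S⊆union {n} (x , e) = factors⇒union p q c (trans (sym e) (trans (groupDet-factors x) (cong₂ _*_
    (cong₂ _*_ (conjugate h₁ h₁-⊕) (conjugate h₃ h₃-⊕)) (cong₂ _*_ (conjugate h₂ h₂-⊕) (conjugate h₄ h₄-⊕)))))
  where
  a b c p q : Quad
  a = coordA x
  b = coordB x
  c = coordC x
  p = a ⊖₄ c
  q = b ⊖₄ c
  conjugate : ∀ (h : Quad → ℤ) (h-⊕ : ∀ x y → h (x ⊕ y) ≡ h x + h y) → D₃ (h a) (h b) (h c) ≡ factor (h p) (h q) (h c)
  conjugate h h-⊕ = trans (cong₂ (λ a b → D₃ (h a) (h b) (h c)) (sym (cancel-⊕ a c)) (sym (cancel-⊕ b c)))
      (D₃-conjugate h h-⊕ p q c)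

theorem5p2 : (n : ℤ) → (InS n → Union n) × (Union n → InS n)
theorem5p2 n = S⊆union , union⊆S
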